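{- Let $G$ be a minimal non-$4$-choosable planar graph, embedded in the plane, and let $v$ be a vertex of degree $6$ in $G$. Then at least two of the faces incident to $v$ are each incident to at least two vertices of degree at least $5$.
   Context: All graphs are finite, simple and undirected. A graph is $4$-choosable if for every assignment of lists of size $4$ to its vertices there is a proper coloring choosing each vertex's color from its list. A minimal non-$4$-choosable planar graph is a planar graph that is not $4$-choosable and has the minimum number of vertices among such graphs. A face is incident to a vertex if the vertex lies on its boundary. -}

module Defs where

open import Data.Nat using (ℕ; zero; suc; _+_; _*_; _<_; _≤_; _<ᵇ_)
open import Data.Fin using (Fin; toℕ)
open import Data.Bool using (Bool; true; false; not; _∧_)
open import Data.List using (List; length; allFin; filterᵇ; upTo; cartesianProduct)
open import Data.Bool.ListAction using (any)
open import Data.Product using (Σ; ∃; ∃-syntax; _×_; _,_; proj₁; proj₂)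
open import Data.Sum using (_⊎_)
open import Relation.Binary.PropositionalEquality using (_≡_; _≢_)
open import Relation.Nullary using (¬_)

iter : {A : Set} → (A → A) → ℕ → A → A
iter f zero    x = x
iter f (suc k) x = f (iter f k x)

record Graph (n : ℕ) : Set where
  field
    adj    : Fin n → Fin n → Bool
    sym    : ∀ u w → adj u w ≡ adj w u
    irrefl : ∀ u → adj u u ≡ false
open Graph public

module _ {n : ℕ} (G : Graph n) where

  deg : Fin n → ℕ
  deg v = length (filterᵇ (adj G v) (allFin n))

  pairs : List (Fin n × Fin n)
  pairs = cartesianProduct (allFin n) (allFin n)

  isDart : Fin n × Fin n → Bool
  isDart (u , w) = adj G u w

  dartCount : ℕ
  dartCount = length (filterᵇ isDart pairs)

  data Path : Fin n → Fin n → Set where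
    here : ∀ u → Path u u
    step : ∀ {u x w} → adj G u x ≡ true → Path x w → Path u w

  Connected : Set
  Connected = ∀ u w → Path u w

  -- proper colourings from lists of size k (lists = injective maps Fin k → colours)
  Choosable : ℕ → Set
  Choosable k = (L : Fin n → Fin k → ℕ) →
                (∀ v i j → L v i ≡ L v j → i ≡ j) →
                Σ (Fin n → ℕ) λ c →
                  (∀ v → ∃[ i ] L v i ≡ c v) ×
                  (∀ u w → adj G u w ≡ true → c u ≢ c w)

  -- A rotation system (combinatorial embedding): for each vertex u,
  -- rot u is the cyclic successor on the neighbours of u, forming a single cycle.
  record Rotation : Set where
    field
      rot     : Fin n → Fin n → Fin n
      rot-adj : ∀ u w → adj G u w ≡ true → adj G u (rot u w) ≡ true
      rot-cyc : ∀ u w w' → adj G u w ≡ true → adj G u w' ≡ true →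
                ∃[ k ] iter (rot u) k w ≡ w'
  open Rotation public

  module _ (ρ : Rotation) where

    -- face permutation on darts: (u , w) ↦ (w , successor of u around w)
    φ : Fin n × Fin n → Fin n × Fin n
    φ (u , w) = (w , rot ρ w u)

    code : Fin n × Fin n → ℕ
    code (u , w) = toℕ u * n + toℕ w

    -- a dart is the leader of its face if it has the smallest code in its φ-orbit
    -- (orbits have size ≤ number of darts ≤ n * n)
    isLeader : Fin n × Fin n → Bool
    isLeader d = not (any (λ k → code (iter φ k d) <ᵇ code d) (upTo (n * n)))

    faceCount : ℕ
    faceCount = length (filterᵇ (λ d → isDart d ∧ isLeader d) pairs)

    -- the embedding is in the plane (sphere): G connected and Euler's formula
    -- V - E + F = 2, written as 2V + 2F = 4 + 2E = 4 + #darts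
    PlaneEmbedding : Set
    PlaneEmbedding = Connected × (2 * n + 2 * faceCount ≡ 4 + dartCount)

    SameFace : Fin n × Fin n → Fin n × Fin n → Set
    SameFace d d' = ∃[ k ] iter φ k d ≡ d'

    OnFace : Fin n × Fin n → Fin n → Set
    OnFace d x = ∃[ k ] proj₁ (iter φ k d) ≡ x

    RichFace : Fin n × Fin n → Set
    RichFace d = Σ (Fin n) λ x → Σ (Fin n) λ y →
                 x ≢ y × OnFace d x × OnFace d y × 5 ≤ deg x × 5 ≤ deg y

    TwoRichFacesAt : Fin n → Set
    TwoRichFacesAt v = Σ (Fin n × Fin n) λ d₁ → Σ (Fin n × Fin n) λ d₂ →
                       isDart d₁ ≡ true × isDart d₂ ≡ true × ¬ SameFace d₁ d₂ ×
                       OnFace d₁ v × OnFace d₂ v × RichFace d₁ × RichFace d₂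

_⊆ᴳ_ : {n : ℕ} → Graph n → Graph n → Set
G ⊆ᴳ H = ∀ u w → adj G u w ≡ true → adj H u w ≡ true

Planar : {n : ℕ} → Graph n → Set
Planar {n} G = n ≤ 1 ⊎ Σ (Graph n) λ H → G ⊆ᴳ H × Σ (Rotation H) λ ρ → PlaneEmbedding H ρ

MinimalNon4ChoosablePlanar : {n : ℕ} → Graph n → Set
MinimalNon4ChoosablePlanar {n} G =
  Planar G × ¬ Choosable G 4 ×
  (∀ m → m < n → (H : Graph m) → Planar H → Choosable H 4)

{-# OPTIONS --safe #-}
-- Suppose v has degree 6 and at most one rich face. Choose a shortest run w₀, …, w_l of consecutive
-- neighbours of v such that the corners before w₀ and after w_l lie on the same face (all six neighbours
-- if the faces around v are distinct). Splitting v along that face would contradict Euler's formula unless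
-- the wᵢ are the only neighbours of v in their component K of G − v. Following the faces between them, of
-- which at most one is rich, shows that for l > 0 the wᵢ have degree 4 and are connected by vertices of
-- degree 4.
--
-- Planar graphs are closed under contraction, so by minimality every proper contraction of G is
-- 4-choosable. The rest of G − v acts as a gadget that only forbids some colours of v, and a contraction
-- carries it over to another vertex. Hence if some wᵢ has a neighbour p outside a connected set X of
-- vertices of degree 4 containing all wᵢ, then G can be coloured: p is given either the colour of v or a
-- colour outside the list of wᵢ, and X is coloured greedily towards wᵢ. So every neighbour of a wᵢ
-- separates the wᵢ or is one of them, which produces a K₅ minor, although K₅ is not 4-choosable.
-- If l = 0 the edge v w₀ is a bridge and contracting it yields a colouring.

module Submission where

open import Defs renaming (sym to adj-sym; irrefl to adj-irrefl; here to stop; step to move)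
open import Data.Nat using (ℕ; zero; suc; _+_; _*_; _∸_; _<_; _≤_; _<ᵇ_; z≤n; s≤s; _%_; _/_; NonZero)
import Data.Nat.Properties as ℕₚ
open import Data.Nat.DivMod using (m≡m%n+[m/n]*n; m%n<n)
open import Data.Nat.Solver using (module +-*-Solver)
open import Data.Fin using (Fin; zero; suc; toℕ; combine; punchIn; punchOut; _≟_; finToFun; funToFin)
import Data.Fin.Properties as Finₚ
open import Data.Bool using (Bool; true; false; not; _∧_)
open import Data.Bool.Properties using (T-≡; T-∧)
open import Data.Bool.ListAction using (any)
open import Data.List using (List; []; _∷_; _++_; length; map; filter; filterᵇ; tabulate; allFin; upTo; applyUpTo)
open import Data.List.Properties using (length-map; length-++; length-tabulate)
open import Data.List.Membership.Propositional using (_∈_; _∉_; find; lose)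
open import Data.List.Membership.Propositional.Properties
  using (∈-∃++; ∈-++⁻; ∈-++⁺ˡ; ∈-++⁺ʳ; ∈-map⁺; ∈-map⁻; ∈-filter⁺; ∈-filter⁻; ∈-allFin; ∈-cartesianProduct⁺;
         ∈-upTo⁺; ∈-tabulate⁺; ∈-tabulate⁻; ∈-applyUpTo⁺; ∈-applyUpTo⁻)
open import Data.List.Membership.DecPropositional using (_∈?_)
open import Data.List.Relation.Unary.Any as Any using (Any; here; there)
import Data.List.Relation.Unary.Any.Properties as Anyₚ
open import Data.List.Relation.Unary.All as All using ([]; _∷_)
import Data.List.Relation.Unary.All.Properties as Allₚ
open import Data.List.Relation.Unary.AllPairs using ([]; _∷_)
open import Data.List.Relation.Unary.Unique.Propositional using (Unique)
open import Data.List.Relation.Unary.Unique.Propositional.Properties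
  using (allFin⁺; cartesianProduct⁺; filter⁺; map⁺; ++⁺; tabulate⁺; applyUpTo⁺₁)
open import Data.Maybe using (Maybe; just; nothing)
open import Data.Maybe.Properties using (just-injective)
open import Data.Product using (Σ; ∃; ∃-syntax; _×_; _,_; proj₁; proj₂)
open import Data.Product.Properties using (≡-dec)
open import Data.Sum using (_⊎_; inj₁; inj₂; [_,_]; [_,_]′)
open import Data.Empty using (⊥; ⊥-elim)
open import Function using (_∘_; mk⇔; Equivalence)
open import Relation.Binary.Definitions using (tri<; tri≈; tri>)
open import Relation.Binary.PropositionalEquality
  using (_≡_; _≢_; refl; sym; trans; cong; cong₂; subst; module ≡-Reasoning)
open import Relation.Nullary using (¬_; Dec; yes; no; does)
open import Relation.Nullary.Decidable using (T?; _×-dec_; _⊎-dec_; _→-dec_; ¬?; does-⇔; dec-true; dec-false; map′)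

-- A face may occupy several corners of a cut vertex, so corners cannot be counted as faces. Since
-- the run is shortest, the corners before its members lie on pairwise distinct faces, and since `v`
-- itself has degree at least 5, one more such vertex makes a face rich. Two rich corners of the run
-- therefore already prove the theorem. The number 6 bounds the neighbours of `v` in K. A piece of K
-- that lies among them and hangs on a single attachment vertex has at least three vertices, as its
-- members have degree at least 4 and send at most two edges out of it, to `v` and to the
-- attachment. Two disjoint pieces then use up all six neighbours and are triangles. Without
-- attachments each neighbour of `v` in K is joined to at least three others, hence misses at most
-- two; both a triangle among them and an independent triple around one of them then give a K₅
-- minor. Minimality enters by contraction only, because contraction keeps a map connected, as the
-- Euler count requires.

-- Counting with duplicate-free lists, and iterates of a function

length-⊆ : ∀ {A : Set} {xs ys : List A} → Unique xs → (∀ {x} → x ∈ xs → x ∈ ys) → length xs ≤ length ys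
length-⊆ {xs = []} _ _ = z≤n
length-⊆ {A} {x ∷ xs} (x∉xs ∷ uniq) sub with ∈-∃++ (sub (here refl))
... | as , bs , refl = begin
    suc (length xs)               ≤⟨ s≤s (length-⊆ uniq sub′) ⟩
    suc (length (as ++ bs))       ≡⟨ cong suc (length-++ as) ⟩
    suc (length as + length bs)   ≡⟨ ℕₚ.+-suc (length as) (length bs) ⟨
    length as + suc (length bs)   ≡⟨ length-++ as ⟨
    length (as ++ x ∷ bs)         ∎
  where
  open ℕₚ.≤-Reasoning
  sub′ : ∀ {z} → z ∈ xs → z ∈ as ++ bs
  sub′ z∈ with ∈-++⁻ as (sub (there z∈))
  ... | inj₁ z∈as          = ∈-++⁺ˡ z∈as
  ... | inj₂ (here refl)   = ⊥-elim (All.lookup x∉xs z∈ refl)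
  ... | inj₂ (there z∈bs)  = ∈-++⁺ʳ as z∈bs

module _ {A : Set} (f : A → A) where

  iter-+ : ∀ j k x → iter f (j + k) x ≡ iter f j (iter f k x)
  iter-+ zero    k x = refl
  iter-+ (suc j) k x = cong f (iter-+ j k x)

  iter-shift : ∀ k x → iter f k (f x) ≡ f (iter f k x)
  iter-shift zero    x = refl
  iter-shift (suc k) x = cong f (iter-shift k x)

  iter-* : ∀ q p x → iter f p x ≡ x → iter f (q * p) x ≡ x
  iter-* zero    p x eq = refl
  iter-* (suc q) p x eq = begin
    iter f (p + q * p) x         ≡⟨ iter-+ p (q * p) x ⟩
    iter f p (iter f (q * p) x)  ≡⟨ cong (iter f p) (iter-* q p x eq) ⟩
    iter f p x                   ≡⟨ eq ⟩
    x                            ∎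
    where open ≡-Reasoning

  iter-% : ∀ k p .{{_ : NonZero p}} x → iter f p x ≡ x → iter f k x ≡ iter f (k % p) x
  iter-% k p x eq = begin
    iter f k x                              ≡⟨ cong (λ m → iter f m x) (m≡m%n+[m/n]*n k p) ⟩
    iter f (k % p + (k / p) * p) x          ≡⟨ iter-+ (k % p) _ x ⟩
    iter f (k % p) (iter f ((k / p) * p) x) ≡⟨ cong (iter f (k % p)) (iter-* (k / p) p x eq) ⟩
    iter f (k % p) x                        ∎
    where open ≡-Reasoning

-- Rotation systems and their faces

module Adjacency {n : ℕ} (G : Graph n) where

  infix 4 _~_
  _~_ : Fin n → Fin n → Set
  u ~ w = adj G u w ≡ true

  ~-sym : ∀ {u w} → u ~ w → w ~ u
  ~-sym {u} {w} uw = trans (adj-sym G w u) uw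

  ~⇒≢ : ∀ {u w} → u ~ w → u ≢ w
  ~⇒≢ {u} uw refl with () ← trans (sym uw) (adj-irrefl G u)

  _~?_ : ∀ u w → Dec (u ~ w)
  u ~? w = adj G u w Data.Bool.≟ true

  Dart : Fin n × Fin n → Set
  Dart d = isDart G d ≡ true

  pairs-unique : Unique (pairs G)
  pairs-unique = cartesianProduct⁺ (allFin⁺ n) (allFin⁺ n)

  ∈-pairs : ∀ d → d ∈ pairs G
  ∈-pairs (u , w) = ∈-cartesianProduct⁺ (∈-allFin u) (∈-allFin w)

  darts : List (Fin n × Fin n)
  darts = filterᵇ (isDart G) (pairs G)

  darts-unique : Unique darts
  darts-unique = filter⁺ (λ d → T? (isDart G d)) pairs-unique

  ∈-darts⁺ : ∀ {d} → Dart d → d ∈ darts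
  ∈-darts⁺ {d} dart = ∈-filter⁺ (λ d → T? (isDart G d)) (∈-pairs d) (Equivalence.from T-≡ dart)

  ∈-darts⁻ : ∀ {d} → d ∈ darts → Dart d
  ∈-darts⁻ d∈ = Equivalence.to T-≡ (proj₂ (∈-filter⁻ (λ d → T? (isDart G d)) {xs = pairs G} d∈))

  nbrs : Fin n → List (Fin n)
  nbrs v = filterᵇ (adj G v) (allFin n)

  nbrs-unique : ∀ v → Unique (nbrs v)
  nbrs-unique v = filter⁺ (λ w → T? (adj G v w)) (allFin⁺ n)

  ∈-nbrs⁺ : ∀ {v w} → v ~ w → w ∈ nbrs v
  ∈-nbrs⁺ {v} {w} vw = ∈-filter⁺ (λ w → T? (adj G v w)) (∈-allFin w) (Equivalence.from T-≡ vw)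

  ∈-nbrs⁻ : ∀ {v w} → w ∈ nbrs v → v ~ w
  ∈-nbrs⁻ {v} w∈ = Equivalence.to T-≡ (proj₂ (∈-filter⁻ (λ w → T? (adj G v w)) {xs = allFin n} w∈))

module Faces {n : ℕ} (G : Graph n) (ρ : Rotation G) where
  open Adjacency G public

  -- `rot-cyc` provides reachability only. If `w` and `w′` have the same successor `z`, then `z`
  -- recurs after `suc k₁` and after `suc k₂` steps, so both are reached from `z` after (1 + k₁)(1 +
  -- k₂) - 1 steps.
  rot-injective : ∀ {u w w′} → u ~ w → u ~ w′ → rot ρ u w ≡ rot ρ u w′ → w ≡ w′
  rot-injective {u} {w} {w′} uw uw′ eq = begin
    w                                 ≡⟨ e₁ ⟨
    iter r k₁ z                       ≡⟨ cong (iter r k₁) (iter-* r k₂ (suc k₁) z (cong r e₁)) ⟨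
    iter r k₁ (iter r (k₂ * suc k₁) z) ≡⟨ iter-+ r k₁ (k₂ * suc k₁) z ⟨
    iter r (k₁ + k₂ * suc k₁) z       ≡⟨ cong (λ m → iter r m z) arith ⟩
    iter r (k₂ + k₁ * suc k₂) z       ≡⟨ iter-+ r k₂ (k₁ * suc k₂) z ⟩
    iter r k₂ (iter r (k₁ * suc k₂) z) ≡⟨ cong (iter r k₂) (iter-* r k₁ (suc k₂) z (trans (cong r e₂) (sym eq))) ⟩
    iter r k₂ z                       ≡⟨ e₂ ⟩
    w′                                ∎
    where
    open ≡-Reasoning
    open +-*-Solver using (solve; _:=_; _:+_; _:*_; con)
    r = rot ρ u
    z = r w
    uz = rot-adj ρ u w uw
    k₁ = proj₁ (rot-cyc ρ u z w uz uw)
    e₁ = proj₂ (rot-cyc ρ u z w uz uw)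
    k₂ = proj₁ (rot-cyc ρ u z w′ uz uw′)
    e₂ = proj₂ (rot-cyc ρ u z w′ uz uw′)
    arith : k₁ + k₂ * suc k₁ ≡ k₂ + k₁ * suc k₂
    arith = solve 2 (λ a b → a :+ b :* (con 1 :+ a) := b :+ a :* (con 1 :+ b)) refl k₁ k₂

  iter-rot-adj : ∀ {u w} k → u ~ w → u ~ iter (rot ρ u) k w
  iter-rot-adj zero    uw = uw
  iter-rot-adj {u} (suc k) uw = rot-adj ρ u _ (iter-rot-adj k uw)

  rot-period : ∀ {u w} → u ~ w → ∃[ k ] iter (rot ρ u) (suc k) w ≡ w
  rot-period {u} {w} uw with rot-cyc ρ u (rot ρ u w) w (rot-adj ρ u w uw) uw
  ... | k , eq = k , trans (sym (iter-shift (rot ρ u) k w)) eq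

  pred : ∀ {u w} → u ~ w → ∃[ x ] (u ~ x × rot ρ u x ≡ w)
  pred uw with rot-period uw
  ... | k , eq = _ , iter-rot-adj k uw , eq

  rot-≢ : ∀ {u w x} → u ~ w → u ~ x → w ≢ x → rot ρ u w ≢ w
  rot-≢ {u} {w} {x} uw ux w≢x fix with rot-cyc ρ u w x uw ux
  ... | k , eq = w≢x (trans (sym (fixed k)) eq)
    where
    fixed : ∀ k → iter (rot ρ u) k w ≡ w
    fixed zero    = refl
    fixed (suc k) = trans (cong (rot ρ u) (fixed k)) fix

  ϕ : Fin n × Fin n → Fin n × Fin n
  ϕ = φ G ρ

  ϕ-dart : ∀ {d} → Dart d → Dart (ϕ d)
  ϕ-dart {u , w} dart = rot-adj ρ w u (~-sym dart)

  iter-ϕ-dart : ∀ k {d} → Dart d → Dart (iter ϕ k d)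
  iter-ϕ-dart zero    dart = dart
  iter-ϕ-dart (suc k) {d} dart = ϕ-dart {iter ϕ k d} (iter-ϕ-dart k dart)

  ϕ-injective : ∀ {d e} → Dart d → Dart e → ϕ d ≡ ϕ e → d ≡ e
  ϕ-injective {u , w} {u′ , w′} dd de eq with refl ← cong proj₁ eq =
    cong (_, w) (rot-injective (~-sym dd) (~-sym de) (cong proj₂ eq))

  iter-ϕ-cancel : ∀ i {d e} → Dart d → Dart e → iter ϕ i d ≡ iter ϕ i e → d ≡ e
  iter-ϕ-cancel zero    dd de eq = eq
  iter-ϕ-cancel (suc i) dd de eq =
    iter-ϕ-cancel i dd de (ϕ-injective (iter-ϕ-dart i dd) (iter-ϕ-dart i de) eq)

  -- Two of the first n * n + 1 iterates coincide, and cancelling `ϕ` moves the coincidence back to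
  -- `d`.
  period : ∀ {d} → Dart d → ∃[ p ] (suc p ≤ n * n × iter ϕ (suc p) d ≡ d)
  period {d} dd with Finₚ.pigeonhole {n * n} (ℕₚ.n<1+n (n * n)) (λ i → enc (iter ϕ (toℕ i) d))
    where
    enc : Fin n × Fin n → Fin (n * n)
    enc (a , b) = combine a b
  ... | i , j , i<j , eq = toℕ j ∸ suc (toℕ i) , bound , sym (iter-ϕ-cancel (toℕ i) dd (iter-ϕ-dart m dd) eq′)
    where
    m = suc (toℕ j ∸ suc (toℕ i))
    split : toℕ i + m ≡ toℕ j
    split = trans (ℕₚ.+-suc (toℕ i) _) (ℕₚ.m+[n∸m]≡n i<j)
    bound : m ≤ n * n
    bound = ℕₚ.≤-trans (ℕₚ.≤-trans (ℕₚ.m≤n+m m (toℕ i)) (ℕₚ.≤-reflexive split)) (ℕₚ.≤-pred (Finₚ.toℕ<n j))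
    same : iter ϕ (toℕ i) d ≡ iter ϕ (toℕ j) d
    same = let a , b = iter ϕ (toℕ i) d ; a′ , b′ = iter ϕ (toℕ j) d
               a≡ , b≡ = Finₚ.combine-injective {n} {n} a b a′ b′ eq
           in cong₂ _,_ a≡ b≡
    eq′ : iter ϕ (toℕ i) d ≡ iter ϕ (toℕ i) (iter ϕ m d)
    eq′ = trans same (trans (cong (λ k → iter ϕ k d) (sym split)) (iter-+ ϕ (toℕ i) m d))

  bounded : ∀ {d} → Dart d → ∀ k → ∃[ j ] (j < n * n × iter ϕ k d ≡ iter ϕ j d)
  bounded {d} dd k with period dd
  ... | p , p≤ , eq = k % suc p , ℕₚ.<-≤-trans (m%n<n k (suc p)) p≤ , iter-% ϕ k (suc p) d eq

  orbit-sym : ∀ {d} → Dart d → ∀ k → ∃[ j ] iter ϕ j (iter ϕ k d) ≡ d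
  orbit-sym {d} dd k with period dd
  ... | p , _ , eq = k * p , trans (sym (iter-+ ϕ (k * p) k d))
          (trans (cong (λ m → iter ϕ m d) arith) (iter-* ϕ k (suc p) d eq))
    where
    arith : k * p + k ≡ k * suc p
    arith = trans (ℕₚ.+-comm (k * p) k) (sym (ℕₚ.*-suc k p))

  code′ : Fin n × Fin n → ℕ
  code′ = code G ρ

  code-injective : ∀ {d e} → code′ d ≡ code′ e → d ≡ e
  code-injective {u , w} {u′ , w′} eq = cong₂ _,_ (proj₁ inj) (proj₂ inj)
    where
    conv : ∀ (a b : Fin n) → toℕ (combine a b) ≡ toℕ a * n + toℕ b
    conv a b = trans (Finₚ.toℕ-combine a b) (cong (_+ toℕ b) (ℕₚ.*-comm n (toℕ a)))
    inj = Finₚ.combine-injective u w u′ w′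
            (Finₚ.toℕ-injective (trans (conv u w) (trans eq (sym (conv u′ w′)))))

  best : ℕ → Fin n × Fin n → Fin n × Fin n
  best zero    d = d
  best (suc m) d with code′ (iter ϕ (suc m) d) ℕₚ.<? code′ (best m d)
  ... | yes _ = iter ϕ (suc m) d
  ... | no  _ = best m d

  best-orbit : ∀ m d → ∃[ k ] best m d ≡ iter ϕ k d
  best-orbit zero    d = 0 , refl
  best-orbit (suc m) d with code′ (iter ϕ (suc m) d) ℕₚ.<? code′ (best m d)
  ... | yes _ = suc m , refl
  ... | no  _ = best-orbit m d

  best-≤ : ∀ m d {k} → k ≤ m → code′ (best m d) ≤ code′ (iter ϕ k d)
  best-≤ zero    d z≤n = ℕₚ.≤-refl
  best-≤ (suc m) d {k} k≤ with code′ (iter ϕ (suc m) d) ℕₚ.<? code′ (best m d) | ℕₚ.m≤n⇒m<n∨m≡n k≤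
  ... | yes lt | inj₁ (s≤s k≤m) = ℕₚ.≤-trans (ℕₚ.<⇒≤ lt) (best-≤ m d k≤m)
  ... | yes lt | inj₂ refl      = ℕₚ.≤-refl
  ... | no ¬lt | inj₁ (s≤s k≤m) = best-≤ m d k≤m
  ... | no ¬lt | inj₂ refl      = ℕₚ.≮⇒≥ ¬lt

  abstract
    -- The leader of the face of `d` in the sense of `isLeader`: n * n iterates cover the whole
    -- orbit. The search is abstract so that it is never unfolded later.
    face : Fin n × Fin n → Fin n × Fin n
    face = best (n * n)

    face-orbit : ∀ d → ∃[ k ] face d ≡ iter ϕ k d
    face-orbit = best-orbit (n * n)

    face-≤ : ∀ {d} → Dart d → ∀ k → code′ (face d) ≤ code′ (iter ϕ k d)
    face-≤ {d} dd k with bounded dd k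
    ... | j , j< , eq = subst (λ e → code′ (face d) ≤ code′ e) (sym eq) (best-≤ (n * n) d (ℕₚ.<⇒≤ j<))

  face-dart : ∀ {d} → Dart d → Dart (face d)
  face-dart {d} dd with face-orbit d
  ... | k , eq = subst Dart (sym eq) (iter-ϕ-dart k dd)

  face-iter : ∀ {d} → Dart d → ∀ k → face (iter ϕ k d) ≡ face d
  face-iter {d} dd k = code-injective (ℕₚ.≤-antisym upper lower)
    where
    d′ = iter ϕ k d
    dd′ = iter-ϕ-dart k dd
    lower : code′ (face d) ≤ code′ (face d′)
    lower with face-orbit d′
    ... | j , eq = subst (λ e → code′ (face d) ≤ code′ e) (trans (iter-+ ϕ j k d) (sym eq)) (face-≤ dd (j + k))
    upper : code′ (face d′) ≤ code′ (face d)
    upper with face-orbit d | orbit-sym dd k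
    ... | j , eq | m , back = subst (λ e → code′ (face d′) ≤ code′ e)
            (trans (iter-+ ϕ j m d′) (trans (cong (iter ϕ j) back) (sym eq))) (face-≤ dd′ (j + m))

  face-ϕ : ∀ {d} → Dart d → face (ϕ d) ≡ face d
  face-ϕ dd = face-iter dd 1

  sameFace⇒face≡ : ∀ {d e} → Dart d → SameFace G ρ d e → face d ≡ face e
  sameFace⇒face≡ dd (k , refl) = sym (face-iter dd k)

  leader⇒≤ : ∀ {d} → Dart d → isLeader G ρ d ≡ true → ∀ k → code′ d ≤ code′ (iter ϕ k d)
  leader⇒≤ {d} dd lead k with bounded dd k
  ... | j , j< , eq = subst (λ e → code′ d ≤ code′ e) (sym eq) (ℕₚ.≮⇒≥ not<)
    where
    p = λ k → code′ (iter ϕ k d) <ᵇ code′ d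
    not< : ¬ code′ (iter ϕ j d) < code′ d
    not< lt with () ← trans (sym lead) (cong not (Equivalence.to T-≡
      (Anyₚ.any⁺ p (lose {P = Data.Bool.T ∘ p} (∈-upTo⁺ j<) (ℕₚ.<⇒<ᵇ lt)))))

  ≤⇒leader : ∀ {d} → (∀ k → code′ d ≤ code′ (iter ϕ k d)) → isLeader G ρ d ≡ true
  ≤⇒leader {d} le with any (λ k → code′ (iter ϕ k d) <ᵇ code′ d) (upTo (n * n))
                     | Anyₚ.any⁻ (λ k → code′ (iter ϕ k d) <ᵇ code′ d) (upTo (n * n))
  ... | false | _ = refl
  ... | true  | f with find (f _)
  ...   | k , _ , t = ⊥-elim (ℕₚ.<⇒≱ (ℕₚ.<ᵇ⇒< _ _ t) (le k))

  private
    keep : Fin n × Fin n → Bool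
    keep d = isDart G d ∧ isLeader G ρ d

  faces : List (Fin n × Fin n)
  faces = filterᵇ keep (pairs G)

  faces-unique : Unique faces
  faces-unique = filter⁺ (λ d → T? (keep d)) pairs-unique

  ∈-faces⁻ : ∀ {d} → d ∈ faces → Dart d × face d ≡ d
  ∈-faces⁻ {d} d∈ with Equivalence.to T-∧ (proj₂ (∈-filter⁻ (λ d → T? (keep d)) {xs = pairs G} d∈))
  ... | td , tl = dd , code-injective (ℕₚ.≤-antisym (face-≤ dd 0) back)
    where
    dd = Equivalence.to T-≡ td
    back : code′ d ≤ code′ (face d)
    back with face-orbit d
    ... | k , eq = subst (λ e → code′ d ≤ code′ e) (sym eq) (leader⇒≤ dd (Equivalence.to T-≡ tl) k)

  face∈faces : ∀ {d} → Dart d → face d ∈ faces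
  face∈faces {d} dd = ∈-filter⁺ (λ d → T? (keep d)) (∈-pairs (face d))
    (Equivalence.from T-∧ (Equivalence.from T-≡ (face-dart dd) , Equivalence.from T-≡ (≤⇒leader le)))
    where
    le : ∀ k → code′ (face d) ≤ code′ (iter ϕ k (face d))
    le k with face-orbit d
    ... | j , eq = subst (λ e → code′ (face d) ≤ code′ e)
            (trans (iter-+ ϕ k j d) (cong (iter ϕ k) (sym eq))) (face-≤ dd (k + j))

  -- Faces of a modified map are never enumerated. A labelling of its darts that is constant along
  -- `φ` takes one value per face, so the values attained bound the number of faces from below;
  -- every modification below uses labels derived from the old faces.
  labels≤faceCount : ∀ {A : Set} (ℓ : Fin n × Fin n → A) → (∀ {d} → Dart d → ℓ (ϕ d) ≡ ℓ d) →
    (as : List A) → Unique as → (∀ {a} → a ∈ as → ∃[ d ] (Dart d × ℓ d ≡ a)) → length as ≤ faceCount G ρ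
  labels≤faceCount ℓ inv as uniq att =
    subst (length as ≤_) (length-map ℓ faces) (length-⊆ uniq sub)
    where
    inv-iter : ∀ k {d} → Dart d → ℓ (iter ϕ k d) ≡ ℓ d
    inv-iter zero    dd = refl
    inv-iter (suc k) dd = trans (inv (iter-ϕ-dart k dd)) (inv-iter k dd)
    sub : ∀ {a} → a ∈ as → a ∈ map ℓ faces
    sub a∈ with att a∈
    ... | d , dd , refl with face-orbit d
    ...   | k , eq = subst (_∈ map ℓ faces) (trans (cong ℓ eq) (inv-iter k dd)) (∈-map⁺ ℓ (face∈faces dd))

does⇒ : ∀ {A : Set} (a? : Dec A) → does a? ≡ true → A
does⇒ (yes a) _ = a

-- Modifying plane maps

-- The rotation at a single vertex, so that rotations can be edited vertex by vertex. What `r` does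
-- outside `P` is left open and need not be repaired by an edit.
record Cyclic {A : Set} (P : A → Set) (r : A → A) : Set where
  constructor cyclic
  field
    preserves : ∀ {w} → P w → P (r w)
    cycle  : ∀ {w w′} → P w → P w′ → ∃[ k ] iter r k w ≡ w′
open Cyclic public

Cyclic-resp : ∀ {A : Set} {P Q : A → Set} {r : A → A} → (∀ {w} → P w → Q w) → (∀ {w} → Q w → P w) →
              Cyclic P r → Cyclic Q r
Cyclic-resp to from (cyclic cl cy) = cyclic (to ∘ cl ∘ from) (λ p q → cy (from p) (from q))

module _ {A : Set} {P Keep : A → Set} (keep? : ∀ w → Dec (Keep w)) (r : A → A) where

  skip : A → A
  skip w with keep? (r w)
  ... | yes _ = r w
  ... | no  _ = r (r w)

  -- `skip` jumps over one element at most, hence the condition that no two consecutive elements are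
  -- dropped.
  skip-cyclic : Cyclic P r → (∀ {w} → P w → ¬ Keep w → Keep (r w)) →
                Cyclic (λ w → P w × Keep w) skip
  skip-cyclic C apart = cyclic cl (λ (p , k) (p′ , k′) → let j , eq = cycle C p p′ in go j p k k′ eq)
    where
    cl : ∀ {w} → P w × Keep w → P (skip w) × Keep (skip w)
    cl {w} (p , k) with keep? (r w)
    ... | yes k′ = preserves C p , k′
    ... | no ¬k′ = preserves C (preserves C p) , apart (preserves C p) ¬k′

    go : ∀ k {w w′} → P w → Keep w → Keep w′ → iter r k w ≡ w′ → ∃[ j ] iter skip j w ≡ w′
    go zero p kw kw′ eq = 0 , eq
    go (suc k) {w} {w′} p kw kw′ eq with keep? (r w) in keq
    ... | yes k′ with go k (preserves C p) k′ kw′ (trans (iter-shift r k w) eq)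
    ...   | j , eq′ = suc j , trans (sym (iter-shift skip j w)) (trans (cong (iter skip j) sw) eq′)
      where
      sw : skip w ≡ r w
      sw rewrite keq = refl
    go (suc zero) {w} p kw kw′ refl | no ¬k′ = ⊥-elim (¬k′ kw′)
    go (suc (suc k)) {w} p kw kw′ eq | no ¬k′
      with go k (preserves C (preserves C p)) (apart (preserves C p) ¬k′) kw′
             (trans (iter-shift r k (r w)) (trans (cong r (iter-shift r k w)) eq))
    ... | j , eq′ = suc j , trans (sym (iter-shift skip j w)) (trans (cong (iter skip j) sw) eq′)
      where
      sw : skip w ≡ r (r w)
      sw rewrite keq = refl

module _ {n : ℕ} (v x : Fin n) (r : Fin n → Fin n) where

  insertAfter : Fin n → Fin n
  insertAfter w with w ≟ x
  ... | yes _ = r v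
  ... | no  _ with w ≟ v
  ...   | yes _ = x
  ...   | no  _ = r w

  insertAfter-new : insertAfter x ≡ r v
  insertAfter-new with x ≟ x
  ... | yes _  = refl
  ... | no x≢x = ⊥-elim (x≢x refl)

  insertAfter-at : v ≢ x → insertAfter v ≡ x
  insertAfter-at v≢x with v ≟ x
  ... | yes v≡x = ⊥-elim (v≢x v≡x)
  ... | no  _ with v ≟ v
  ...   | yes _  = refl
  ...   | no v≢v = ⊥-elim (v≢v refl)

  insertAfter-old : ∀ {w} → w ≢ x → w ≢ v → insertAfter w ≡ r w
  insertAfter-old {w} w≢x w≢v with w ≟ x
  ... | yes w≡x = ⊥-elim (w≢x w≡x)
  ... | no  _ with w ≟ v
  ...   | yes w≡v = ⊥-elim (w≢v w≡v)
  ...   | no  _   = refl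

  insertAfter-cyclic : ∀ {P : Fin n → Set} → Cyclic P r → P v → ¬ P x → Cyclic (λ w → P w ⊎ w ≡ x) insertAfter
  insertAfter-cyclic {P} C Pv ¬Px = cyclic cl cy
    where
    s = insertAfter
    P⇒≢x : ∀ {w} → P w → w ≢ x
    P⇒≢x p refl = ¬Px p
    cl : ∀ {w} → P w ⊎ w ≡ x → P (s w) ⊎ s w ≡ x
    cl (inj₂ refl) = inj₁ (subst P (sym insertAfter-new) (preserves C Pv))
    cl {w} (inj₁ p) with w ≟ v
    ... | yes refl = inj₂ (insertAfter-at (P⇒≢x p))
    ... | no w≢v   = inj₁ (subst P (sym (insertAfter-old (P⇒≢x p) w≢v)) (preserves C p))
    go : ∀ k {w w′} → P w → iter r k w ≡ w′ → ∃[ j ] iter s j w ≡ w′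
    go zero p eq = 0 , eq
    go (suc k) {w} {w′} p eq with go k (preserves C p) (trans (iter-shift r k w) eq) | w ≟ v
    ... | j , eq′ | no w≢v = suc j , trans (sym (iter-shift s j w))
                                     (trans (cong (iter s j) (insertAfter-old (P⇒≢x p) w≢v)) eq′)
    ... | j , eq′ | yes refl = suc (suc j) , (begin
        s (s (iter s j v))  ≡⟨ cong s (iter-shift s j v) ⟨
        s (iter s j (s v))  ≡⟨ iter-shift s j (s v) ⟨
        iter s j (s (s v))  ≡⟨ cong (iter s j) (trans (cong s (insertAfter-at (P⇒≢x p))) insertAfter-new) ⟩
        iter s j (r v)      ≡⟨ eq′ ⟩
        w′                  ∎)
      where open ≡-Reasoning
    toNew : ∀ {w} → P w → ∃[ j ] iter s j w ≡ x
    toNew p with cycle C p Pv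
    ... | k , eq with go k p eq
    ...   | j , eq′ = suc j , trans (cong s eq′) (insertAfter-at (P⇒≢x Pv))
    cy : ∀ {w w′} → P w ⊎ w ≡ x → P w′ ⊎ w′ ≡ x → ∃[ k ] iter s k w ≡ w′
    cy (inj₂ refl) (inj₂ refl) = 0 , refl
    cy (inj₁ p)    (inj₂ refl) = toNew p
    cy (inj₁ p)    (inj₁ p′)   = let k , eq = cycle C p p′ in go k p eq
    cy (inj₂ refl) (inj₁ p′) with cycle C (preserves C Pv) p′
    ... | k , eq with go k (preserves C Pv) eq
    ...   | j , eq′ = suc j , trans (sym (iter-shift s j x)) (trans (cong (iter s j) insertAfter-new) eq′)

-- K bounds twice the Euler characteristic from below. Lower bounds are all that the constructions have to
-- provide: that K ≤ 4 always holds is euler-≤.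
record PlaneMap (K n : ℕ) : Set where
  constructor planeMap
  field
    graph     : Graph n
    rotation  : Rotation graph
    connected : Connected graph
    euler     : K + dartCount graph ≤ 2 * n + 2 * faceCount graph rotation
open PlaneMap public

rotation-cyclic : ∀ {n} {G : Graph n} (ρ : Rotation G) u → Cyclic (λ w → adj G u w ≡ true) (rot ρ u)
rotation-cyclic ρ u = cyclic (λ {w} → rot-adj ρ u w) (λ {w} {w′} → rot-cyc ρ u w w′)

cyclic-rotation : ∀ {n} {G : Graph n} (r : Fin n → Fin n → Fin n) →
                  (∀ u → Cyclic (λ w → adj G u w ≡ true) (r u)) → Rotation G
cyclic-rotation r C = record
  { rot = r ; rot-adj = λ u w → preserves (C u) ; rot-cyc = λ u w w′ → cycle (C u) }

module MkGraph {n : ℕ} {R : Fin n → Fin n → Set} (R? : ∀ a b → Dec (R a b))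
               (R-sym : ∀ {a b} → R a b → R b a) (R-irrefl : ∀ {a} → ¬ R a a) where

  mkGraph : Graph n
  mkGraph = record
    { adj    = λ a b → does (R? a b)
    ; sym    = λ a b → does-⇔ (mk⇔ R-sym R-sym) (R? a b) (R? b a)
    ; irrefl = λ a → dec-false (R? a a) R-irrefl }

  adj⁻ : ∀ {a b} → adj mkGraph a b ≡ true → R a b
  adj⁻ {a} {b} = does⇒ (R? a b)

  adj⁺ : ∀ {a b} → R a b → adj mkGraph a b ≡ true
  adj⁺ {a} {b} = dec-true (R? a b)

module _ {n : ℕ} {G : Graph n} where

  infixr 5 _⊙_
  _⊙_ : ∀ {a b c} → Path G a b → Path G b c → Path G a c
  stop _   ⊙ q = q
  move e p ⊙ q = move e (p ⊙ q)

  path-sym : ∀ {a b} → Path G a b → Path G b a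
  path-sym (stop u) = stop u
  path-sym (move {u} {x} e p) = path-sym p ⊙ move (trans (adj-sym G x u) e) (stop u)

path-map : ∀ {m n} {G : Graph m} {H : Graph n} (f : Fin m → Fin n) →
           (∀ {a b} → adj G a b ≡ true → Path H (f a) (f b)) → ∀ {a b} → Path G a b → Path H (f a) (f b)
path-map f e (stop u)   = stop (f u)
path-map f e (move s p) = e s ⊙ path-map f e p

_≟ᵈ_ : ∀ {n} (d e : Fin n × Fin n) → Dec (d ≡ e)
_≟ᵈ_ = ≡-dec _≟_ _≟_

-- The triangle v x y keeps the graph connected when v x is deleted; the faces on the two sides of v x merge.
module Delete {K n : ℕ} (M : PlaneMap K n) {v x y : Fin n}
  (vx : adj (graph M) v x ≡ true) (vy : adj (graph M) v y ≡ true) (xy : adj (graph M) x y ≡ true) where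

  private
    G = graph M
    ρ = rotation M
  open Faces G ρ

  private
    v≢x = ~⇒≢ vx
    x≢y = ~⇒≢ xy
    v≢y = ~⇒≢ vy

  Gone : Fin n → Fin n → Set
  Gone a b = (a ≡ v × b ≡ x) ⊎ (a ≡ x × b ≡ v)

  gone? : ∀ a b → Dec (Gone a b)
  gone? a b = (a ≟ v ×-dec b ≟ x) ⊎-dec (a ≟ x ×-dec b ≟ v)

  gone-sym : ∀ {a b} → Gone a b → Gone b a
  gone-sym (inj₁ (p , q)) = inj₂ (q , p)
  gone-sym (inj₂ (p , q)) = inj₁ (q , p)

  open MkGraph {n} {λ a b → a ~ b × ¬ Gone a b} (λ a b → (a ~? b) ×-dec ¬? (gone? a b))
    (λ (e , ¬g) → ~-sym e , ¬g ∘ gone-sym) (λ (e , _) → ~⇒≢ e refl)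
    renaming (mkGraph to G′) public

  -- Both `v` and `x` have the further neighbour `y`, so the removed neighbour is not its own
  -- successor.
  gone-apart : ∀ {u w} → u ~ w → Gone u w → ¬ Gone u (rot ρ u w)
  gone-apart uw (inj₁ (refl , refl)) (inj₁ (_ , q)) = rot-≢ vx vy x≢y q
  gone-apart uw (inj₁ (refl , refl)) (inj₂ (p , _)) = v≢x p
  gone-apart uw (inj₂ (refl , refl)) (inj₁ (p , _)) = v≢x (sym p)
  gone-apart uw (inj₂ (refl , refl)) (inj₂ (_ , q)) = rot-≢ (~-sym vx) xy v≢y q

  rot′ : Fin n → Fin n → Fin n
  rot′ u = skip {P = u ~_} (λ w → ¬? (gone? u w)) (rot ρ u)

  ρ′ : Rotation G′
  ρ′ = cyclic-rotation rot′ λ u → Cyclic-resp adj⁺ adj⁻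
    (skip-cyclic (λ w → ¬? (gone? u w)) (rot ρ u) (rotation-cyclic ρ u)
      (λ {w} uw ¬¬g → case-gone (gone? u w) uw ¬¬g))
    where
    case-gone : ∀ {u w} → Dec (Gone u w) → u ~ w → ¬ ¬ Gone u w → ¬ Gone u (rot ρ u w)
    case-gone (yes g) uw _  = gone-apart uw g
    case-gone (no ¬g) uw ¬¬g = ⊥-elim (¬¬g ¬g)

  open Faces G′ ρ′ using () renaming (Dart to Dart′; labels≤faceCount to labels≤faceCount′;
    darts to darts′; darts-unique to darts-unique′; ∈-darts⁻ to ∈-darts⁻′)

  connected′ : Connected G′
  connected′ a b = path-map (λ u → u) edge (connected M a b)
    where
    v~y = adj⁺ (vy , λ { (inj₁ (_ , q)) → x≢y (sym q) ; (inj₂ (p , _)) → v≢x p })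
    y~x = adj⁺ (~-sym xy , λ { (inj₁ (p , _)) → v≢y (sym p) ; (inj₂ (p , _)) → x≢y (sym p) })
    detour : Path G′ v x
    detour = move v~y (move y~x (stop x))
    edge : ∀ {a b} → a ~ b → Path G′ a b
    edge {a} {b} ab with gone? a b
    ... | yes (inj₁ (refl , refl)) = detour
    ... | yes (inj₂ (refl , refl)) = path-sym detour
    ... | no ¬g                    = move (adj⁺ (ab , ¬g)) (stop b)

  dartCount′ : 2 + dartCount G′ ≤ dartCount G
  dartCount′ = length-⊆ {xs = (v , x) ∷ (x , v) ∷ darts′}
    (((λ eq → v≢x (cong proj₁ eq)) ∷ All.tabulate λ d∈ eq → out (inj₁ (refl , refl)) (subst (_∈ darts′) (sym eq) d∈))
     ∷ (All.tabulate λ d∈ eq → out (inj₂ (refl , refl)) (subst (_∈ darts′) (sym eq) d∈))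
     ∷ darts-unique′)
    λ { (here refl) → ∈-darts⁺ vx ; (there (here refl)) → ∈-darts⁺ (~-sym vx)
      ; (there (there d∈)) → ∈-darts⁺ (proj₁ (adj⁻ (∈-darts⁻′ d∈))) }
    where
    out : ∀ {a b} → Gone a b → (a , b) ∉ darts′
    out g d∈ = proj₂ (adj⁻ (∈-darts⁻′ d∈)) g

  private
    f₁ = face (v , x)
    f₂ = face (x , v)

  merge : Fin n × Fin n → Fin n × Fin n
  merge f with f ≟ᵈ f₁
  ... | yes _ = f₂
  ... | no  _ = f

  merge-f₁ : merge f₁ ≡ f₂
  merge-f₁ with f₁ ≟ᵈ f₁
  ... | yes _ = refl
  ... | no ne = ⊥-elim (ne refl)

  merge-f₂ : merge f₂ ≡ f₂
  merge-f₂ with f₂ ≟ᵈ f₁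
  ... | yes _ = refl
  ... | no _  = refl

  merge-≢ : ∀ {f} → f ≢ f₁ → merge f ≡ f
  merge-≢ {f} f≢ with f ≟ᵈ f₁
  ... | yes eq = ⊥-elim (f≢ eq)
  ... | no _   = refl

  label-inv : ∀ {d} → Dart′ d → merge (face (φ G′ ρ′ d)) ≡ merge (face d)
  label-inv {a , b} dd with proj₁ (adj⁻ dd) | gone? b (rot ρ b a)
  ... | ab | no _ = cong merge (face-ϕ ab)
  ... | ab | yes (inj₁ (refl , q)) = begin
      merge (face (v , rot ρ v (rot ρ v a)))  ≡⟨ cong (λ z → merge (face (v , rot ρ v z))) q ⟩
      merge (face (ϕ (x , v)))                ≡⟨ cong merge (face-ϕ (~-sym vx)) ⟩
      merge f₂                                ≡⟨ merge-f₂ ⟩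
      f₂                                      ≡⟨ merge-f₁ ⟨
      merge f₁                                ≡⟨ cong (λ z → merge (face (v , z))) q ⟨
      merge (face (ϕ (a , v)))                ≡⟨ cong merge (face-ϕ ab) ⟩
      merge (face (a , v))                    ∎
    where open ≡-Reasoning
  ... | ab | yes (inj₂ (refl , q)) = begin
      merge (face (x , rot ρ x (rot ρ x a)))  ≡⟨ cong (λ z → merge (face (x , rot ρ x z))) q ⟩
      merge (face (ϕ (v , x)))                ≡⟨ cong merge (face-ϕ vx) ⟩
      merge f₁                                ≡⟨ merge-f₁ ⟩
      f₂                                      ≡⟨ merge-f₂ ⟨
      merge f₂                                ≡⟨ cong (λ z → merge (face (x , z))) q ⟨
      merge (face (ϕ (a , x)))                ≡⟨ cong merge (face-ϕ ab) ⟩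
      merge (face (a , x))                    ∎
    where open ≡-Reasoning

  private
    other? : ∀ f → Dec (f ≢ f₁)
    other? f = ¬? (f ≟ᵈ f₁)

  attained : ∀ {f} → f ∈ filter other? faces → ∃[ d ] (Dart′ d × merge (face d) ≡ f)
  attained {f} f∈ with ∈-filter⁻ other? {xs = faces} f∈
  ... | f∈faces , f≢ with f ≟ᵈ f₂
  -- The leader may be the deleted dart itself, so the next dart on the face stands in for it.
  ...   | yes refl = ϕ (x , v)
            , adj⁺ (ϕ-dart {x , v} (~-sym vx) , λ { (inj₁ (_ , q)) → rot-≢ vx vy x≢y q ; (inj₂ (p , _)) → v≢x p })
            , trans (cong merge (face-ϕ (~-sym vx))) merge-f₂
  ...   | no f≢f₂ with ∈-faces⁻ f∈faces
  ...     | df , ff = f , adj⁺ (df , λ { (inj₁ (refl , refl)) → f≢ (sym ff) ; (inj₂ (refl , refl)) → f≢f₂ (sym ff) })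
                        , trans (cong merge ff) (merge-≢ f≢)

  faceCount′ : faceCount G ρ ≤ 1 + faceCount G′ ρ′
  faceCount′ = ℕₚ.≤-trans
    (length-⊆ {ys = f₁ ∷ filter other? faces} faces-unique sub)
    (s≤s (labels≤faceCount′ (merge ∘ face) label-inv (filter other? faces) (filter⁺ other? faces-unique) attained))
    where
    sub : ∀ {f} → f ∈ faces → f ∈ f₁ ∷ filter other? faces
    sub {f} f∈ with f ≟ᵈ f₁
    ... | yes eq = here eq
    ... | no ne  = there (∈-filter⁺ other? f∈ ne)

  deleted : PlaneMap K n
  deleted = planeMap G′ ρ′ connected′ (ℕₚ.+-cancelˡ-≤ 2 _ _ (begin
    2 + (K + dartCount G′)          ≡⟨ solve 2 (λ k d → con 2 :+ (k :+ d) := k :+ (con 2 :+ d)) refl K (dartCount G′) ⟩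
    K + (2 + dartCount G′)          ≤⟨ ℕₚ.+-monoʳ-≤ K dartCount′ ⟩
    K + dartCount G                 ≤⟨ euler M ⟩
    2 * n + 2 * faceCount G ρ       ≤⟨ ℕₚ.+-monoʳ-≤ (2 * n) (ℕₚ.*-monoʳ-≤ 2 faceCount′) ⟩
    2 * n + 2 * (1 + faceCount G′ ρ′) ≡⟨ solve 2 (λ a b → con 2 :* a :+ con 2 :* (con 1 :+ b) := con 2 :+ (con 2 :* a :+ con 2 :* b)) refl n (faceCount G′ ρ′) ⟩
    2 + (2 * n + 2 * faceCount G′ ρ′) ∎))
    where
    open ℕₚ.≤-Reasoning
    open +-*-Solver using (solve; _:=_; _:+_; _:*_; con)

-- Joining two cyclically consecutive neighbours x, y of v cuts off a triangular face.
module Ear {K n : ℕ} (M : PlaneMap K n) {v x y : Fin n}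
  (vx : adj (graph M) v x ≡ true) (vy : adj (graph M) v y ≡ true)
  (next : rot (rotation M) v x ≡ y) (x≁y : ¬ adj (graph M) x y ≡ true) (x≢y : x ≢ y) where

  private
    G = graph M
    ρ = rotation M
  open Faces G ρ

  private
    v≢x = ~⇒≢ vx
    v≢y = ~⇒≢ vy
    -- `q` precedes `v` around `x`. Placing `y` right after `q` there, and `x` right after `v`
    -- around `y`, draws the new edge inside the corner of `v` between `x` and `y`.
    q   = proj₁ (pred (~-sym vx))
    xq  = proj₁ (proj₂ (pred (~-sym vx)))
    rq  = proj₂ (proj₂ (pred (~-sym vx)))
    q≢y : q ≢ y
    q≢y refl = x≁y xq
    y≁x : ¬ y ~ x
    y≁x yx = x≁y (~-sym yx)

  New : Fin n → Fin n → Set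
  New a b = (a ≡ x × b ≡ y) ⊎ (a ≡ y × b ≡ x)

  new? : ∀ a b → Dec (New a b)
  new? a b = (a ≟ x ×-dec b ≟ y) ⊎-dec (a ≟ y ×-dec b ≟ x)

  new-sym : ∀ {a b} → New a b → New b a
  new-sym (inj₁ (p , r)) = inj₂ (r , p)
  new-sym (inj₂ (p , r)) = inj₁ (r , p)

  new-irrefl : ∀ {a} → ¬ New a a
  new-irrefl (inj₁ (p , r)) = x≢y (trans (sym p) r)
  new-irrefl (inj₂ (p , r)) = x≢y (trans (sym r) p)

  open MkGraph {n} {λ a b → a ~ b ⊎ New a b} (λ a b → (a ~? b) ⊎-dec new? a b)
    [ inj₁ ∘ ~-sym , inj₂ ∘ new-sym ] [ (λ e → ~⇒≢ e refl) , new-irrefl ]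
    renaming (mkGraph to G′) public

  rot′ : Fin n → Fin n → Fin n
  rot′ u with u ≟ x | u ≟ y
  ... | yes _ | _     = insertAfter q y (rot ρ x)
  ... | no _  | yes _ = insertAfter v x (rot ρ y)
  ... | no _  | no _  = rot ρ u

  rot′-x : rot′ x ≡ insertAfter q y (rot ρ x)
  rot′-x with x ≟ x | x ≟ y
  ... | yes _  | _ = refl
  ... | no x≢x | _ = ⊥-elim (x≢x refl)

  rot′-y : rot′ y ≡ insertAfter v x (rot ρ y)
  rot′-y with y ≟ x | y ≟ y
  ... | yes eq | _     = ⊥-elim (x≢y (sym eq))
  ... | no _   | yes _ = refl
  ... | no _   | no ne = ⊥-elim (ne refl)

  rot′-other : ∀ {u} → u ≢ x → u ≢ y → rot′ u ≡ rot ρ u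
  rot′-other {u} u≢x u≢y with u ≟ x | u ≟ y
  ... | yes eq | _      = ⊥-elim (u≢x eq)
  ... | no _   | yes eq = ⊥-elim (u≢y eq)
  ... | no _   | no _   = refl

  ρ′ : Rotation G′
  ρ′ = cyclic-rotation rot′ λ u → cyc u (u ≟ x) (u ≟ y)
    where
    cyc : ∀ u → Dec (u ≡ x) → Dec (u ≡ y) → Cyclic (λ w → adj G′ u w ≡ true) (rot′ u)
    cyc u (yes refl) _ = subst (Cyclic _) (sym rot′-x)
      (Cyclic-resp (adj⁺ ∘ [ inj₁ , (λ e → inj₂ (inj₁ (refl , e))) ])
        ([ inj₁ , [ inj₂ ∘ proj₂ , (λ (e , _) → ⊥-elim (x≢y e)) ] ] ∘ adj⁻)
        (insertAfter-cyclic q y (rot ρ x) (rotation-cyclic ρ x) xq x≁y))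
    cyc u (no _) (yes refl) = subst (Cyclic _) (sym rot′-y)
      (Cyclic-resp (adj⁺ ∘ [ inj₁ , (λ e → inj₂ (inj₂ (refl , e))) ])
        ([ inj₁ , [ (λ (e , _) → ⊥-elim (x≢y (sym e))) , inj₂ ∘ proj₂ ] ] ∘ adj⁻)
        (insertAfter-cyclic v x (rot ρ y) (rotation-cyclic ρ y) (~-sym vy) y≁x))
    cyc u (no u≢x) (no u≢y) = subst (Cyclic _) (sym (rot′-other u≢x u≢y))
      (Cyclic-resp (adj⁺ ∘ inj₁)
        ([ (λ e → e) , [ (λ (e , _) → ⊥-elim (u≢x e)) , (λ (e , _) → ⊥-elim (u≢y e)) ] ] ∘ adj⁻)
        (rotation-cyclic ρ u))

  open Faces G′ ρ′ using () renaming (Dart to Dart′; labels≤faceCount to labels≤faceCount′;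
    darts to darts′; darts-unique to darts-unique′; ∈-darts⁻ to ∈-darts⁻′)

  connected′ : Connected G′
  connected′ a b = path-map (λ u → u) (λ e → move (adj⁺ (inj₁ e)) (stop _)) (connected M a b)

  dartCount′ : dartCount G′ ≤ 2 + dartCount G
  dartCount′ = length-⊆ {ys = (x , y) ∷ (y , x) ∷ darts} darts-unique′ sub
    where
    sub : ∀ {d} → d ∈ darts′ → d ∈ (x , y) ∷ (y , x) ∷ darts
    sub {a , b} d∈ with adj⁻ (∈-darts⁻′ d∈)
    ... | inj₁ ab                   = there (there (∈-darts⁺ ab))
    ... | inj₂ (inj₁ (refl , refl)) = here refl
    ... | inj₂ (inj₂ (refl , refl)) = there (here refl)

  Tri : Fin n × Fin n → Set
  Tri d = d ≡ (x , v) ⊎ d ≡ (v , y) ⊎ d ≡ (y , x)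

  tri? : ∀ d → Dec (Tri d)
  tri? d = d ≟ᵈ (x , v) ⊎-dec d ≟ᵈ (v , y) ⊎-dec d ≟ᵈ (y , x)

  -- nothing labels the new triangle; the rest of the cut face keeps its old label.
  ℓ : Fin n × Fin n → Maybe (Fin n × Fin n)
  ℓ d with tri? d | d ≟ᵈ (x , y)
  ... | yes _ | _     = nothing
  ... | no _  | yes _ = just (face (x , v))
  ... | no _  | no _  = just (face d)

  ℓ-tri : ∀ {d} → Tri d → ℓ d ≡ nothing
  ℓ-tri {d} t with tri? d | d ≟ᵈ (x , y)
  ... | yes _ | _ = refl
  ... | no ¬t | _ = ⊥-elim (¬t t)

  ℓ-xy : ℓ (x , y) ≡ just (face (x , v))
  ℓ-xy with tri? (x , y) | (x , y) ≟ᵈ (x , y)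
  ... | yes (inj₁ eq)        | _     = ⊥-elim (v≢y (sym (cong proj₂ eq)))
  ... | yes (inj₂ (inj₁ eq)) | _     = ⊥-elim (v≢x (sym (cong proj₁ eq)))
  ... | yes (inj₂ (inj₂ eq)) | _     = ⊥-elim (x≢y (cong proj₁ eq))
  ... | no _                 | yes _ = refl
  ... | no _                 | no ne = ⊥-elim (ne refl)

  ℓ-old : ∀ {d} → ¬ Tri d → d ≢ (x , y) → ℓ d ≡ just (face d)
  ℓ-old {d} ¬t ne with tri? d | d ≟ᵈ (x , y)
  ... | yes t | _      = ⊥-elim (¬t t)
  ... | no _  | yes eq = ⊥-elim (ne eq)
  ... | no _  | no _   = refl

  ℓ-old₁ : ∀ {a b} → b ≢ x → b ≢ y → b ≢ v → ℓ (a , b) ≡ just (face (a , b))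
  ℓ-old₁ b≢x b≢y b≢v = ℓ-old
    (λ { (inj₁ refl) → b≢v refl ; (inj₂ (inj₁ refl)) → b≢y refl ; (inj₂ (inj₂ refl)) → b≢x refl })
    (λ { refl → b≢y refl })

  ℓ-old₂ : ∀ {a b} → a ≢ x → a ≢ y → a ≢ v → ℓ (a , b) ≡ just (face (a , b))
  ℓ-old₂ a≢x a≢y a≢v = ℓ-old
    (λ { (inj₁ refl) → a≢x refl ; (inj₂ (inj₁ refl)) → a≢v refl ; (inj₂ (inj₂ refl)) → a≢y refl })
    (λ { refl → a≢x refl })

  face-xv : face (v , y) ≡ face (x , v)
  face-xv = trans (cong (λ z → face (v , z)) (sym next)) (face-ϕ {x , v} (~-sym vx))

  label-inv : ∀ {d} → Dart′ d → ℓ (φ G′ ρ′ d) ≡ ℓ d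
  label-inv {a , b} dd with adj⁻ dd
  ... | inj₂ (inj₁ (refl , refl)) = begin
      ℓ (y , rot′ y x)              ≡⟨ cong (λ r → ℓ (y , r x)) rot′-y ⟩
      ℓ (y , insertAfter v x (rot ρ y) x) ≡⟨ cong (λ z → ℓ (y , z)) (insertAfter-new v x (rot ρ y)) ⟩
      ℓ (y , rot ρ y v)             ≡⟨ ℓ-old (λ { (inj₁ e) → x≢y (sym (cong proj₁ e)) ; (inj₂ (inj₁ e)) → v≢y (sym (cong proj₁ e))
                                                ; (inj₂ (inj₂ e)) → y≁x (subst (y ~_) (cong proj₂ e) (rot-adj ρ y v (~-sym vy))) })
                                             (λ e → x≢y (sym (cong proj₁ e))) ⟩
      just (face (ϕ (v , y)))       ≡⟨ cong just (trans (face-ϕ {v , y} vy) face-xv) ⟩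
      just (face (x , v))           ≡⟨ ℓ-xy ⟨
      ℓ (x , y)                     ∎
    where open ≡-Reasoning
  ... | inj₂ (inj₂ (refl , refl)) = begin
      ℓ (x , rot′ x y)              ≡⟨ cong (λ r → ℓ (x , r y)) rot′-x ⟩
      ℓ (x , insertAfter q y (rot ρ x) y) ≡⟨ cong (λ z → ℓ (x , z)) (trans (insertAfter-new q y (rot ρ x)) rq) ⟩
      ℓ (x , v)                     ≡⟨ ℓ-tri (inj₁ refl) ⟩
      nothing                       ≡⟨ ℓ-tri (inj₂ (inj₂ refl)) ⟨
      ℓ (y , x)                     ∎
    where open ≡-Reasoning
  ... | inj₁ ab = old (b ≟ x) (b ≟ y) (b ≟ v) (a ≟ q) (a ≟ v) (a ≟ x)
    where
    open ≡-Reasoning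
    old : Dec (b ≡ x) → Dec (b ≡ y) → Dec (b ≡ v) → Dec (a ≡ q) → Dec (a ≡ v) → Dec (a ≡ x) →
          ℓ (b , rot′ b a) ≡ ℓ (a , b)
    old (yes refl) _ _ (yes refl) _ _ = begin
      ℓ (x , rot′ x q)              ≡⟨ cong (λ r → ℓ (x , r q)) rot′-x ⟩
      ℓ (x , insertAfter q y (rot ρ x) q) ≡⟨ cong (λ z → ℓ (x , z)) (insertAfter-at q y (rot ρ x) q≢y) ⟩
      ℓ (x , y)                     ≡⟨ ℓ-xy ⟩
      just (face (x , v))           ≡⟨ cong (λ z → just (face (x , z))) rq ⟨
      just (face (ϕ (q , x)))       ≡⟨ cong just (face-ϕ {q , x} ab) ⟩
      just (face (q , x))           ≡⟨ ℓ-old (λ { (inj₁ e) → v≢x (sym (cong proj₂ e)) ; (inj₂ (inj₁ e)) → x≢y (cong proj₂ e)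
                                                ; (inj₂ (inj₂ e)) → q≢y (cong proj₁ e) }) (λ e → x≢y (cong proj₂ e)) ⟨
      ℓ (q , x)                     ∎
    old (yes refl) _ _ (no a≢q) _ _ = begin
      ℓ (x , rot′ x a)              ≡⟨ cong (λ r → ℓ (x , r a)) rot′-x ⟩
      ℓ (x , insertAfter q y (rot ρ x) a) ≡⟨ cong (λ z → ℓ (x , z)) (insertAfter-old q y (rot ρ x) a≢y a≢q) ⟩
      ℓ (x , rot ρ x a)             ≡⟨ ℓ-old (λ { (inj₁ e) → a≢q (rot-injective (~-sym ab) xq (trans (cong proj₂ e) (sym rq)))
                                                ; (inj₂ (inj₁ e)) → v≢x (sym (cong proj₁ e)) ; (inj₂ (inj₂ e)) → x≢y (cong proj₁ e) })
                                             (λ e → x≁y (subst (x ~_) (cong proj₂ e) (rot-adj ρ x a (~-sym ab)))) ⟩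
      just (face (ϕ (a , x)))       ≡⟨ cong just (face-ϕ {a , x} ab) ⟩
      just (face (a , x))           ≡⟨ ℓ-old (λ { (inj₁ e) → v≢x (sym (cong proj₂ e)) ; (inj₂ (inj₁ e)) → x≢y (cong proj₂ e)
                                                ; (inj₂ (inj₂ e)) → a≢y (cong proj₁ e) }) (λ e → x≢y (cong proj₂ e)) ⟨
      ℓ (a , x)                     ∎
      where
      a≢y : a ≢ y
      a≢y refl = y≁x ab
    old (no b≢x) (yes refl) _ _ (yes refl) _ = begin
      ℓ (y , rot′ y v)              ≡⟨ cong (λ r → ℓ (y , r v)) rot′-y ⟩
      ℓ (y , insertAfter v x (rot ρ y) v) ≡⟨ cong (λ z → ℓ (y , z)) (insertAfter-at v x (rot ρ y) v≢x) ⟩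
      ℓ (y , x)                     ≡⟨ ℓ-tri (inj₂ (inj₂ refl)) ⟩
      nothing                       ≡⟨ ℓ-tri (inj₂ (inj₁ refl)) ⟨
      ℓ (v , y)                     ∎
    old (no b≢x) (yes refl) _ _ (no a≢v) _ = begin
      ℓ (y , rot′ y a)              ≡⟨ cong (λ r → ℓ (y , r a)) rot′-y ⟩
      ℓ (y , insertAfter v x (rot ρ y) a) ≡⟨ cong (λ z → ℓ (y , z)) (insertAfter-old v x (rot ρ y) a≢x a≢v) ⟩
      ℓ (y , rot ρ y a)             ≡⟨ ℓ-old (λ { (inj₁ e) → x≢y (sym (cong proj₁ e)) ; (inj₂ (inj₁ e)) → v≢y (sym (cong proj₁ e))
                                                ; (inj₂ (inj₂ e)) → y≁x (subst (y ~_) (cong proj₂ e) (rot-adj ρ y a (~-sym ab))) })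
                                             (λ e → x≢y (sym (cong proj₁ e))) ⟩
      just (face (ϕ (a , y)))       ≡⟨ cong just (face-ϕ {a , y} ab) ⟩
      just (face (a , y))           ≡⟨ ℓ-old (λ { (inj₁ e) → v≢y (sym (cong proj₂ e)) ; (inj₂ (inj₁ e)) → a≢v (cong proj₁ e)
                                                ; (inj₂ (inj₂ e)) → x≢y (sym (cong proj₂ e)) }) (λ e → a≢x (cong proj₁ e)) ⟨
      ℓ (a , y)                     ∎
      where
      a≢x : a ≢ x
      a≢x refl = x≁y ab
    old (no b≢x) (no b≢y) (yes refl) _ _ (yes refl) = begin
      ℓ (v , rot′ v x)              ≡⟨ cong (λ r → ℓ (v , r x)) (rot′-other b≢x b≢y) ⟩
      ℓ (v , rot ρ v x)             ≡⟨ cong (λ z → ℓ (v , z)) next ⟩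
      ℓ (v , y)                     ≡⟨ ℓ-tri (inj₂ (inj₁ refl)) ⟩
      nothing                       ≡⟨ ℓ-tri (inj₁ refl) ⟨
      ℓ (x , v)                     ∎
    old (no b≢x) (no b≢y) (yes refl) _ _ (no a≢x) = begin
      ℓ (v , rot′ v a)              ≡⟨ cong (λ r → ℓ (v , r a)) (rot′-other b≢x b≢y) ⟩
      ℓ (v , rot ρ v a)             ≡⟨ ℓ-old (λ { (inj₁ e) → v≢x (cong proj₁ e)
                                                ; (inj₂ (inj₁ e)) → a≢x (rot-injective (~-sym ab) vx (trans (cong proj₂ e) (sym next)))
                                                ; (inj₂ (inj₂ e)) → v≢y (cong proj₁ e) })
                                             (λ e → v≢x (cong proj₁ e)) ⟩
      just (face (ϕ (a , v)))       ≡⟨ cong just (face-ϕ {a , v} ab) ⟩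
      just (face (a , v))           ≡⟨ ℓ-old (λ { (inj₁ e) → a≢x (cong proj₁ e) ; (inj₂ (inj₁ e)) → v≢y (cong proj₂ e)
                                                ; (inj₂ (inj₂ e)) → v≢x (cong proj₂ e) }) (λ e → v≢y (cong proj₂ e)) ⟨
      ℓ (a , v)                     ∎
    old (no b≢x) (no b≢y) (no b≢v) _ _ _ = begin
      ℓ (b , rot′ b a)              ≡⟨ cong (λ r → ℓ (b , r a)) (rot′-other b≢x b≢y) ⟩
      ℓ (b , rot ρ b a)             ≡⟨ ℓ-old₂ b≢x b≢y b≢v ⟩
      just (face (ϕ (a , b)))       ≡⟨ cong just (face-ϕ {a , b} ab) ⟩
      just (face (a , b))           ≡⟨ ℓ-old₁ b≢x b≢y b≢v ⟨
      ℓ (a , b)                     ∎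

  attained : ∀ {f} → f ∈ nothing ∷ map just faces → ∃[ d ] (Dart′ d × ℓ d ≡ f)
  attained (here refl) = (y , x) , adj⁺ (inj₂ (inj₂ (refl , refl))) , ℓ-tri (inj₂ (inj₂ refl))
  attained (there f∈) with ∈-map⁻ just f∈
  ... | f , f∈faces , refl with ∈-faces⁻ f∈faces
  ...   | df , ff = pick (tri? f)
    where
    -- A leader that now lies on the triangle is replaced by `x y`, which inherits the label of the
    -- cut face.
    cut : ∀ {g} → face g ≡ face (x , v) → g ≡ f → ∃[ d ] (Dart′ d × ℓ d ≡ just f)
    cut fg refl = (x , y) , adj⁺ (inj₂ (inj₁ (refl , refl))) , trans ℓ-xy (cong just (trans (sym fg) ff))
    pick : Dec (Tri f) → ∃[ d ] (Dart′ d × ℓ d ≡ just f)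
    pick (no ¬t) = f , adj⁺ (inj₁ df) , trans (ℓ-old ¬t λ { refl → x≁y df }) (cong just ff)
    pick (yes (inj₁ eq))        = cut refl (sym eq)
    pick (yes (inj₂ (inj₁ eq))) = cut face-xv (sym eq)
    pick (yes (inj₂ (inj₂ refl))) = ⊥-elim (y≁x df)

  faceCount′ : 1 + faceCount G ρ ≤ faceCount G′ ρ′
  faceCount′ = subst (λ m → suc m ≤ faceCount G′ ρ′) (length-map just faces)
    (labels≤faceCount′ ℓ label-inv (nothing ∷ map just faces)
      (Allₚ.map⁺ (All.universal (λ _ ()) faces) ∷ map⁺ just-injective faces-unique) attained)

  withEar : PlaneMap K n
  withEar = planeMap G′ ρ′ connected′ (begin
    K + dartCount G′                ≤⟨ ℕₚ.+-monoʳ-≤ K dartCount′ ⟩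
    K + (2 + dartCount G)           ≡⟨ solve 2 (λ k d → k :+ (con 2 :+ d) := con 2 :+ (k :+ d)) refl K (dartCount G) ⟩
    2 + (K + dartCount G)           ≤⟨ ℕₚ.+-monoʳ-≤ 2 (euler M) ⟩
    2 + (2 * n + 2 * faceCount G ρ) ≡⟨ solve 2 (λ a b → con 2 :+ (con 2 :* a :+ con 2 :* b) := con 2 :* a :+ con 2 :* (con 1 :+ b)) refl n (faceCount G ρ) ⟩
    2 * n + 2 * (1 + faceCount G ρ) ≤⟨ ℕₚ.+-monoʳ-≤ (2 * n) (ℕₚ.*-monoʳ-≤ 2 faceCount′) ⟩
    2 * n + 2 * faceCount G′ ρ′     ∎)
    where
    open ℕₚ.≤-Reasoning
    open +-*-Solver using (solve; _:=_; _:+_; _:*_; con)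

-- The vertex map of the contraction of `v` into `y`, where `y` already carries its number in the
-- smaller graph.
collapse : ∀ {m} → Fin (suc m) → Fin m → Fin (suc m) → Fin m
collapse v y w with v ≟ w
... | yes _   = y
... | no v≢w  = punchOut v≢w

collapse-self : ∀ {m} (v : Fin (suc m)) (y : Fin m) → collapse v y v ≡ y
collapse-self v y with v ≟ v
... | yes _ = refl
... | no ne = ⊥-elim (ne refl)

collapse-punchIn : ∀ {m} (v : Fin (suc m)) (y a : Fin m) → collapse v y (punchIn v a) ≡ a
collapse-punchIn v y a with v ≟ punchIn v a
... | yes eq = ⊥-elim (Finₚ.punchInᵢ≢i v a (sym eq))
... | no ne  = Finₚ.punchOut-punchIn v

punchIn-collapse : ∀ {m} (v : Fin (suc m)) (y : Fin m) {w} → v ≢ w → punchIn v (collapse v y w) ≡ w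
punchIn-collapse v y {w} v≢w with v ≟ w
... | yes eq = ⊥-elim (v≢w eq)
... | no ne  = Finₚ.punchIn-punchOut ne

-- The spur from `y` to the leaf `v` and back lies on one face, so its removal keeps all faces and
-- costs one vertex and one edge, which leaves `K` unchanged. The neighbour `z` is what `y` turns to
-- once `v` is skipped.
module Leaf {K m : ℕ} (M : PlaneMap K (suc m)) (v : Fin (suc m)) (y : Fin m)
  (vy : adj (graph M) v (punchIn v y) ≡ true)
  (only : ∀ {w} → adj (graph M) v w ≡ true → w ≡ punchIn v y)
  {z : Fin (suc m)} (yz : adj (graph M) (punchIn v y) z ≡ true) (v≢z : v ≢ z) where

  private
    G = graph M
    ρ = rotation M
    ↑ = punchIn v
    ↓ = collapse v y
  open Faces G ρ

  G′ : Graph m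
  G′ = record { adj = λ a b → adj G (↑ a) (↑ b) ; sym = λ a b → adj-sym G (↑ a) (↑ b) ; irrefl = λ a → adj-irrefl G (↑ a) }

  private
    keep? : ∀ w → Dec (v ≢ w)
    keep? w = ¬? (v ≟ w)

    ↑≢v : ∀ a → v ≢ ↑ a
    ↑≢v a eq = Finₚ.punchInᵢ≢i v a (sym eq)

    next : rot ρ (↑ y) v ≢ v
    next = rot-≢ (~-sym vy) yz v≢z

  rot⁻ : Fin m → Fin (suc m) → Fin (suc m)
  rot⁻ a = skip {P = ↑ a ~_} keep? (rot ρ (↑ a))

  rot⁻-cyclic : ∀ a → Cyclic (λ w → ↑ a ~ w × v ≢ w) (rot⁻ a)
  rot⁻-cyclic a = skip-cyclic keep? (rot ρ (↑ a)) (rotation-cyclic ρ (↑ a)) apart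
    where
    apart : ∀ {w} → ↑ a ~ w → ¬ v ≢ w → v ≢ rot ρ (↑ a) w
    apart {w} aw ¬¬ eq with v ≟ w
    ... | no ne    = ¬¬ ne
    ... | yes refl = next (trans (cong (λ u → rot ρ u v) (sym (only (~-sym aw)))) (sym eq))

  rot′ : Fin m → Fin m → Fin m
  rot′ a b = ↓ (rot⁻ a (↑ b))

  ↑-rot′ : ∀ {a b} → ↑ a ~ ↑ b → ↑ (rot′ a b) ≡ rot⁻ a (↑ b)
  ↑-rot′ {a} {b} ab = punchIn-collapse v y (proj₂ (preserves (rot⁻-cyclic a) (ab , ↑≢v b)))

  ρ′ : Rotation G′
  ρ′ = cyclic-rotation rot′ λ a → cyclic (cl a) (cy a)
    where
    cl : ∀ a {b} → ↑ a ~ ↑ b → ↑ a ~ ↑ (rot′ a b)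
    cl a {b} ab = subst (↑ a ~_) (sym (↑-rot′ ab)) (proj₁ (preserves (rot⁻-cyclic a) (ab , ↑≢v b)))
    lift : ∀ a k {b} → ↑ a ~ ↑ b → ↑ a ~ ↑ (iter (rot′ a) k b) × ↑ (iter (rot′ a) k b) ≡ iter (rot⁻ a) k (↑ b)
    lift a zero    ab = ab , refl
    lift a (suc k) {b} ab with lift a k ab
    ... | e , eq = cl a e , trans (↑-rot′ e) (cong (rot⁻ a) eq)
    cy : ∀ a {b b′} → ↑ a ~ ↑ b → ↑ a ~ ↑ b′ → ∃[ k ] iter (rot′ a) k b ≡ b′
    cy a {b} {b′} ab ab′ with cycle (rot⁻-cyclic a) (ab , ↑≢v b) (ab′ , ↑≢v b′)
    ... | k , eq = k , Finₚ.punchIn-injective v _ _ (trans (proj₂ (lift a k ab)) eq)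

  open Faces G′ ρ′ using () renaming (Dart to Dart′; labels≤faceCount to labels≤faceCount′;
    darts to darts′; darts-unique to darts-unique′; ∈-darts⁻ to ∈-darts⁻′)

  edge↓ : ∀ {a b} → a ~ b → ↓ a ≡ ↓ b ⊎ adj G′ (↓ a) (↓ b) ≡ true
  edge↓ {a} {b} ab with v ≟ a | v ≟ b
  ... | yes refl | yes refl = ⊥-elim (~⇒≢ ab refl)
  ... | yes refl | no v≢b   = inj₁ (sym (Finₚ.punchIn-injective v _ _ (trans (Finₚ.punchIn-punchOut v≢b) (only ab))))
  ... | no v≢a   | yes refl = inj₁ (Finₚ.punchIn-injective v _ _ (trans (Finₚ.punchIn-punchOut v≢a) (only (~-sym ab))))
  ... | no v≢a   | no v≢b   = inj₂ (trans (cong₂ (adj G) (Finₚ.punchIn-punchOut v≢a) (Finₚ.punchIn-punchOut v≢b)) ab)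

  connected′ : Connected G′
  connected′ a b = subst (λ c → Path G′ c b) (collapse-punchIn v y a)
    (subst (Path G′ (↓ (↑ a))) (collapse-punchIn v y b) (path-map ↓ edge (connected M (↑ a) (↑ b))))
    where
    edge : ∀ {a b} → a ~ b → Path G′ (↓ a) (↓ b)
    edge {a} {b} ab with edge↓ ab
    ... | inj₁ eq = subst (Path G′ (↓ a)) eq (stop (↓ a))
    ... | inj₂ e  = move e (stop _)

  private
    ↑ᵈ : Fin m × Fin m → Fin (suc m) × Fin (suc m)
    ↑ᵈ (a , b) = ↑ a , ↑ b

  dartCount′ : 2 + dartCount G′ ≤ dartCount G
  dartCount′ = subst (λ k → 2 + k ≤ dartCount G) (length-map ↑ᵈ darts′)
    (length-⊆ {xs = (v , ↑ y) ∷ (↑ y , v) ∷ map ↑ᵈ darts′}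
      (((λ eq → ↑≢v y (cong proj₁ eq)) ∷ Allₚ.map⁺ (All.universal (λ d eq → ↑≢v _ (cong proj₁ eq)) darts′))
       ∷ Allₚ.map⁺ (All.universal (λ d eq → ↑≢v _ (cong proj₂ eq)) darts′)
       ∷ map⁺ (λ eq → cong₂ _,_ (Finₚ.punchIn-injective v _ _ (cong proj₁ eq)) (Finₚ.punchIn-injective v _ _ (cong proj₂ eq))) darts-unique′)
      sub)
    where
    sub : ∀ {d} → d ∈ (v , ↑ y) ∷ (↑ y , v) ∷ map ↑ᵈ darts′ → d ∈ darts
    sub (here refl)         = ∈-darts⁺ vy
    sub (there (here refl)) = ∈-darts⁺ (~-sym vy)
    sub (there (there d∈)) with ∈-map⁻ ↑ᵈ d∈
    ... | e , e∈ , refl = ∈-darts⁺ (∈-darts⁻′ e∈)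

  face-turn : face (↑ y , rot ρ (↑ y) v) ≡ face (↑ y , v)
  face-turn = trans (face-ϕ {v , ↑ y} vy) (trans (cong (λ w → face (v , w)) (sym (only (rot-adj ρ v (↑ y) vy))))
    (face-ϕ {↑ y , v} (~-sym vy)))

  label-inv : ∀ {d} → Dart′ d → face (↑ᵈ (φ G′ ρ′ d)) ≡ face (↑ᵈ d)
  label-inv {a , b} ab = trans (cong (λ w → face (↑ b , w)) (↑-rot′ (~-sym ab))) go
    where
    go : face (↑ b , rot⁻ b (↑ a)) ≡ face (↑ a , ↑ b)
    go with v ≟ rot ρ (↑ b) (↑ a)
    ... | no _ = face-ϕ {↑ a , ↑ b} ab
    ... | yes eq = trans step (trans face-turn (trans (sym step′) (face-ϕ {↑ a , ↑ b} ab)))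
      where
      b≡y : ↑ b ≡ ↑ y
      b≡y = only (~-sym (subst (↑ b ~_) (sym eq) (rot-adj ρ (↑ b) (↑ a) (~-sym ab))))
      step : face (↑ b , rot ρ (↑ b) (rot ρ (↑ b) (↑ a))) ≡ face (↑ y , rot ρ (↑ y) v)
      step = trans (cong (λ w → face (↑ b , rot ρ (↑ b) w)) (sym eq)) (cong (λ u → face (u , rot ρ u v)) b≡y)
      step′ : face (↑ b , rot ρ (↑ b) (↑ a)) ≡ face (↑ y , v)
      step′ = trans (cong (λ w → face (↑ b , w)) (sym eq)) (cong (λ u → face (u , v)) b≡y)

  lift-face : ∀ a b → a ~ b → face (a , b) ≡ (a , b) → ∃[ d ] (Dart′ d × face (↑ᵈ d) ≡ (a , b))
  lift-face a b ab ff = pick (v ≟ a) (v ≟ b)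
    where
    -- A leader on the spur is traded for the dart leaving `y` right after it.
    turn : face (↑ y , v) ≡ (a , b) → ∃[ d ] (Dart′ d × face (↑ᵈ d) ≡ (a , b))
    turn eq = (y , ↓ (rot ρ (↑ y) v))
      , subst (↑ y ~_) (sym back) (rot-adj ρ (↑ y) v (~-sym vy))
      , trans (cong (λ w → face (↑ y , w)) back) (trans face-turn eq)
      where
      back = punchIn-collapse v y (next ∘ sym)
    pick : Dec (v ≡ a) → Dec (v ≡ b) → ∃[ d ] (Dart′ d × face (↑ᵈ d) ≡ (a , b))
    pick (yes refl) _ = turn (trans (sym (face-ϕ {↑ y , v} (~-sym vy)))
      (trans (cong (λ w → face (v , w)) (trans (only (rot-adj ρ v (↑ y) vy)) (sym (only ab)))) ff))
    pick (no _) (yes refl) = turn (trans (cong (λ w → face (w , v)) (sym (only (~-sym ab)))) ff)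
    pick (no v≢a) (no v≢b) = (↓ a , ↓ b) , trans (cong₂ (adj G) ea eb) ab
      , trans (cong₂ (λ s t → face (s , t)) ea eb) ff
      where
      ea = punchIn-collapse v y v≢a
      eb = punchIn-collapse v y v≢b

  faceCount′ : faceCount G ρ ≤ faceCount G′ ρ′
  faceCount′ = labels≤faceCount′ (face ∘ ↑ᵈ) (λ {d} → label-inv {d}) faces faces-unique
    λ {f} f∈ → lift-face (proj₁ f) (proj₂ f) (proj₁ (∈-faces⁻ f∈)) (proj₂ (∈-faces⁻ f∈))

  removed : PlaneMap K m
  removed = planeMap G′ ρ′ connected′ (ℕₚ.+-cancelˡ-≤ 2 _ _ (begin
    2 + (K + dartCount G′)          ≡⟨ solve 2 (λ k d → con 2 :+ (k :+ d) := k :+ (con 2 :+ d)) refl K (dartCount G′) ⟩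
    K + (2 + dartCount G′)          ≤⟨ ℕₚ.+-monoʳ-≤ K dartCount′ ⟩
    K + dartCount G                 ≤⟨ euler M ⟩
    2 * suc m + 2 * faceCount G ρ   ≤⟨ ℕₚ.+-monoʳ-≤ (2 * suc m) (ℕₚ.*-monoʳ-≤ 2 faceCount′) ⟩
    2 * suc m + 2 * faceCount G′ ρ′ ≡⟨ solve 2 (λ a b → con 2 :* (con 1 :+ a) :+ con 2 :* b := con 2 :+ (con 2 :* a :+ con 2 :* b)) refl m (faceCount G′ ρ′) ⟩
    2 + (2 * m + 2 * faceCount G′ ρ′) ∎))
    where
    open ℕₚ.≤-Reasoning
    open +-*-Solver using (solve; _:=_; _:+_; _:*_; con)

Contraction : ∀ {K m} → PlaneMap K (suc m) → Fin (suc m) → Fin m → Set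
Contraction {K} {m} M v y = Σ (PlaneMap K m) λ M′ → ∀ {a b} → adj (graph M) a b ≡ true →
  collapse v y a ≡ collapse v y b ⊎ adj (graph M′) (collapse v y a) (collapse v y b) ≡ true

-- Contracting v into y: the neighbours of v are moved to y one by one, starting with the
-- one preceding y around v, until v is a leaf.
contract : ∀ fuel {K m} (M : PlaneMap K (suc (suc (suc m)))) v y → adj (graph M) v (punchIn v y) ≡ true →
           deg (graph M) v ≤ fuel → Contraction M v y
contract zero M v y vy d≤ with () ← ℕₚ.≤-trans (length-⊆ {xs = punchIn v y ∷ []} ([] ∷ [])
                                     λ { (here refl) → Adjacency.∈-nbrs⁺ (graph M) vy }) d≤
contract (suc fuel) {K} {m} M v y vy d≤ = go (pred vy)
  where
  G = graph M
  ρ = rotation M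
  open Faces G ρ
  y⁺ = punchIn v y
  ↓ = collapse v y

  -- A step M₁ towards the contraction may drop only the edge v x, provided x is joined to y.
  resume : ∀ {x} (M₁ : PlaneMap K (suc (suc (suc m)))) → v ~ x →
           adj (graph M₁) v y⁺ ≡ true → adj (graph M₁) x y⁺ ≡ true → ¬ adj (graph M₁) v x ≡ true →
           (∀ {a} → adj (graph M₁) v a ≡ true → v ~ a) →
           (∀ {a b} → a ~ b → (a ≡ v × b ≡ x) ⊎ (a ≡ x × b ≡ v) ⊎ adj (graph M₁) a b ≡ true) →
           Contraction M v y
  resume {x} M₁ vx vy₁ xy₁ v≁x sub old with contract fuel M₁ v y vy₁ (ℕₚ.≤-pred (ℕₚ.≤-trans fewer d≤))
    where
    module A₁ = Adjacency (graph M₁)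
    fewer : suc (deg (graph M₁) v) ≤ deg G v
    fewer = length-⊆ {xs = x ∷ A₁.nbrs v} {ys = nbrs v}
      (All.tabulate (λ w∈ → λ { refl → v≁x (A₁.∈-nbrs⁻ w∈) }) ∷ A₁.nbrs-unique v)
      λ { (here refl) → ∈-nbrs⁺ vx ; (there w∈) → ∈-nbrs⁺ (sub (A₁.∈-nbrs⁻ w∈)) }
  ... | M′ , hom = M′ , hom′
    where
    ↓v : ↓ v ≡ ↓ y⁺
    ↓v = trans (collapse-self v y) (sym (collapse-punchIn v y y))
    hom′ : ∀ {a b} → a ~ b → ↓ a ≡ ↓ b ⊎ adj (graph M′) (↓ a) (↓ b) ≡ true
    hom′ ab with old ab
    ... | inj₂ (inj₂ e) = hom e
    ... | inj₂ (inj₁ (refl , refl)) with hom xy₁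
    ...   | inj₁ eq = inj₁ (trans eq (sym ↓v))
    ...   | inj₂ e  = inj₂ (trans (cong (adj (graph M′) (↓ x)) ↓v) e)
    hom′ ab | inj₁ (refl , refl) with hom xy₁
    ...   | inj₁ eq = inj₁ (sym (trans eq (sym ↓v)))
    ...   | inj₂ e  = inj₂ (trans (adj-sym (graph M′) (↓ v) (↓ x)) (trans (cong (adj (graph M′) (↓ x)) ↓v) e))

  go : ∃[ x ] (v ~ x × rot ρ v x ≡ y⁺) → Contraction M v y
  go (x , vx , next) with x ≟ y⁺
  ... | yes refl = Leaf.removed M v y vy only (proj₁ (proj₂ other)) (proj₂ (proj₂ other))
                 , Leaf.edge↓ M v y vy only (proj₁ (proj₂ other)) (proj₂ (proj₂ other))
    where
    only : ∀ {w} → v ~ w → w ≡ y⁺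
    only {w} vw with y⁺ ≟ w
    ... | yes eq = sym eq
    ... | no ne  = ⊥-elim (rot-≢ vy vw ne next)
    -- Some third vertex has to be reached from `y⁺`, and `v` leads back to `y⁺` only; so `y⁺` has a
    -- neighbour other than `v`, as the removal of the leaf requires.
    escape : ∀ {u w} → Path G u w → u ≡ y⁺ ⊎ u ≡ v → w ≢ y⁺ → w ≢ v → ∃[ z ] (y⁺ ~ z × v ≢ z)
    escape (stop _) (inj₁ eq) w≢y w≢v = ⊥-elim (w≢y eq)
    escape (stop _) (inj₂ eq) w≢y w≢v = ⊥-elim (w≢v eq)
    escape (move {x = z} e p) (inj₁ refl) w≢y w≢v with v ≟ z
    ... | yes refl = escape p (inj₂ refl) w≢y w≢v
    ... | no v≢z   = z , e , v≢z
    escape (move e p) (inj₂ refl) w≢y w≢v = escape p (inj₁ (only e)) w≢y w≢v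
    third : ∀ (y : Fin (suc (suc m))) → ∃[ a ] (a ≢ y)
    third zero    = suc zero , λ ()
    third (suc _) = zero , λ ()
    other : ∃[ z ] (y⁺ ~ z × v ≢ z)
    other with third y
    ... | a , a≢y = escape (connected M y⁺ (punchIn v a)) (inj₁ refl)
                      (a≢y ∘ Finₚ.punchIn-injective v a y) (Finₚ.punchInᵢ≢i v a)
  ... | no x≢y with x ~? y⁺
  ...   | yes xy = resume D.deleted vx
            (D.adj⁺ (vy , λ { (inj₁ (_ , e)) → x≢y (sym e) ; (inj₂ (e , _)) → ~⇒≢ vx e }))
            (D.adj⁺ (xy , λ { (inj₁ (e , _)) → ~⇒≢ vx (sym e) ; (inj₂ (_ , e)) → ~⇒≢ vy (sym e) }))
            (λ e → proj₂ (D.adj⁻ e) (inj₁ (refl , refl))) (proj₁ ∘ D.adj⁻) old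
    where
    module D = Delete M vx vy xy
    old : ∀ {a b} → a ~ b → (a ≡ v × b ≡ x) ⊎ (a ≡ x × b ≡ v) ⊎ adj D.G′ a b ≡ true
    old {a} {b} ab with D.gone? a b
    ... | yes (inj₁ g) = inj₁ g
    ... | yes (inj₂ g) = inj₂ (inj₁ g)
    ... | no ¬g        = inj₂ (inj₂ (D.adj⁺ (ab , ¬g)))
  -- The ear `x y⁺` is drawn first. It gains the face that deleting `v x` may lose.
  ...   | no x≁y = resume D.deleted vx
            (D.adj⁺ (E.adj⁺ (inj₁ vy) , λ { (inj₁ (_ , e)) → x≢y (sym e) ; (inj₂ (e , _)) → ~⇒≢ vx e }))
            (D.adj⁺ (xy′ , λ { (inj₁ (e , _)) → ~⇒≢ vx (sym e) ; (inj₂ (_ , e)) → ~⇒≢ vy (sym e) }))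
            (λ e → proj₂ (D.adj⁻ e) (inj₁ (refl , refl))) sub old
    where
    module E = Ear M vx vy next x≁y x≢y
    xy′ = E.adj⁺ (inj₂ (inj₁ (refl , refl)))
    module D = Delete E.withEar (E.adj⁺ (inj₁ vx)) (E.adj⁺ (inj₁ vy)) xy′
    sub : ∀ {a} → adj D.G′ v a ≡ true → v ~ a
    sub e with E.adj⁻ (proj₁ (D.adj⁻ e))
    ... | inj₁ va             = va
    ... | inj₂ (inj₁ (p , _)) = ⊥-elim (~⇒≢ vx p)
    ... | inj₂ (inj₂ (p , _)) = ⊥-elim (~⇒≢ vy p)
    old : ∀ {a b} → a ~ b → (a ≡ v × b ≡ x) ⊎ (a ≡ x × b ≡ v) ⊎ adj D.G′ a b ≡ true
    old {a} {b} ab with D.gone? a b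
    ... | yes (inj₁ g) = inj₁ g
    ... | yes (inj₂ g) = inj₂ (inj₁ g)
    ... | no ¬g        = inj₂ (inj₂ (D.adj⁺ (E.adj⁺ (inj₁ ab) , ¬g)))

-- Euler's inequality and contractions

-- Contractions preserve `K` and end with two vertices, where two darts and a single face leave room
-- for nothing above 4.
euler-≤ : ∀ m {K} → PlaneMap K (suc (suc m)) → K ≤ 4
euler-≤ zero {K} M = ℕₚ.+-cancelʳ-≤ 2 K 4 (begin
    K + 2                         ≤⟨ ℕₚ.+-monoʳ-≤ K two-darts ⟩
    K + dartCount G               ≤⟨ euler M ⟩
    4 + 2 * faceCount G ρ         ≤⟨ ℕₚ.+-monoʳ-≤ 4 (ℕₚ.*-monoʳ-≤ 2 one-face) ⟩
    4 + 2                         ∎)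
  where
  open ℕₚ.≤-Reasoning
  G = graph M
  ρ = rotation M
  open Faces G ρ
  0~1 : zero ~ suc zero
  0~1 with connected M zero (suc zero)
  ... | move {x = zero} e _     = ⊥-elim (~⇒≢ e refl)
  ... | move {x = suc zero} e _ = e
  two-darts : 2 ≤ dartCount G
  two-darts = length-⊆ {xs = (zero , suc zero) ∷ (suc zero , zero) ∷ []} (((λ ()) ∷ []) ∷ [] ∷ [])
    λ { (here refl) → ∈-darts⁺ 0~1 ; (there (here refl)) → ∈-darts⁺ (~-sym 0~1) }
  only-0 : ∀ w → suc zero ~ w → w ≡ zero
  only-0 zero       _ = refl
  only-0 (suc zero) e = ⊥-elim (~⇒≢ e refl)
  turn : ϕ (zero , suc zero) ≡ (suc zero , zero)
  turn = cong (suc zero ,_) (only-0 _ (rot-adj ρ (suc zero) zero (~-sym 0~1)))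
  same : ∀ {f} → Dart f → face f ≡ face (zero , suc zero)
  same {zero , zero}         e = ⊥-elim (~⇒≢ e refl)
  same {suc zero , suc zero} e = ⊥-elim (~⇒≢ e refl)
  same {zero , suc zero}     e = refl
  same {suc zero , zero}     e = trans (cong face (sym turn)) (face-ϕ {zero , suc zero} 0~1)
  one-face : faceCount G ρ ≤ 1
  one-face = length-⊆ {ys = face (zero , suc zero) ∷ []} faces-unique
    λ f∈ → let df , ff = ∈-faces⁻ f∈ in here (trans (sym ff) (same df))
euler-≤ (suc m) M with connected M zero (suc zero)
... | move {x = zero} e _  = ⊥-elim (Adjacency.~⇒≢ (graph M) e refl)
... | move {x = suc y} e _ = euler-≤ m (proj₁ (contract _ M zero y e ℕₚ.≤-refl))

-- The constructions provide one half of Euler's formula. The other half is `euler-≤` applied to the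
-- same map with its exact value in place of `K`.
planar : ∀ {m} (M : PlaneMap 4 (suc (suc m))) → Planar (graph M)
planar {m} M = inj₂ (graph M , (λ _ _ e → e) , rotation M , connected M , ℕₚ.≤-antisym upper (euler M))
  where
  total = 2 * suc (suc m) + 2 * faceCount (graph M) (rotation M)
  ds    = dartCount (graph M)
  exact : (total ∸ ds) + ds ≡ total
  exact = ℕₚ.m∸n+n≡m (ℕₚ.≤-trans (ℕₚ.m≤n+m ds 4) (euler M))
  upper : total ≤ 4 + ds
  upper = subst (_≤ 4 + ds) exact (ℕₚ.+-monoˡ-≤ ds (euler-≤ m
    (planeMap {K = total ∸ ds} (graph M) (rotation M) (connected M) (ℕₚ.≤-reflexive exact))))

collapse-≡ : ∀ {m} (v : Fin (suc m)) (y : Fin m) {a b} → collapse v y a ≡ collapse v y b →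
             a ≡ b ⊎ (a ≡ v × b ≡ punchIn v y) ⊎ (a ≡ punchIn v y × b ≡ v)
collapse-≡ v y {a} {b} eq with v ≟ a | v ≟ b
... | yes refl | yes refl = inj₁ refl
... | yes refl | no v≢b   = inj₂ (inj₁ (refl , trans (sym (Finₚ.punchIn-punchOut v≢b)) (cong (punchIn v) (sym eq))))
... | no v≢a   | yes refl = inj₂ (inj₂ (trans (sym (Finₚ.punchIn-punchOut v≢a)) (cong (punchIn v) eq) , refl))
... | no v≢a   | no v≢b   = inj₁ (Finₚ.punchOut-injective v≢a v≢b eq)

module Contractions {n : ℕ} (G : Graph n) (κ : Fin n → Fin n) where
  open Adjacency G

  -- A contraction in progress: `q` may identify vertices only within a class of `κ`, and `s`
  -- chooses representatives, through which lists are carried over.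
  record Quotient (m : ℕ) : Set where
    field
      M   : PlaneMap 4 (suc (suc m))
      q   : Fin n → Fin (suc (suc m))
      s   : Fin (suc (suc m)) → Fin n
      q-s : ∀ a → q (s a) ≡ a
      hom : ∀ {x z} → x ~ z → q x ≡ q z ⊎ adj (graph M) (q x) (q z) ≡ true
      fib : ∀ {x z} → q x ≡ q z → κ x ≡ κ z
  open Quotient public

  AllEqual : Set
  AllEqual = ∀ x z → κ x ≡ κ z

  Finer : ∀ {m m′} → Quotient m → Quotient m′ → Set
  Finer Q Q′ = ∀ {x z} → q Q x ≡ q Q z → q Q′ x ≡ q Q′ z

  fib-step : ∀ {m} (Q : Quotient m) {x z} → κ x ≡ κ z → (q≢ : q Q x ≢ q Q z) → ∀ {a b} →
             collapse (q Q x) (punchOut q≢) (q Q a) ≡ collapse (q Q x) (punchOut q≢) (q Q b) → κ a ≡ κ b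
  fib-step Q κ≡ q≢ eq with collapse-≡ _ _ eq
  ... | inj₁ e = fib Q e
  ... | inj₂ (inj₁ (ea , eb)) = trans (fib Q ea) (trans κ≡ (sym (fib Q (trans eb (Finₚ.punchIn-punchOut q≢)))))
  ... | inj₂ (inj₂ (ea , eb)) = trans (fib Q (trans ea (Finₚ.punchIn-punchOut q≢))) (trans (sym κ≡) (sym (fib Q eb)))

  -- With two vertices left, the edge is not contracted: the whole graph is then one class, and this
  -- is reported instead.
  merge-step : ∀ {m} (Q : Quotient m) {x z} → x ~ z → κ x ≡ κ z → q Q x ≢ q Q z →
               AllEqual ⊎ ∃[ m′ ] (m′ < m × Σ (Quotient m′) λ Q′ → Finer Q Q′ × q Q′ x ≡ q Q′ z)
  merge-step {zero} Q xz κ≡ q≢ = inj₁ λ a b → fib-step Q κ≡ q≢ (unique _ _)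
    where
    unique : ∀ (c d : Fin 1) → c ≡ d
    unique zero zero = refl
  merge-step {suc m} Q {x} {z} xz κ≡ q≢ = inj₂ (m , ℕₚ.≤-refl , Q′ , cong ↓ , both)
    where
    v = q Q x
    y = punchOut q≢
    ↓ = collapse v y
    vy : adj (graph (M Q)) v (punchIn v y) ≡ true
    vy with hom Q xz
    ... | inj₁ e = ⊥-elim (q≢ e)
    ... | inj₂ e = trans (cong (adj (graph (M Q)) v) (Finₚ.punchIn-punchOut q≢)) e
    C = contract _ (M Q) v y vy ℕₚ.≤-refl
    both : ↓ v ≡ ↓ (q Q z)
    both = trans (collapse-self v y) (trans (sym (collapse-punchIn v y y)) (cong ↓ (Finₚ.punchIn-punchOut q≢)))
    Q′ : Quotient m
    Q′ = record
      { M = proj₁ C ; q = ↓ ∘ q Q ; s = s Q ∘ punchIn v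
      ; q-s = λ a → trans (cong ↓ (q-s Q (punchIn v a))) (collapse-punchIn v y a)
      ; hom = λ e → [ inj₁ ∘ cong ↓ , proj₂ C ]′ (hom Q e)
      ; fib = fib-step Q κ≡ q≢ }

  Inner : Fin n × Fin n → Set
  Inner (x , z) = x ~ z × κ x ≡ κ z

  merge-all : ∀ {m} (es : List (Fin n × Fin n)) (Q : Quotient m) →
              AllEqual ⊎ ∃[ m′ ] (m′ ≤ m × Σ (Quotient m′) λ Q′ →
                Finer Q Q′ × (∀ {x z} → (x , z) ∈ es → Inner (x , z) → q Q′ x ≡ q Q′ z))
  merge-all {m} [] Q = inj₂ (m , ℕₚ.≤-refl , Q , (λ e → e) , λ ())
  merge-all {m} ((x , z) ∷ es) Q with (x ~? z) ×-dec (κ x ≟ κ z) ×-dec ¬? (q Q x ≟ q Q z)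
  merge-all ((x , z) ∷ es) Q | yes (xz , κ≡ , q≢) with merge-step Q xz κ≡ q≢
  ... | inj₁ all = inj₁ all
  ... | inj₂ (m₁ , m₁<m , Q₁ , fin₁ , eq₁) with merge-all es Q₁
  ...   | inj₁ all = inj₁ all
  ...   | inj₂ (m₂ , m₂≤m₁ , Q₂ , fin₂ , done) =
          inj₂ (m₂ , ℕₚ.≤-trans m₂≤m₁ (ℕₚ.<⇒≤ m₁<m) , Q₂ , fin₂ ∘ fin₁
            , λ { (here refl) _ → fin₂ eq₁ ; (there e∈) inner → done e∈ inner })
  merge-all ((x , z) ∷ es) Q | no ¬p with merge-all es Q
  ... | inj₁ all = inj₁ all
  ... | inj₂ (m₂ , m₂≤m , Q₂ , fin₂ , done) = inj₂ (m₂ , m₂≤m , Q₂ , fin₂ , λ where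
          (here refl) (xz , κ≡) → fin₂ (same xz κ≡)
          (there e∈) inner      → done e∈ inner)
    where
    same : x ~ z → κ x ≡ κ z → q Q x ≡ q Q z
    same xz κ≡ with q Q x ≟ q Q z
    ... | yes e = e
    ... | no ne = ⊥-elim (¬p (xz , κ≡ , ne))

Lists : ℕ → Set
Lists n = Fin n → Fin 4 → ℕ

Proper : ∀ {n} → Lists n → Set
Proper L = ∀ v i j → L v i ≡ L v j → i ≡ j

-- Constancy is asked along edges only, because a class may be disconnected and its components are
-- contracted separately.
record ClassColouring {n : ℕ} (G : Graph n) (κ : Fin n → Fin n) (L : Lists n) : Set where
  field
    colour   : Fin n → ℕ
    listed   : ∀ x → ∃[ i ] L x i ≡ colour x
    constant : ∀ {x z} → adj G x z ≡ true → κ x ≡ κ z → colour x ≡ colour z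
    distinct : ∀ {x z} → adj G x z ≡ true → κ x ≢ κ z → colour x ≢ colour z
open ClassColouring public

-- Minimality applied to the planar graph obtained by contracting all edges inside the classes of κ.
abstract
  classColouring : ∀ {n} (M₀ : PlaneMap 4 n) → (∀ m → m < n → (H : Graph m) → Planar H → Choosable H 4) →
    (κ : Fin n → Fin n) → ∀ {x₀ z₀} → adj (graph M₀) x₀ z₀ ≡ true → κ x₀ ≡ κ z₀ →
    (L : Lists n) → Proper L → (∀ {x z} → κ x ≡ κ z → ∀ i → L x i ≡ L z i) → ClassColouring (graph M₀) κ L
  classColouring {suc zero} M₀ _ κ {zero} {zero} e _ _ _ _ = ⊥-elim (Adjacency.~⇒≢ (graph M₀) e refl)
  -- Contracting `x₀ z₀` first makes the quotient strictly smaller than the given graph, as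
  -- minimality demands.
  classColouring {suc (suc n)} M₀ choose κ {x₀} {z₀} e₀ κ₀ L inj Lκ = finish (merge-step start e₀ κ₀ (~⇒≢ e₀))
    where
    open Adjacency (graph M₀)
    open Contractions (graph M₀) κ
    start : Quotient n
    start = record { M = M₀ ; q = λ x → x ; s = λ x → x ; q-s = λ _ → refl ; hom = inj₂ ; fib = cong κ }

    trivial : AllEqual → ClassColouring (graph M₀) κ L
    trivial all = record { colour = λ x → L x zero ; listed = λ x → zero , refl
      ; constant = λ {x} {z} _ _ → Lκ (all x z) zero ; distinct = λ {x} {z} _ ne → ⊥-elim (ne (all x z)) }

    finish : AllEqual ⊎ ∃[ m ] (m < n × Σ (Quotient m) λ Q → Finer start Q × q Q x₀ ≡ q Q z₀) → ClassColouring (graph M₀) κ L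
    finish (inj₁ all) = trivial all
    finish (inj₂ (m₁ , m₁<n , Q₁ , _)) with merge-all (pairs (graph M₀)) Q₁
    ... | inj₁ all = trivial all
    ... | inj₂ (m , m≤m₁ , Q , _ , done) with choose (suc (suc m)) (s≤s (s≤s (ℕₚ.≤-<-trans m≤m₁ m₁<n)))
                                               (graph (M Q)) (planar (M Q)) (L ∘ s Q) (λ a → inj (s Q a))
    ...   | c , listed′ , proper = record
            { colour = c ∘ q Q
            ; listed = λ x → let i , e = listed′ (q Q x) in i , trans (Lκ (sym (fib Q (q-s Q (q Q x)))) i) e
            ; constant = λ {x} {z} xz κ≡ → cong c (done (∈-pairs (x , z)) (xz , κ≡))
            ; distinct = dist }
      where
      dist : ∀ {x z} → x ~ z → κ x ≢ κ z → c (q Q x) ≢ c (q Q z)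
      dist xz κ≢ with hom Q xz
      ... | inj₁ e = ⊥-elim (κ≢ (fib Q e))
      ... | inj₂ e = proper _ _ e

-- Walks, and splitting a vertex along a face

data Walk {n : ℕ} (G : Graph n) (S : Fin n → Set) : Fin n → Fin n → Set where
  end : ∀ {x} → S x → Walk G S x x
  via : ∀ {x y z} → S x → adj G x y ≡ true → Walk G S y z → Walk G S x z

Cyclic-map : ∀ {A B : Set} {P : A → Set} {Q : B → Set} {r : A → A} (f : A → B) (g : B → A) →
  (∀ {a} → P a → Q (f a)) → (∀ {b} → Q b → P (g b)) →
  (∀ {b} → Q b → f (g b) ≡ b) → (∀ {a} → P a → g (f a) ≡ a) → Cyclic P r → Cyclic Q (f ∘ r ∘ g)
Cyclic-map {P = P} {Q} {r} f g Pf Qg fg gf C = cyclic (Pf ∘ preserves C ∘ Qg) cy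
  where
  s = f ∘ r ∘ g
  lift : ∀ k {b} → Q b → P (iter r k (g b)) × iter s k b ≡ f (iter r k (g b))
  lift zero    qb = Qg qb , sym (fg qb)
  lift (suc k) qb with lift k qb
  ... | p , eq = preserves C p , cong (f ∘ r) (trans (cong g eq) (gf p))
  cy : ∀ {b b′} → Q b → Q b′ → ∃[ k ] iter s k b ≡ b′
  cy qb qb′ with cycle C (Qg qb) (Qg qb′)
  ... | k , eq = k , trans (proj₂ (lift k qb)) (trans (cong f eq) (fg qb′))

-- If two corners of v lie on the same face, v can be split along that face into two vertices
-- without losing faces. By Euler's formula the resulting graph is disconnected.
module Split {n : ℕ} (M : PlaneMap 4 n) {v a : Fin n} (va : adj (graph M) v a ≡ true) (l : ℕ) where

  private
    G = graph M
    ρ = rotation M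
    L = suc l
  open Faces G ρ

  w : ℕ → Fin n
  w k = iter (rot ρ v) k a

  vw : ∀ k → v ~ w k
  vw k = iter-rot-adj k va

  Arc : Fin n → Set
  Arc y = ∃[ k ] (k < L × w k ≡ y)

  arc? : ∀ y → Dec (Arc y)
  arc? y = ℕₚ.anyUpTo? (λ k → w k ≟ y) L

  arc~ : ∀ {y} → Arc y → v ~ y
  arc~ (k , _ , refl) = vw k

  module Cut (same : face (v , a) ≡ face (v , w L)) (¬arc : ¬ Arc (w L)) where

    private
      b = w L

    redirect : Fin n → Fin n → Fin n → Fin n
    redirect s t y with rot ρ v y ≟ s
    ... | yes _ = t
    ... | no  _ = rot ρ v y

    redirect-at : ∀ {s t y} → rot ρ v y ≡ s → redirect s t y ≡ t
    redirect-at {s} {t} {y} e with rot ρ v y ≟ s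
    ... | yes _ = refl
    ... | no ne = ⊥-elim (ne e)

    redirect-other : ∀ {s t y} → rot ρ v y ≢ s → redirect s t y ≡ rot ρ v y
    redirect-other {s} {t} {y} ne with rot ρ v y ≟ s
    ... | yes e = ⊥-elim (ne e)
    ... | no _  = refl

    -- This is where the two corners have to share a face: rerouting from one to the other stays on
    -- it, so the old faces still label the darts of the split graph.
    redirect-face : ∀ {s t} y → face (v , s) ≡ face (v , t) → face (v , redirect s t y) ≡ face (v , rot ρ v y)
    redirect-face {s} {t} y e with rot ρ v y ≟ s
    ... | yes eq = trans (sym e) (cong (λ z → face (v , z)) (sym eq))
    ... | no _   = refl

    -- `r₁` closes the arc after its last element, and `r₂` closes the remaining neighbours by
    -- jumping over the arc.
    r₁ = redirect b a
    r₂ = redirect a b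

    r₁-w : ∀ {k} → suc k < L → r₁ (w k) ≡ w (suc k)
    r₁-w {k} lt = redirect-other λ e → ¬arc (suc k , lt , e)

    iter-r₁ : ∀ d i → d + i < L → iter r₁ d (w i) ≡ w (d + i)
    iter-r₁ zero    i lt = refl
    iter-r₁ (suc d) i lt = trans (cong r₁ (iter-r₁ d i (ℕₚ.<-trans (ℕₚ.n<1+n _) lt))) (r₁-w lt)

    arc-cyclic : Cyclic Arc r₁
    arc-cyclic = cyclic cl cy
      where
      cl : ∀ {y} → Arc y → Arc (r₁ y)
      cl (k , k<L , refl) with ℕₚ.m≤n⇒m<n∨m≡n k<L
      ... | inj₁ lt   = suc k , lt , sym (r₁-w lt)
      ... | inj₂ refl = 0 , s≤s z≤n , sym (redirect-at refl)
      cy : ∀ {y y′} → Arc y → Arc y′ → ∃[ k ] iter r₁ k y ≡ y′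
      cy (i , s≤s i≤l , refl) (j , j<L , refl) = j + suc (l ∸ i) , (begin
        iter r₁ (j + suc (l ∸ i)) (w i)          ≡⟨ iter-+ r₁ j (suc (l ∸ i)) (w i) ⟩
        iter r₁ j (r₁ (iter r₁ (l ∸ i) (w i)))   ≡⟨ cong (iter r₁ j ∘ r₁) (iter-r₁ (l ∸ i) i (s≤s (ℕₚ.≤-reflexive back))) ⟩
        iter r₁ j (r₁ (w (l ∸ i + i)))           ≡⟨ cong (λ m → iter r₁ j (r₁ (w m))) back ⟩
        iter r₁ j (r₁ (w l))                     ≡⟨ cong (iter r₁ j) (redirect-at refl) ⟩
        iter r₁ j a                              ≡⟨ iter-r₁ j 0 (subst (_< L) (sym (ℕₚ.+-identityʳ j)) j<L) ⟩
        w (j + 0)                                ≡⟨ cong w (ℕₚ.+-identityʳ j) ⟩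
        w j                                      ∎)
        where
        open ≡-Reasoning
        back = ℕₚ.m∸n+n≡m i≤l

    Rest : Fin n → Set
    Rest y = v ~ y × ¬ Arc y

    rest-step : ∀ {y} → Rest y → rot ρ v y ≢ a → Rest (rot ρ v y)
    rest-step {y} (vy , ¬ay) ne = rot-adj ρ v y vy , ¬a
      where
      ¬a : ¬ Arc (rot ρ v y)
      ¬a (zero , _ , e) = ne (sym e)
      ¬a (suc k , lt , e) = ¬ay (k , ℕₚ.<-trans (ℕₚ.n<1+n k) lt , rot-injective (vw k) vy e)

    rest-cyclic : Cyclic Rest r₂
    rest-cyclic = cyclic cl (λ {y} {y′} R R′ → let k , e = rot-cyc ρ v y y′ (proj₁ R) (proj₁ R′) in go k k ℕₚ.≤-refl R R′ e)
      where
      cl : ∀ {y} → Rest y → Rest (r₂ y)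
      cl {y} R with rot ρ v y ≟ a
      ... | yes _ = vw L , ¬arc
      ... | no ne = rest-step R ne
      -- A jump over the arc uses up `L` steps of the old rotation at once, hence the fuel.
      go : ∀ fuel k → k ≤ fuel → ∀ {y y′} → Rest y → Rest y′ → iter (rot ρ v) k y ≡ y′ → ∃[ j ] iter r₂ j y ≡ y′
      go fuel zero _ R R′ e = 0 , e
      go (suc fuel) (suc k) (s≤s k≤) {y} {y′} R R′ e = step (rot ρ v y ≟ a) (trans (iter-shift (rot ρ v) k y) e)
        where
        prepend : ∀ {u} → r₂ y ≡ u → ∃[ j ] iter r₂ j u ≡ y′ → ∃[ j ] iter r₂ j y ≡ y′
        prepend refl (j , e′) = suc j , trans (sym (iter-shift r₂ j y)) e′
        step : Dec (rot ρ v y ≡ a) → iter (rot ρ v) k (rot ρ v y) ≡ y′ → ∃[ j ] iter r₂ j y ≡ y′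
        step (no ne) e′ = prepend (redirect-other ne) (go fuel k k≤ (rest-step R ne) R′ e′)
        step (yes at) e′ with L ℕₚ.≤? k
        ... | no k<L = ⊥-elim (proj₂ R′ (k , ℕₚ.≰⇒> k<L , trans (cong (iter (rot ρ v) k) (sym at)) e′))
        ... | yes L≤k = prepend (redirect-at at) (go fuel (k ∸ L) (ℕₚ.≤-trans (ℕₚ.m∸n≤m k L) k≤) (vw L , ¬arc) R′ (begin
          iter (rot ρ v) (k ∸ L) b            ≡⟨ iter-+ (rot ρ v) (k ∸ L) L a ⟨
          iter (rot ρ v) (k ∸ L + L) a        ≡⟨ cong (λ m → iter (rot ρ v) m a) (ℕₚ.m∸n+n≡m L≤k) ⟩
          iter (rot ρ v) k a                  ≡⟨ cong (iter (rot ρ v) k) at ⟨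
          iter (rot ρ v) k (rot ρ v y)        ≡⟨ e′ ⟩
          y′                                  ∎))
          where open ≡-Reasoning

    -- zero is the new copy of v, which takes over the neighbours outside the arc.
    R* : Fin (suc n) → Fin (suc n) → Set
    R* zero    zero    = ⊥
    R* zero    (suc y) = Rest y
    R* (suc x) zero    = Rest x
    R* (suc x) (suc y) = x ~ y × (x ≡ v → Arc y) × (y ≡ v → Arc x)

    rest? : ∀ y → Dec (Rest y)
    rest? y = (v ~? y) ×-dec ¬? (arc? y)

    R*? : ∀ x y → Dec (R* x y)
    R*? zero    zero    = no λ ()
    R*? zero    (suc y) = rest? y
    R*? (suc x) zero    = rest? x
    R*? (suc x) (suc y) = (x ~? y) ×-dec ((x ≟ v) →-dec arc? y) ×-dec ((y ≟ v) →-dec arc? x)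

    R*-sym : ∀ {x y} → R* x y → R* y x
    R*-sym {zero}  {suc y} r = r
    R*-sym {suc x} {zero}  r = r
    R*-sym {suc x} {suc y} (e , p , q) = ~-sym e , q , p

    R*-irrefl : ∀ {x} → ¬ R* x x
    R*-irrefl {suc x} (e , _) = ~⇒≢ e refl

    open MkGraph R*? R*-sym R*-irrefl renaming (mkGraph to G*)

    ↓ : Fin (suc n) → Fin n
    ↓ zero    = v
    ↓ (suc x) = x

    R*-↓ : ∀ {x y} → R* x y → ↓ x ~ ↓ y
    R*-↓ {zero}  {suc y} (e , _) = e
    R*-↓ {suc x} {zero}  (e , _) = ~-sym e
    R*-↓ {suc x} {suc y} (e , _) = e

    copy : Fin n → Fin (suc n)
    copy y with arc? y
    ... | yes _ = suc v
    ... | no  _ = zero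

    ↓-copy : ∀ y → ↓ (copy y) ≡ v
    ↓-copy y with arc? y
    ... | yes _ = refl
    ... | no  _ = refl

    copy-arc : ∀ {y} → Arc y → copy y ≡ suc v
    copy-arc {y} ay with arc? y
    ... | yes _  = refl
    ... | no ¬ay = ⊥-elim (¬ay ay)

    copy-rest : ∀ {y} → ¬ Arc y → copy y ≡ zero
    copy-rest {y} ¬ay with arc? y
    ... | yes ay = ⊥-elim (¬ay ay)
    ... | no _   = refl

    copy-R* : ∀ {y} → v ~ y → R* (copy y) (suc y)
    copy-R* {y} vy with arc? y
    ... | yes ay = vy , (λ _ → ay) , λ e → ⊥-elim (~⇒≢ vy (sym e))
    ... | no ¬ay = vy , ¬ay

    up : Fin n → Fin n → Fin (suc n)
    up u z with z ≟ v
    ... | yes _ = copy u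
    ... | no  _ = suc z

    ↓-up : ∀ u z → ↓ (up u z) ≡ z
    ↓-up u z with z ≟ v
    ... | yes refl = ↓-copy u
    ... | no _     = refl

    up-v : ∀ u → up u v ≡ copy u
    up-v u with v ≟ v
    ... | yes _ = refl
    ... | no ne = ⊥-elim (ne refl)

    up-other : ∀ u {z} → z ≢ v → up u z ≡ suc z
    up-other u {z} ne with z ≟ v
    ... | yes e = ⊥-elim (ne e)
    ... | no _  = refl

    up-R* : ∀ {u z} → u ≢ v → u ~ z → R* (suc u) (up u z)
    up-R* {u} {z} u≢v uz = go (z ≟ v)
      where
      go : Dec (z ≡ v) → R* (suc u) (up u z)
      go (yes refl) = subst (R* (suc u)) (sym (up-v u)) (R*-sym {copy u} {suc u} (copy-R* (~-sym uz)))
      go (no z≢v)   = subst (R* (suc u)) (sym (up-other u z≢v)) (uz , (λ e → ⊥-elim (u≢v e)) , λ e → ⊥-elim (z≢v e))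

    up-↓ : ∀ {u z} → u ≢ v → R* (suc u) z → up u (↓ z) ≡ z
    up-↓ {u} {zero} u≢v (_ , ¬au) = trans (up-v u) (copy-rest ¬au)
    up-↓ {u} {suc z} u≢v (uz , _ , q) with z ≟ v
    ... | yes refl = copy-arc (q refl)
    ... | no _     = refl

    rot* : Fin (suc n) → Fin (suc n) → Fin (suc n)
    rot* zero    y = suc (r₂ (↓ y))
    rot* (suc u) y with u ≟ v
    ... | yes _ = suc (r₁ (↓ y))
    ... | no  _ = up u (rot ρ u (↓ y))

    rot*-v : ∀ y → rot* (suc v) y ≡ suc (r₁ (↓ y))
    rot*-v y with v ≟ v
    ... | yes _ = refl
    ... | no ne = ⊥-elim (ne refl)

    rot*-other : ∀ {u} → u ≢ v → ∀ y → rot* (suc u) y ≡ up u (rot ρ u (↓ y))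
    rot*-other {u} ne y with u ≟ v
    ... | yes e = ⊥-elim (ne e)
    ... | no _  = refl

    Cyclic-≗ : ∀ {A : Set} {P : A → Set} {r s : A → A} → (∀ y → s y ≡ r y) → Cyclic P r → Cyclic P s
    Cyclic-≗ {P = P} {r} {s} e C = cyclic (λ p → subst P (sym (e _)) (preserves C p))
      (λ p p′ → let k , eq = cycle C p p′ in k , trans (it k _) eq)
      where
      it : ∀ k y → iter s k y ≡ iter r k y
      it zero    y = refl
      it (suc k) y = trans (e _) (cong r (it k y))

    ρ* : Rotation G*
    ρ* = cyclic-rotation rot* λ u → Cyclic-resp adj⁺ adj⁻ (cyc u)
      where
      cyc′ : ∀ u → Dec (u ≡ v) → Cyclic (R* (suc u)) (rot* (suc u))
      cyc′ u (no u≢v) = Cyclic-≗ (rot*-other u≢v)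
        (Cyclic-map (up u) ↓ (up-R* u≢v) (λ {y} → R*-↓ {suc u} {y}) (up-↓ u≢v) (λ {z} _ → ↓-up u z) (rotation-cyclic ρ u))
      cyc′ u (yes refl) = Cyclic-≗ rot*-v
        (Cyclic-map {Q = R* (suc v)} suc ↓ (λ ay → arc~ ay , (λ _ → ay) , λ e → ⊥-elim (~⇒≢ (arc~ ay) (sym e)))
          (λ { {zero} (e , _) → ⊥-elim (~⇒≢ e refl) ; {suc y} (_ , p , _) → p refl })
          (λ { {zero} (e , _) → ⊥-elim (~⇒≢ e refl) ; {suc y} _ → refl }) (λ _ → refl) arc-cyclic)
      cyc : ∀ u → Cyclic (R* u) (rot* u)
      cyc zero = Cyclic-map {Q = R* zero} suc ↓ (λ r → r) (λ { {suc y} r → r }) (λ { {suc y} _ → refl }) (λ _ → refl) rest-cyclic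
      cyc (suc u) = cyc′ u (u ≟ v)

    open Faces G* ρ* using () renaming (Dart to Dart*; labels≤faceCount to labels≤faceCount*;
      darts to darts*; darts-unique to darts-unique*; ∈-darts⁻ to ∈-darts⁻*)

    ↓ᵈ : Fin (suc n) × Fin (suc n) → Fin n × Fin n
    ↓ᵈ (x , y) = ↓ x , ↓ y

    label-inv : ∀ {d} → Dart* d → face (↓ᵈ (φ G* ρ* d)) ≡ face (↓ᵈ d)
    label-inv {x , y} dd = trans (turn y) (face-ϕ {↓ x , ↓ y} (R*-↓ {x} {y} (adj⁻ dd)))
      where
      turn : ∀ y → face (↓ y , ↓ (rot* y x)) ≡ face (↓ y , rot ρ (↓ y) (↓ x))
      turn zero = redirect-face (↓ x) same
      turn (suc u) with u ≟ v
      ... | yes refl = redirect-face (↓ x) (sym same)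
      ... | no _     = cong (λ z → face (u , z)) (↓-up u (rot ρ u (↓ x)))

    lift : Fin n × Fin n → Fin (suc n) × Fin (suc n)
    lift (p , r) with p ≟ v
    ... | yes _ = copy r , suc r
    ... | no  _ = suc p , up p r

    lift-dart : ∀ {d} → Dart d → Dart* (lift d) × ↓ᵈ (lift d) ≡ d
    lift-dart {p , r} dd with p ≟ v
    ... | yes refl = adj⁺ (copy-R* dd) , cong (_, r) (↓-copy r)
    ... | no p≢v   = adj⁺ (up-R* p≢v dd) , cong (p ,_) (↓-up p r)

    lift-↓ : ∀ {x y} → R* x y → lift (↓ x , ↓ y) ≡ (x , y)
    lift-↓ {zero} {suc y} (_ , ¬ay) with v ≟ v
    ... | yes _ = cong (_, suc y) (copy-rest ¬ay)
    ... | no ne = ⊥-elim (ne refl)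
    lift-↓ {suc x} {y} r = go (x ≟ v) y r
      where
      go : Dec (x ≡ v) → ∀ y → R* (suc x) y → lift (x , ↓ y) ≡ (suc x , y)
      go (yes refl) zero (e , _) = ⊥-elim (~⇒≢ e refl)
      go (yes refl) (suc y) (_ , p , _) with v ≟ v
      ... | yes _ = cong (_, suc y) (copy-arc (p refl))
      ... | no ne = ⊥-elim (ne refl)
      go (no x≢v) y r with x ≟ v
      ... | yes e = ⊥-elim (x≢v e)
      ... | no _  = cong (suc x ,_) (up-↓ x≢v r)

    dartCount* : dartCount G* ≤ dartCount G
    dartCount* = subst (dartCount G* ≤_) (length-map lift darts) (length-⊆ darts-unique* sub)
      where
      sub : ∀ {d} → d ∈ darts* → d ∈ map lift darts
      sub {x , y} d∈ = let r = adj⁻ (∈-darts⁻* d∈) in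
        subst (_∈ map lift darts) (lift-↓ r) (∈-map⁺ lift (∈-darts⁺ (R*-↓ {x} {y} r)))

    faceCount* : faceCount G ρ ≤ faceCount G* ρ*
    faceCount* = labels≤faceCount* (face ∘ ↓ᵈ) (λ {d} → label-inv {d}) faces faces-unique λ {f} f∈ →
      let df , ff = ∈-faces⁻ f∈ ; dl , el = lift-dart df in lift f , dl , trans (cong face el) ff

    -- The walk would connect the two copies of `v`. The split graph has one more vertex, no more
    -- darts and no fewer faces, so it would be a connected map with bound 6, against `euler-≤`.
    separated : ∀ {x y} → Arc x → Rest y → ¬ Walk G (λ u → u ≢ v) x y
    separated {x} {y} ax ry walk = contradiction n v M*
      where
      walk* : ∀ {p q} → Walk G (λ u → u ≢ v) p q → Path G* (suc p) (suc q)
      walk* (end _) = stop _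
      walk* (via {p} {z} p≢v e rest) = move (adj⁺ {suc p} {suc z} (e , (λ eq → ⊥-elim (p≢v eq)) , λ eq → ⊥-elim (head≢v rest eq))) (walk* rest)
        where
        head≢v : ∀ {p q} → Walk G (λ u → u ≢ v) p q → p ≢ v
        head≢v (end ne)     = ne
        head≢v (via ne _ _) = ne
      bridge : Path G* zero (suc v)
      bridge = move (adj⁺ {zero} {suc y} ry) (path-sym (walk* walk)) ⊙
        move (adj⁺ {suc x} {suc v} (~-sym (arc~ ax) , (λ e → ⊥-elim (~⇒≢ (arc~ ax) (sym e))) , λ _ → ax)) (stop _)
      toV : ∀ {u t} → Path G u t → t ≡ v → Path G* (suc u) (suc v)
      toV (stop u) refl = stop (suc u)
      toV (move {u} {z} e p) refl with u ≟ v | z ≟ v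
      ... | yes refl | _ = stop (suc v)
      ... | no u≢v | no z≢v = move (adj⁺ {suc u} {suc z} (e , (λ eq → ⊥-elim (u≢v eq)) , λ eq → ⊥-elim (z≢v eq))) (toV p refl)
      ... | no u≢v | yes refl with arc? u
      ...   | yes au = move (adj⁺ {suc u} {suc v} (e , (λ eq → ⊥-elim (u≢v eq)) , λ _ → au)) (stop _)
      ...   | no ¬au = move (adj⁺ {suc u} {zero} (~-sym e , ¬au)) bridge
      toV* : ∀ u → Path G* u (suc v)
      toV* zero    = bridge
      toV* (suc u) = toV (connected M u v) refl
      M* : PlaneMap 6 (suc n)
      M* = planeMap G* ρ* (λ p q → toV* p ⊙ path-sym (toV* q)) (begin
        6 + dartCount G*                  ≤⟨ ℕₚ.+-monoʳ-≤ 6 dartCount* ⟩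
        2 + (4 + dartCount G)             ≤⟨ ℕₚ.+-monoʳ-≤ 2 (euler M) ⟩
        2 + (2 * n + 2 * faceCount G ρ)   ≤⟨ ℕₚ.+-monoʳ-≤ 2 (ℕₚ.+-monoʳ-≤ (2 * n) (ℕₚ.*-monoʳ-≤ 2 faceCount*)) ⟩
        2 + (2 * n + 2 * faceCount G* ρ*) ≡⟨ solve 2 (λ p q → con 2 :+ (con 2 :* p :+ con 2 :* q) := con 2 :* (con 1 :+ p) :+ con 2 :* q) refl n (faceCount G* ρ*) ⟩
        2 * suc n + 2 * faceCount G* ρ*   ∎)
        where
        open ℕₚ.≤-Reasoning
        open +-*-Solver using (solve; _:=_; _:+_; _:*_; con)
      contradiction : ∀ n → Fin n → ¬ PlaneMap 6 (suc n)
      contradiction (suc m) _ N = ℕₚ.<⇒≱ (s≤s (s≤s (s≤s (s≤s (s≤s z≤n))))) (euler-≤ m N)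

-- List colourings

∀⊎∃ : ∀ {k} {P Q : Fin k → Set} → (∀ i → P i ⊎ Q i) → (∀ i → P i) ⊎ ∃ Q
∀⊎∃ {zero}  f = inj₁ λ ()
∀⊎∃ {suc k} f with f zero | ∀⊎∃ (f ∘ suc)
... | inj₂ q | _              = inj₂ (zero , q)
... | inj₁ _ | inj₂ (i , q)   = inj₂ (suc i , q)
... | inj₁ p | inj₁ ps        = inj₁ λ { zero → p ; (suc i) → ps i }

abstract
  -- The enumeration returns a function only up to pointwise equality, hence the first hypothesis.
  ∃-function? : ∀ {n k} {P : (Fin n → Fin k) → Set} → (∀ {f g} → (∀ x → f x ≡ g x) → P f → P g) →
                (∀ f → Dec (P f)) → Dec (∃ P)
  ∃-function? {n} {k} {P} resp P? = map′ (λ (i , p) → finToFun i , p)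
    (λ (f , p) → funToFin f , resp (λ x → sym (Finₚ.finToFun-funToFin f x)) p)
    (Finₚ.any? λ i → P? (finToFun {k} {n} i))

abstract
  -- Common values are paired with themselves one at a time; once none is left, any bijection will
  -- do. One index can then choose from two lists without an accidental clash.
  matching : ∀ {k} (f g : Fin k → ℕ) → (∀ i j → f i ≡ f j → i ≡ j) → (∀ i j → g i ≡ g j → i ≡ j) →
             Σ (Fin k → Fin k) λ h → (∀ i j → h i ≡ h j → i ≡ j) × (∀ i → g (h i) ≡ f i ⊎ (∀ j → f j ≢ g (h i)))
  matching {zero} f g _ _ = (λ ()) , (λ ()) , λ ()
  matching {suc k} f g f-inj g-inj with Finₚ.any? (λ i → Finₚ.any? (λ j → f i ℕₚ.≟ g j))
  ... | no ¬p = (λ i → i) , (λ _ _ e → e) , λ i → inj₂ λ j e → ¬p (j , i , e)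
  ... | yes (i₀ , j₀ , e₀) with matching (f ∘ punchIn i₀) (g ∘ punchIn j₀)
          (λ i j e → Finₚ.punchIn-injective i₀ i j (f-inj _ _ e)) (λ i j e → Finₚ.punchIn-injective j₀ i j (g-inj _ _ e))
  ...   | h′ , h′-inj , h′-match = h , h-inj , h-match
    where
    h : Fin (suc k) → Fin (suc k)
    h a with i₀ ≟ a
    ... | yes _ = j₀
    ... | no ne = punchIn j₀ (h′ (punchOut ne))
    h-inj : ∀ a b → h a ≡ h b → a ≡ b
    h-inj a b e with i₀ ≟ a | i₀ ≟ b
    ... | yes refl | yes refl = refl
    ... | yes refl | no ne    = ⊥-elim (Finₚ.punchInᵢ≢i j₀ _ (sym e))
    ... | no ne    | yes refl = ⊥-elim (Finₚ.punchInᵢ≢i j₀ _ e)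
    ... | no na    | no nb    = Finₚ.punchOut-injective na nb (h′-inj _ _ (Finₚ.punchIn-injective j₀ _ _ e))
    h-match : ∀ a → g (h a) ≡ f a ⊎ (∀ j → f j ≢ g (h a))
    h-match a with i₀ ≟ a
    ... | yes refl = inj₁ (sym e₀)
    ... | no na with h′-match (punchOut na)
    ...   | inj₁ e  = inj₁ (trans e (cong f (Finₚ.punchIn-punchOut na)))
    ...   | inj₂ ne = inj₂ none
      where
      none : ∀ j → f j ≢ g (punchIn j₀ (h′ (punchOut na)))
      none j e with i₀ ≟ j
      ... | yes refl = Finₚ.punchInᵢ≢i j₀ _ (sym (g-inj _ _ (trans (sym e₀) e)))
      ... | no nj    = ne (punchOut nj) (trans (cong f (Finₚ.punchIn-punchOut nj)) e)

_[_↦_] : ∀ {n} → (Fin n → ℕ) → Fin n → ℕ → Fin n → ℕ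
(c [ x ↦ k ]) z with x ≟ z
... | yes _ = k
... | no  _ = c z

update-same : ∀ {n} (c : Fin n → ℕ) x k → (c [ x ↦ k ]) x ≡ k
update-same c x k with x ≟ x
... | yes _ = refl
... | no ne = ⊥-elim (ne refl)

update-other : ∀ {n} (c : Fin n → ℕ) {x z} k → x ≢ z → (c [ x ↦ k ]) z ≡ c z
update-other c {x} {z} k ne with x ≟ z
... | yes e = ⊥-elim (ne e)
... | no _  = refl

module _ {n : ℕ} {G : Graph n} where

  walk-start : ∀ {S x y} → Walk G S x y → S x
  walk-start (end s)     = s
  walk-start (via s _ _) = s

  walk-finish : ∀ {S x y} → Walk G S x y → S y
  walk-finish (end s)     = s
  walk-finish (via _ _ p) = walk-finish p

  walk-map : ∀ {S S′ x y} → (∀ {z} → S z → S′ z) → Walk G S x y → Walk G S′ x y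
  walk-map f (end s)     = end (f s)
  walk-map f (via s e p) = via (f s) e (walk-map f p)

  walk-trans : ∀ {S x y z} → Walk G S x y → Walk G S y z → Walk G S x z
  walk-trans (end _)     q = q
  walk-trans (via s e p) q = via s e (walk-trans p q)

  walk-snoc : ∀ {S x y z} → Walk G S x y → adj G y z ≡ true → S z → Walk G S x z
  walk-snoc p e s = walk-trans p (via (walk-finish p) e (end s))

  walk-sym : ∀ {S x y} → Walk G S x y → Walk G S y x
  walk-sym (end s) = end s
  walk-sym (via {x} {y} s e p) = walk-snoc (walk-sym p) (trans (adj-sym G y x) e) s

  first-visit : ∀ {S x y} (b : Fin n) → x ≢ b → Walk G S x y →
                Walk G (λ z → S z × z ≢ b) x y ⊎ ∃[ u ] (Walk G (λ z → S z × z ≢ b) x u × adj G u b ≡ true)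
  first-visit b x≢b (end s) = inj₁ (end (s , x≢b))
  first-visit b x≢b (via {x} {y} s e p) with y ≟ b
  ... | yes refl = inj₂ (x , end (s , x≢b) , e)
  ... | no y≢b with first-visit b y≢b p
  ...   | inj₁ q            = inj₁ (via (s , x≢b) e q)
  ...   | inj₂ (u , q , ub) = inj₂ (u , via (s , x≢b) e q , ub)

module Tools {n : ℕ} (G : Graph n) where
  open Adjacency G

  few-nbrs : ∀ {x} (ys : List (Fin n)) → Unique ys → (∀ {y} → y ∈ ys → x ~ y) → length ys ≤ deg G x
  few-nbrs ys uniq sub = length-⊆ uniq (∈-nbrs⁺ ∘ sub)

  abstract
    fresh : ∀ {x} (ys : List (Fin n)) → length ys < deg G x → ∃[ z ] (x ~ z × z ∉ ys)
    fresh {x} ys lt with Finₚ.any? (λ z → (x ~? z) ×-dec ¬? (_∈?_ _≟_ z ys))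
    ... | yes p = p
    ... | no ¬p = ⊥-elim (ℕₚ.<⇒≱ lt (length-⊆ (nbrs-unique x) sub))
      where
      sub : ∀ {z} → z ∈ nbrs x → z ∈ ys
      sub {z} z∈ with _∈?_ _≟_ z ys
      ... | yes q = q
      ... | no ¬q = ⊥-elim (¬p (z , ∈-nbrs⁻ z∈ , ¬q))

  abstract
    -- If all four colours were blocked by neighbours outside `ys`, these would be distinct, as
    -- their colours are, and together with `ys` exceed the degree.
    freeColour : ∀ {x} (ys : List (Fin n)) → Unique ys → (∀ {y} → y ∈ ys → x ~ y) → deg G x < 4 + length ys →
      (c : Fin n → ℕ) (l : Fin 4 → ℕ) → (∀ i j → l i ≡ l j → i ≡ j) →
      ∃[ i ] (∀ z → x ~ z → z ∉ ys → c z ≢ l i)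
    freeColour {x} ys uniq sub d< c l inj = finish (∀⊎∃ search)
      where
      Used : Fin 4 → Fin n → Set
      Used i z = x ~ z × z ∉ ys × c z ≡ l i
      search : ∀ i → ∃ (Used i) ⊎ (∀ z → x ~ z → z ∉ ys → c z ≢ l i)
      search i with Finₚ.any? (λ z → (x ~? z) ×-dec ¬? (_∈?_ _≟_ z ys) ×-dec (c z ℕₚ.≟ l i))
      ... | yes p = inj₁ p
      ... | no ¬p = inj₂ λ z xz z∉ e → ¬p (z , xz , z∉ , e)
      finish : (∀ i → ∃ (Used i)) ⊎ ∃[ i ] (∀ z → x ~ z → z ∉ ys → c z ≢ l i) → ∃[ i ] (∀ z → x ~ z → z ∉ ys → c z ≢ l i)
      finish (inj₂ r) = r
      finish (inj₁ used) = ⊥-elim (ℕₚ.<⇒≱ d< (few-nbrs (zs ++ ys) (++⁺ zs-unique uniq disjoint) all))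
        where
        z : Fin 4 → Fin n
        z i = proj₁ (used i)
        zs : List (Fin n)
        zs = tabulate z
        zs-unique : Unique zs
        zs-unique = tabulate⁺ λ {i} {j} e → inj i j
          (trans (sym (proj₂ (proj₂ (proj₂ (used i))))) (trans (cong c e) (proj₂ (proj₂ (proj₂ (used j))))))
        disjoint : ∀ {u} → ¬ (u ∈ zs × u ∈ ys)
        disjoint (u∈ , u∈ys) with ∈-tabulate⁻ {f = z} u∈
        ... | i , refl = proj₁ (proj₂ (proj₂ (used i))) u∈ys
        all : ∀ {u} → u ∈ zs ++ ys → x ~ u
        all u∈ with ∈-++⁻ zs u∈
        ... | inj₂ u∈ys = sub u∈ys
        ... | inj₁ u∈zs with ∈-tabulate⁻ {f = z} u∈zs
        ...   | i , refl = proj₁ (proj₂ (used i))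

  Colouring : Lists n → Set
  Colouring L = Σ (Fin n → ℕ) λ c → (∀ x → ∃[ i ] L x i ≡ c x) × (∀ x z → x ~ z → c x ≢ c z)

  -- Listed from the last vertex added back to the root r.
  data Order (r : Fin n) : List (Fin n) → Set where
    root : Order r (r ∷ [])
    grow : ∀ {ys x y} → Order r ys → x ∉ ys → y ∈ ys → x ~ y → Order r (x ∷ ys)

  order-unique : ∀ {r ys} → Order r ys → Unique ys
  order-unique root = [] ∷ []
  order-unique (grow {ys} {x} o x∉ _ _) = All.tabulate (λ z∈ → λ { refl → x∉ z∈ }) ∷ order-unique o

  order-root : ∀ {r ys} → Order r ys → r ∈ ys
  order-root root = here refl
  order-root (grow o _ _ _) = there (order-root o)

  order-walk : ∀ {S r ys} → Order r ys → (∀ {y} → y ∈ ys → S y) → ∀ {y} → y ∈ ys → Walk G S r y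
  order-walk root s (here refl) = end (s (here refl))
  order-walk (grow o x∉ y∈ xy) s (here refl) = walk-snoc (order-walk o (s ∘ there) y∈) (~-sym xy) (s (here refl))
  order-walk (grow o x∉ y∈ xy) s (there z∈)  = order-walk o (s ∘ there) z∈

  -- Colour the vertices of the order one by one, the root r last. Every other vertex has an uncoloured
  -- neighbour when its turn comes; the neighbour p of r costs r no colour.
  colourOrder : (L : Lists n) → Proper L → ∀ {r p ys} → Order r ys → (∀ {y} → y ∈ ys → deg G y ≤ 4) →
    (c : Fin n → ℕ) → (∀ {x} → x ∉ ys → ∃[ i ] L x i ≡ c x) → (∀ {x z} → x ∉ ys → z ∉ ys → x ~ z → c x ≢ c z) →
    r ~ p → p ∉ ys → (∀ i → L r i ≡ c p → ∃[ u ] (r ~ u × u ≢ p × u ∉ ys × c u ≡ c p)) → Colouring L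
  colourOrder L inj {r} {p} {ys} o d≤4 c lst prop rp p∉ red = go o d≤4 c lst prop p∉ red
    where
    extend : ∀ {x ys} (c : Fin n → ℕ) i → (∀ {x′} → x′ ∉ x ∷ ys → ∃[ i ] L x′ i ≡ c x′) →
      ∀ {z} → z ∉ ys → ∃[ j ] L z j ≡ (c [ x ↦ L x i ]) z
    extend {x} c i lst {z} z∉ with x ≟ z
    ... | yes refl = i , refl
    ... | no ne    = lst λ { (here e) → ne (sym e) ; (there z∈) → z∉ z∈ }
    extend-proper : ∀ {x ys} (c : Fin n → ℕ) k → (∀ {a b} → a ∉ x ∷ ys → b ∉ x ∷ ys → a ~ b → c a ≢ c b) →
      (∀ z → x ~ z → z ∉ ys → c z ≢ k) → ∀ {a b} → a ∉ ys → b ∉ ys → a ~ b → (c [ x ↦ k ]) a ≢ (c [ x ↦ k ]) b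
    extend-proper {x} c k prop free {a} {b} a∉ b∉ ab with x ≟ a | x ≟ b
    ... | yes refl | yes refl = ⊥-elim (~⇒≢ ab refl)
    ... | yes refl | no _     = free b ab b∉ ∘ sym
    ... | no _     | yes refl = free a (~-sym ab) a∉
    ... | no na    | no nb    = prop (λ { (here e) → na (sym e) ; (there m) → a∉ m }) (λ { (here e) → nb (sym e) ; (there m) → b∉ m }) ab
    go : ∀ {ys} → Order r ys → (∀ {y} → y ∈ ys → deg G y ≤ 4) →
      (c : Fin n → ℕ) → (∀ {x} → x ∉ ys → ∃[ i ] L x i ≡ c x) → (∀ {x z} → x ∉ ys → z ∉ ys → x ~ z → c x ≢ c z) →
      p ∉ ys → (∀ i → L r i ≡ c p → ∃[ u ] (r ~ u × u ≢ p × u ∉ ys × c u ≡ c p)) → Colouring L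
    go root d≤4 c lst prop p∉ red
      with freeColour (p ∷ []) ([] ∷ []) (λ { (here refl) → rp }) (s≤s (d≤4 (here refl))) c (L r) (inj r)
    ... | i , free = c [ r ↦ L r i ] , (λ x → extend {ys = []} c i lst λ ())
        , λ a b → extend-proper {ys = []} c (L r i) prop free′ (λ ()) (λ ())
      where
      free′ : ∀ z → r ~ z → z ∉ [] → c z ≢ L r i
      -- A clash with `p` is also a clash with another neighbour of the same colour, which has been
      -- counted.
      free′ z rz _ e with z ≟ p
      ... | no z≢p = free z rz (λ { (here eq) → z≢p eq }) e
      ... | yes refl with red i (sym e)
      ...   | u , ru , u≢p , _ , eq = free u ru (λ { (here eq′) → u≢p eq′ }) (trans eq e)
    go (grow {ys} {x} {y} o x∉ y∈ xy) d≤4 c lst prop p∉ red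
      with freeColour (y ∷ []) ([] ∷ []) (λ { (here refl) → xy }) (s≤s (d≤4 (here refl))) c (L x) (inj x)
    ... | i , free = go o (d≤4 ∘ there) (c [ x ↦ L x i ]) (extend c i lst)
        (extend-proper c (L x i) prop λ z xz z∉ → free z xz λ { (here refl) → z∉ y∈ })
        (p∉ ∘ there) red′
      where
      keep : ∀ {z} → z ∉ x ∷ ys → (c [ x ↦ L x i ]) z ≡ c z
      keep z∉ = update-other c (L x i) λ e → z∉ (here (sym e))
      red′ : ∀ j → L r j ≡ (c [ x ↦ L x i ]) p → ∃[ u ] (r ~ u × u ≢ p × u ∉ ys × (c [ x ↦ L x i ]) u ≡ (c [ x ↦ L x i ]) p)
      red′ j e with red j (trans e (keep p∉))
      ... | u , ru , u≢p , u∉ , eq = u , ru , u≢p , u∉ ∘ there , trans (keep u∉) (trans eq (sym (keep p∉)))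

  module _ {S : Fin n → Set} (S? : ∀ x → Dec (S x)) where

    record Component (r : Fin n) : Set where
      field
        vertices : List (Fin n)
        order    : Order r vertices
        inside   : ∀ {y} → y ∈ vertices → S y
        closed   : ∀ {y z} → y ∈ vertices → y ~ z → S z → z ∈ vertices

      reach : ∀ {z} → Walk G S r z → z ∈ vertices
      reach = along (order-root order)
        where
        along : ∀ {x z} → x ∈ vertices → Walk G S x z → z ∈ vertices
        along x∈ (end _)     = x∈
        along x∈ (via _ e p) = along (closed x∈ e (walk-start p)) p

      walk : ∀ {z} → z ∈ vertices → Walk G S r z
      walk = order-walk order inside

    abstract
      component : ∀ r → S r → Component r
      component r Sr = loop (suc n) root (λ { (here refl) → Sr }) (ℕₚ.m≤n+m (suc n) 1)
        where
        loop : ∀ fuel {ys} → Order r ys → (∀ {y} → y ∈ ys → S y) → n < length ys + fuel → Component r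
        -- The list has no duplicates, so it cannot outgrow the n vertices.
        loop zero {ys} o s lt = ⊥-elim (ℕₚ.<⇒≱ (subst (n <_) (ℕₚ.+-identityʳ _) lt)
          (subst (length ys ≤_) (length-tabulate {n = n} (λ i → i)) (length-⊆ {ys = allFin n} (order-unique o) λ {x} _ → ∈-allFin x)))
        loop (suc fuel) {ys} o s lt
          with Finₚ.any? (λ z → S? z ×-dec ¬? (_∈?_ _≟_ z ys) ×-dec Any.any? (λ y → z ~? y) ys)
        ... | yes (z , Sz , z∉ , w) = let y , y∈ , zy = find w in
              loop fuel (grow o z∉ y∈ zy) (λ { (here refl) → Sz ; (there m) → s m }) (subst (n <_) (ℕₚ.+-suc _ fuel) lt)
        ... | no ¬p = record { vertices = ys ; order = o ; inside = s ; closed = closed′ }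
          where
          closed′ : ∀ {y z} → y ∈ ys → y ~ z → S z → z ∈ ys
          closed′ {y} {z} y∈ yz Sz with _∈?_ _≟_ z ys
          ... | yes m = m
          ... | no z∉ = ⊥-elim (¬p (z , Sz , z∉ , lose y∈ (~-sym yz)))

    abstract
      walk? : ∀ x y → Dec (Walk G S x y)
      walk? x y with S? x
      ... | no ¬s = no (¬s ∘ walk-start)
      ... | yes s = map′ C.walk C.reach (_∈?_ _≟_ y C.vertices)
        where module C = Component (component x s)

-- Reducible configurations

module Minimal {n : ℕ} (M : PlaneMap 4 n)
  (choose : ∀ m → m < n → (H : Graph m) → Planar H → Choosable H 4) (¬choosable : ¬ Choosable (graph M) 4) where

  G : Graph n
  G = graph M
  open Adjacency G
  open Tools G

  _∈ᵛ?_ : ∀ x (ys : List (Fin n)) → Dec (x ∈ ys)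
  _∈ᵛ?_ = _∈?_ _≟_

  -- An edge at `x` is contracted instead of deleting `x`, which could disconnect the map. The
  -- contraction ignores the list of `x`, which is coloured last, with fewer than four neighbours.
  min-degree : ∀ {x r} → x ~ r → 4 ≤ deg G x
  min-degree {x} {r} xr with 4 ℕₚ.≤? deg G x
  ... | yes p = p
  ... | no ¬p = ⊥-elim (¬choosable λ L inj → colouring L inj)
    where
    κ : Fin n → Fin n
    κ z with x ≟ z
    ... | yes _ = r
    ... | no  _ = z
    κ-x : κ x ≡ r
    κ-x with x ≟ x
    ... | yes _ = refl
    ... | no ne = ⊥-elim (ne refl)
    κ-other : ∀ {z} → x ≢ z → κ z ≡ z
    κ-other {z} ne with x ≟ z
    ... | yes e = ⊥-elim (ne e)
    ... | no _  = refl
    colouring : (L : Lists n) → Proper L → Colouring L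
    colouring L inj = c [ x ↦ L x i ] , listed′ , proper
      where
      C = classColouring M choose κ xr (trans κ-x (sym (κ-other (~⇒≢ xr)))) (L ∘ κ) (inj ∘ κ)
            (λ e i → cong (λ u → L u i) e)
      c = colour C
      free = freeColour {x} [] [] (λ ()) (ℕₚ.≰⇒> ¬p) c (L x) (inj x)
      i = proj₁ free
      listed′ : ∀ z → ∃[ j ] L z j ≡ (c [ x ↦ L x i ]) z
      listed′ z with x ≟ z
      ... | yes refl = i , refl
      ... | no ne    = let j , e = listed C z in j , trans (cong (λ u → L u j) (sym (κ-other ne))) e
      proper : ∀ a b → a ~ b → (c [ x ↦ L x i ]) a ≢ (c [ x ↦ L x i ]) b
      proper a b ab with x ≟ a | x ≟ b
      ... | yes refl | yes refl = ⊥-elim (~⇒≢ ab refl)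
      ... | yes refl | no _     = proj₂ free b ab (λ ()) ∘ sym
      ... | no _     | yes refl = proj₂ free a (~-sym ab) λ ()
      ... | no na    | no nb    = distinct C ab λ e → ~⇒≢ ab (trans (sym (κ-other na)) (trans e (κ-other nb)))

  fourColours : Lists n
  fourColours _ = toℕ

  -- The form in which a K₅ minor contradicts minimality: contracting the classes forces five
  -- vertices apart, yet only four colours are on offer. At least one edge must really be
  -- contracted, because minimality speaks of smaller graphs.
  noK₅ : (κ : Fin n → Fin n) → ∀ {x₀ z₀} → x₀ ~ z₀ → κ x₀ ≡ κ z₀ → (us : List (Fin n)) → 5 ≤ length us →
         ((C : ClassColouring G κ fourColours) → Unique (map (colour C) us)) → ⊥
  noK₅ κ e₀ κ₀ us len uniq = ℕₚ.<⇒≱ len (subst (_≤ 4) (length-map (colour C) us) (length-⊆ (uniq C) sub))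
    where
    C = classColouring M choose κ e₀ κ₀ fourColours (λ _ _ _ → Finₚ.toℕ-injective) (λ _ _ → refl)
    sub : ∀ {k} → k ∈ map (colour C) us → k ∈ tabulate {n = 4} toℕ
    sub k∈ with ∈-map⁻ (colour C) k∈
    ... | u , _ , refl with listed C u
    ...   | i , e = subst (_∈ tabulate {n = 4} toℕ) e (∈-tabulate⁺ {f = toℕ} i)

  -- The component of `a` in G - v, and the rest of G - v as a colour gadget

  module Lobe {v a : Fin n} (va : v ~ a) where

    K Out : Fin n → Set
    K x = Walk G (λ z → z ≢ v) a x
    Out x = x ≢ v × ¬ K x

    K? : ∀ x → Dec (K x)
    K? = walk? (λ z → ¬? (z ≟ v)) a

    out? : ∀ x → Dec (Out x)
    out? x = ¬? (x ≟ v) ×-dec ¬? (K? x)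

    K-step : ∀ {x z} → K x → x ~ z → z ≢ v → K z
    K-step = walk-snoc

    -- The i-th colour of v extends to Out.
    Fits : Lists n → Fin 4 → (Fin n → Fin 4) → Set
    Fits L i f = (∀ x z → Out x → Out z → x ~ z → L x (f x) ≢ L z (f z)) × (∀ x → Out x → x ~ v → L x (f x) ≢ L v i)

    Good : Lists n → Fin 4 → Set
    Good L i = ∃ (Fits L i)

    abstract
      good? : ∀ L i → Dec (Good L i)
      good? L i = ∃-function? {P = Fits L i}
        (λ {f} {g} e (p , q) →
            (λ x z ox oz xz → subst (λ t → L x t ≢ L z (g z)) (e x) (subst (λ t → L x (f x) ≢ L z t) (e z) (p x z ox oz xz)))
          , (λ x ox xv → subst (λ t → L x t ≢ L v i) (e x) (q x ox xv)))
        λ f → (Finₚ.all? λ x → Finₚ.all? λ z → out? x →-dec (out? z →-dec ((x ~? z) →-dec ¬? (L x (f x) ℕₚ.≟ L z (f z)))))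
            ×-dec (Finₚ.all? λ x → out? x →-dec ((x ~? v) →-dec ¬? (L x (f x) ℕₚ.≟ L v i)))

    record PartialColouring (L : Lists n) (i : Fin 4) (ys : List (Fin n)) (d : Fin n → ℕ) : Set where
      field
        c       : Fin n → ℕ
        c-list  : ∀ {x} → x ∉ ys → ∃[ j ] L x j ≡ c x
        c-proper : ∀ {x z} → x ∉ ys → z ∉ ys → x ~ z → c x ≢ c z
        c-v     : c v ≡ L v i
        c-K     : ∀ {x} → K x → c x ≡ d x

    abstract
      -- No edge joins `K` to `Out`, so their colourings have to agree only with the colour of `v`.
      assemble : ∀ L i → Good L i → ∀ ys (d : Fin n → ℕ) → (∀ {x} → K x → x ∉ ys → ∃[ j ] L x j ≡ d x) →
        (∀ {x z} → K x → K z → x ∉ ys → z ∉ ys → x ~ z → d x ≢ d z) →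
        (∀ {z} → K z → z ∉ ys → v ~ z → d z ≢ L v i) → PartialColouring L i ys d
      assemble L i (f , ok , okv) ys d lst prop vprop =
        record { c = c ; c-list = λ {x} → c-list x ; c-proper = λ {x} {z} → c-proper x z ; c-v = c-v ; c-K = λ {x} → c-K x }
        where
        c : Fin n → ℕ
        c x with x ≟ v | K? x
        ... | yes _ | _     = L v i
        ... | no _  | yes _ = d x
        ... | no _  | no _  = L x (f x)
        c-list : ∀ x → x ∉ ys → ∃[ j ] L x j ≡ c x
        c-list x x∉ with x ≟ v | K? x
        ... | yes refl | _     = i , refl
        ... | no _     | yes k = lst k x∉
        ... | no _     | no _  = f x , refl
        c-v : c v ≡ L v i
        c-v with v ≟ v | K? v
        ... | yes _ | _ = refl
        ... | no ne | _ = ⊥-elim (ne refl)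
        c-K : ∀ x → K x → c x ≡ d x
        c-K x k with x ≟ v | K? x
        ... | yes e | _     = ⊥-elim (walk-finish k e)
        ... | no _  | yes _ = refl
        ... | no _  | no ¬k = ⊥-elim (¬k k)
        c-proper : ∀ x z → x ∉ ys → z ∉ ys → x ~ z → c x ≢ c z
        c-proper x z x∉ z∉ xz with x ≟ v | K? x | z ≟ v | K? z
        ... | yes refl | _ | yes refl | _ = ⊥-elim (~⇒≢ xz refl)
        ... | yes refl | _ | no _ | yes k = vprop k z∉ xz ∘ sym
        ... | yes refl | _ | no z≢ | no ¬k = okv z (z≢ , ¬k) (~-sym xz) ∘ sym
        ... | no _ | yes k | yes refl | _ = vprop k x∉ (~-sym xz)
        ... | no x≢ | no ¬k | yes refl | _ = okv x (x≢ , ¬k) xz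
        ... | no _ | yes k | no _ | yes k′ = prop k k′ x∉ z∉ xz
        ... | no _ | yes k | no z≢ | no ¬k = ⊥-elim (¬k (K-step k xz z≢))
        ... | no x≢ | no ¬k | no _ | yes k = ⊥-elim (¬k (K-step k (~-sym xz) x≢))
        ... | no x≢ | no ¬k | no z≢ | no ¬k′ = ok x z (x≢ , ¬k) (z≢ , ¬k′) xz

    record Gadget (L : Lists n) (ws : List (Fin n)) (P : Fin 4 → ℕ) : Set where
      field
        i        : Fin 4
        good     : Good L i
        d        : Fin n → ℕ
        d-list   : ∀ {x} → K x → x ∉ ws → ∃[ j ] L x j ≡ d x
        d-proper : ∀ {x z} → K x → K z → x ∉ ws → z ∉ ws → x ~ z → d x ≢ d z
        d-≢P     : ∀ {x u} → K x → x ∉ ws → Walk G (_∈ ws) v u → x ~ u → d x ≢ P i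

    -- Contract ws. The part Out, with its colours made odd, rejects the colours of the contracted vertex
    -- that stand for the bad indices, so it receives some P i with i good.
    abstract
      gadget : ∀ L → Proper L → ∀ ws → v ∈ ws → (∀ {x} → x ∈ ws → x ≢ v → K x) → ∀ {w} → w ∈ ws → v ~ w →
        (P : Fin 4 → ℕ) → (∀ {i j} → Good L i → Good L j → P i ≡ P j → i ≡ j) → Gadget L ws P
      gadget L inj ws v∈ ws⊆K {w} w∈ vw P P-inj = result
        where
        κ : Fin n → Fin n
        κ x with x ∈ᵛ? ws
        ... | yes _ = v
        ... | no  _ = x
        κ-in : ∀ {x} → x ∈ ws → κ x ≡ v
        κ-in {x} x∈ with x ∈ᵛ? ws
        ... | yes _ = refl
        ... | no ne = ⊥-elim (ne x∈)
        κ-out : ∀ {x} → x ∉ ws → κ x ≡ x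
        κ-out {x} x∉ with x ∈ᵛ? ws
        ... | yes x∈ = ⊥-elim (x∉ x∈)
        ... | no _   = refl
        κ-apart : ∀ {x z} → x ∉ ws → x ≢ z → κ x ≢ κ z
        κ-apart {x} {z} x∉ ne e with z ∈ᵛ? ws
        ... | yes _ = x∉ (subst (_∈ ws) (trans (sym e) (κ-out x∉)) v∈)
        ... | no _  = ne (trans (sym (κ-out x∉)) e)

        -- Parity separates the two sides: even values can clash only with `K`, odd ones only with
        -- `Out`. A good index stands for a colour harmless to `Out`, a bad one confronts `Out` with
        -- the actual colour of `v`.
        lw : Fin 4 → ℕ
        lw i with good? L i
        ... | yes _ = 2 * P i
        ... | no  _ = suc (2 * L v i)
        lw-inj : ∀ i j → lw i ≡ lw j → i ≡ j
        lw-inj i j e with good? L i | good? L j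
        ... | yes g | yes g′ = P-inj g g′ (ℕₚ.*-cancelˡ-≡ _ _ 2 e)
        ... | yes _ | no _   = ⊥-elim (ℕₚ.even≢odd (P i) (L v j) e)
        ... | no _  | yes _  = ⊥-elim (ℕₚ.even≢odd (P j) (L v i) (sym e))
        ... | no _  | no _   = inj v i j (ℕₚ.*-cancelˡ-≡ _ _ 2 (ℕₚ.suc-injective e))

        L′ : Lists n
        L′ x i with x ∈ᵛ? ws | K? x
        ... | yes _ | _     = lw i
        ... | no _  | yes _ = 2 * L x i
        ... | no _  | no _  = suc (2 * L x i)
        L′-in : ∀ {x} → x ∈ ws → ∀ i → L′ x i ≡ lw i
        L′-in {x} x∈ i with x ∈ᵛ? ws | K? x
        ... | yes _ | _ = refl
        ... | no ne | _ = ⊥-elim (ne x∈)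
        L′-K : ∀ {x} → x ∉ ws → K x → ∀ i → L′ x i ≡ 2 * L x i
        L′-K {x} x∉ k i with x ∈ᵛ? ws | K? x
        ... | yes x∈ | _     = ⊥-elim (x∉ x∈)
        ... | no _   | yes _ = refl
        ... | no _   | no ¬k = ⊥-elim (¬k k)
        L′-out : ∀ {x} → x ∉ ws → ¬ K x → ∀ i → L′ x i ≡ suc (2 * L x i)
        L′-out {x} x∉ ¬k i with x ∈ᵛ? ws | K? x
        ... | yes x∈ | _     = ⊥-elim (x∉ x∈)
        ... | no _   | yes k = ⊥-elim (¬k k)
        ... | no _   | no _  = refl
        L′-inj : Proper L′
        L′-inj x i j e with x ∈ᵛ? ws | K? x
        ... | yes _ | _     = lw-inj i j e
        ... | no _  | yes _ = inj x i j (ℕₚ.*-cancelˡ-≡ _ _ 2 e)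
        ... | no _  | no _  = inj x i j (ℕₚ.*-cancelˡ-≡ _ _ 2 (ℕₚ.suc-injective e))
        L′-κ : ∀ {x z} → κ x ≡ κ z → ∀ i → L′ x i ≡ L′ z i
        L′-κ {x} {z} e i = go (x ≟ z) (x ∈ᵛ? ws) (z ∈ᵛ? ws)
          where
          go : Dec (x ≡ z) → Dec (x ∈ ws) → Dec (z ∈ ws) → L′ x i ≡ L′ z i
          go (yes refl) _        _        = refl
          go (no _)     (yes x∈) (yes z∈) = trans (L′-in x∈ i) (sym (L′-in z∈ i))
          go (no ne)    (no x∉)  _        = ⊥-elim (κ-apart x∉ ne e)
          go (no ne)    (yes _)  (no z∉)  = ⊥-elim (κ-apart z∉ (ne ∘ sym) (sym e))

        C : ClassColouring G κ L′
        C = classColouring M choose κ vw (trans (κ-in v∈) (sym (κ-in w∈))) L′ L′-inj L′-κ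

        out∉ws : ∀ {x} → Out x → x ∉ ws
        out∉ws (x≢v , ¬k) x∈ = ¬k (ws⊆K x∈ x≢v)

        f : Fin n → Fin 4
        f x = proj₁ (listed C x)

        i₀ : Fin 4
        i₀ = f v
        colour-v : colour C v ≡ lw i₀
        colour-v = trans (sym (proj₂ (listed C v))) (L′-in v∈ i₀)

        colour-out : ∀ {x} → Out x → colour C x ≡ suc (2 * L x (f x))
        colour-out {x} ox = trans (sym (proj₂ (listed C x))) (L′-out (out∉ws ox) (proj₂ ox) (f x))

        colour-K : ∀ {x} → K x → x ∉ ws → colour C x ≡ 2 * L x (f x)
        colour-K {x} k x∉ = trans (sym (proj₂ (listed C x))) (L′-K x∉ k (f x))

        lw-good : ∀ {i} → Good L i → lw i ≡ 2 * P i
        lw-good {i} g with good? L i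
        ... | yes _ = refl
        ... | no ¬g = ⊥-elim (¬g g)

        lw-bad : ∀ {i} → ¬ Good L i → lw i ≡ suc (2 * L v i)
        lw-bad {i} ¬g with good? L i
        ... | yes g = ⊥-elim (¬g g)
        ... | no _  = refl

        -- With the odd colour of a bad index on the contracted vertex, the colours on `Out` would
        -- themselves show that the index is good.
        rejected : ¬ Good L i₀ → Good L i₀
        rejected ¬g = f , (λ x z ox oz xz e → distinct C xz (κ-apart (out∉ws ox) (~⇒≢ xz))
                            (trans (colour-out ox) (trans (cong (λ t → suc (2 * t)) e) (sym (colour-out oz)))))
                        , (λ x ox xv e → distinct C xv (κ-apart (out∉ws ox) (~⇒≢ xv))
                            (trans (colour-out ox) (trans (cong (λ t → suc (2 * t)) e) (sym (trans colour-v (lw-bad ¬g))))))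

        i₀-good : Good L i₀
        i₀-good with good? L i₀
        ... | yes g = g
        ... | no ¬g = rejected ¬g

        along : ∀ {y u} → Walk G (_∈ ws) y u → colour C y ≡ colour C u
        along (end _) = refl
        along (via y∈ e p) = trans (constant C e (trans (κ-in y∈) (sym (κ-in (walk-start p))))) (along p)

        result : Gadget L ws P
        result = record
          { i = i₀ ; good = i₀-good ; d = λ x → L x (f x)
          ; d-list = λ {x} _ _ → f x , refl
          ; d-proper = λ {x} {z} k k′ x∉ z∉ xz e → distinct C xz (κ-apart x∉ (~⇒≢ xz))
              (trans (colour-K k x∉) (trans (cong (2 *_) e) (sym (colour-K k′ z∉))))
          ; d-≢P = λ {x} {u} k x∉ p xu e → distinct C xu (κ-apart x∉ (~⇒≢ xu))
              (trans (colour-K k x∉) (trans (cong (2 *_) e) (trans (sym (trans colour-v (lw-good i₀-good))) (along p)))) }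

    K-a : K a
    K-a = end (~⇒≢ va ∘ sym)

    -- A permutation of the indices without fixed points.
    next prev : Fin 4 → Fin 4
    next zero                   = suc zero
    next (suc zero)             = suc (suc zero)
    next (suc (suc zero))       = suc (suc (suc zero))
    next (suc (suc (suc zero))) = zero
    prev zero                   = suc (suc (suc zero))
    prev (suc zero)             = zero
    prev (suc (suc zero))       = suc zero
    prev (suc (suc (suc zero))) = suc (suc zero)

    prev-next : ∀ i → prev (next i) ≡ i
    prev-next zero                   = refl
    prev-next (suc zero)             = refl
    prev-next (suc (suc zero))       = refl
    prev-next (suc (suc (suc zero))) = refl

    next-inj : ∀ i j → next i ≡ next j → i ≡ j
    next-inj i j e = trans (sym (prev-next i)) (trans (cong prev e) (prev-next j))

    next-≢ : ∀ i → next i ≢ i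
    next-≢ zero ()
    next-≢ (suc zero) ()
    next-≢ (suc (suc zero)) ()
    next-≢ (suc (suc (suc zero))) ()

    -- Contracting `v a` yields one index for both ends. Shifted by `next` and read through the
    -- matched lists, it gives `a` a colour different from that of `v`, and no other edge joins `v`
    -- to `K`.
    no-bridge : ¬ (∀ {z} → v ~ z → K z → z ≡ a)
    no-bridge only = ¬choosable colouring
      where
      colouring : (L : Lists n) → Proper L → Colouring L
      colouring L inj = Q.c , (λ x → Q.c-list λ ()) , (λ x z → Q.c-proper (λ ()) (λ ()))
        where
        mt = matching (L v) (L a) (inj v) (inj a)
        h = proj₁ mt
        P : Fin 4 → ℕ
        P i = L a (h (next i))
        ws = v ∷ a ∷ []
        ws⊆K : ∀ {x} → x ∈ ws → x ≢ v → K x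
        ws⊆K (here e)            ne = ⊥-elim (ne e)
        ws⊆K (there (here refl)) _  = K-a
        D : Gadget L ws P
        D = gadget L inj ws (here refl) ws⊆K (there (here refl)) va P
              (λ _ _ e → next-inj _ _ (proj₁ (proj₂ mt) _ _ (inj a _ _ e)))
        module D = Gadget D
        d′ = D.d [ a ↦ P D.i ]
        ∉ws : ∀ {x} → K x → a ≢ x → x ∉ ws
        ∉ws k ne (here e) = walk-finish k e
        ∉ws k ne (there (here e)) = ne (sym e)
        lst : ∀ {x} → K x → x ∉ [] → ∃[ j ] L x j ≡ d′ x
        lst {x} k _ with a ≟ x
        ... | yes refl = h (next D.i) , refl
        ... | no ne    = D.d-list k (∉ws k ne)
        prop : ∀ {x z} → K x → K z → x ∉ [] → z ∉ [] → x ~ z → d′ x ≢ d′ z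
        prop {x} {z} k k′ _ _ xz with a ≟ x | a ≟ z
        ... | yes refl | yes refl = ⊥-elim (~⇒≢ xz refl)
        ... | yes refl | no ne    = D.d-≢P k′ (∉ws k′ ne) toA (~-sym xz) ∘ sym
          where toA = via (here refl) va (end (there (here refl)))
        ... | no ne    | yes refl = D.d-≢P k (∉ws k ne) toA xz
          where toA = via (here refl) va (end (there (here refl)))
        ... | no ne    | no ne′   = D.d-proper k k′ (∉ws k ne) (∉ws k′ ne′) xz
        vprop : ∀ {z} → K z → z ∉ [] → v ~ z → d′ z ≢ L v D.i
        vprop {z} k _ vz e with only vz k
        ... | refl with proj₂ (proj₂ mt) (next D.i) | trans (sym (update-same D.d a (P D.i))) e
        ...   | inj₁ m | e′ = next-≢ D.i (inj v _ _ (trans (sym m) e′))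
        ...   | inj₂ m | e′ = m D.i (sym e′)
        module Q = PartialColouring (assemble L D.i D.good [] d′ lst prop vprop)

    -- p takes no colour away from w: it is given either the colour of v or one outside the list of w.
    no-surplus : ∀ {S : Fin n → Set} (S? : ∀ x → Dec (S x)) → (∀ {x} → S x → x ≢ v × deg G x ≤ 4) → ∀ {w p} → v ~ w → K w →
      (∀ {z} → v ~ z → K z → Walk G S w z) → w ~ p → p ≢ v → ¬ ¬ S p
    no-surplus {S} S? S-ok {w} {p} vw Kw T wp p≢v ¬Sp = ¬choosable colouring
      where
      Sw = walk-start (T vw Kw)
      module X = Component (component S? w Sw)
      X⊆K : ∀ {x} → x ∈ X.vertices → K x
      X⊆K x∈ = walk-trans Kw (walk-map (proj₁ ∘ S-ok) (X.walk x∈))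
      Kp : K p
      Kp = K-step Kw wp p≢v
      v∉X : v ∉ X.vertices
      v∉X v∈ = proj₁ (S-ok (X.inside v∈)) refl
      p∉X : p ∉ X.vertices
      p∉X p∈ = ¬Sp (X.inside p∈)
      w∈X = order-root X.order
      d≤4 : ∀ {y} → y ∈ X.vertices → deg G y ≤ 4
      d≤4 y∈ = proj₂ (S-ok (X.inside y∈))
      T⊆X : ∀ {z} → K z → v ~ z → z ∈ X.vertices
      T⊆X k vz = X.reach (T vz k)
      ws = v ∷ p ∷ X.vertices
      ws⊆K : ∀ {x} → x ∈ ws → x ≢ v → K x
      ws⊆K (here e) ne = ⊥-elim (ne e)
      ws⊆K (there (here refl)) _ = Kp
      ws⊆K (there (there x∈)) _ = X⊆K x∈
      toP : Walk G (_∈ ws) v p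
      toP = via (here refl) vw (via (there (there w∈X)) wp (end (there (here refl))))
      colouring : (L : Lists n) → Proper L → Colouring L
      colouring L inj = split (∀⊎∃ test)
        where
        Common : Fin 4 → Set
        Common i = Good L i → ∃[ t ] L w t ≡ L v i
        test : ∀ i → Common i ⊎ (Good L i × (∀ t → L w t ≢ L v i))
        test i with good? L i | Finₚ.any? (λ t → L w t ℕₚ.≟ L v i)
        ... | _     | yes t = inj₁ λ _ → t
        ... | no ¬g | no _  = inj₁ λ g → ⊥-elim (¬g g)
        ... | yes g | no ¬t = inj₂ (g , λ t e → ¬t (t , e))
        module _ (P : Fin 4 → ℕ) (P-list : ∀ i → Good L i → ∃[ j ] L p j ≡ P i) (D : Gadget L ws P) where
          module D = Gadget D
          d′ = D.d [ p ↦ P D.i ]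
          ∉ws : ∀ {x} → K x → x ∉ X.vertices → p ≢ x → x ∉ ws
          ∉ws k x∉ ne (here e) = walk-finish k e
          ∉ws k x∉ ne (there (here e)) = ne (sym e)
          ∉ws k x∉ ne (there (there x∈)) = x∉ x∈
          lst : ∀ {x} → K x → x ∉ X.vertices → ∃[ j ] L x j ≡ d′ x
          lst {x} k x∉ with p ≟ x
          ... | yes refl = P-list D.i D.good
          ... | no ne    = D.d-list k (∉ws k x∉ ne)
          prop : ∀ {x z} → K x → K z → x ∉ X.vertices → z ∉ X.vertices → x ~ z → d′ x ≢ d′ z
          prop {x} {z} k k′ x∉ z∉ xz with p ≟ x | p ≟ z
          ... | yes refl | yes refl = ⊥-elim (~⇒≢ xz refl)
          ... | yes refl | no ne    = D.d-≢P k′ (∉ws k′ z∉ ne) toP (~-sym xz) ∘ sym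
          ... | no ne    | yes refl = D.d-≢P k (∉ws k x∉ ne) toP xz
          ... | no ne    | no ne′   = D.d-proper k k′ (∉ws k x∉ ne) (∉ws k′ z∉ ne′) xz
          partial : ∀ i → Good L i → PartialColouring L i X.vertices d′
          partial i g = assemble L i g X.vertices d′ lst prop (λ k z∉ vz _ → z∉ (T⊆X k vz))
        split : (∀ i → Common i) ⊎ ∃[ i ] (Good L i × (∀ t → L w t ≢ L v i)) → Colouring L
        -- The neighbour that costs `w` nothing is `v` here, as colour `i` is missing from the list
        -- of `w`. It may replace the index found by the gadget because all neighbours of `v` in `K`
        -- are still uncoloured.
        split (inj₂ (i , g , none)) =
          colourOrder L inj X.order d≤4 Q.c Q.c-list Q.c-proper (~-sym vw) v∉X (λ t e → ⊥-elim (none t (trans e Q.c-v)))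
          where
          D = gadget L inj ws (here refl) ws⊆K (there (there w∈X)) vw (L p) (λ _ _ → inj p _ _)
          module Q = PartialColouring (partial (L p) (λ j _ → j , refl) D i g)
        split (inj₁ common) =
          colourOrder L inj X.order d≤4 Q.c Q.c-list Q.c-proper wp p∉X redundant
          where
          -- Every good colour of `v` now occurs in the list of `w`; from its position there the
          -- matching leads to the colour of `p`.
          mt = matching (L w) (L p) (inj w) (inj p)
          h = proj₁ mt
          index : Fin 4 → Fin 4
          index i with good? L i
          ... | yes g = proj₁ (common i g)
          -- Arbitrary: `gadget` consults `P` at good indices only.
          ... | no _  = zero
          index-w : ∀ {i} → Good L i → L w (index i) ≡ L v i
          index-w {i} g with good? L i
          ... | yes g′ = proj₂ (common i g′)
          ... | no ¬g  = ⊥-elim (¬g g)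
          P : Fin 4 → ℕ
          P i = L p (h (index i))
          P-inj : ∀ {i j} → Good L i → Good L j → P i ≡ P j → i ≡ j
          P-inj {i} {j} g g′ e = inj v i j (trans (sym (index-w g))
            (trans (cong (L w) (proj₁ (proj₂ mt) _ _ (inj p _ _ e))) (index-w g′)))
          D = gadget L inj ws (here refl) ws⊆K (there (there w∈X)) vw P P-inj
          module D′ = Gadget D
          module Q = PartialColouring (partial P (λ j _ → h (index j) , refl) D D′.i D′.good)
          c-p : Q.c p ≡ P D′.i
          c-p = trans (Q.c-K Kp) (update-same D′.d p (P D′.i))
          redundant : ∀ t → L w t ≡ Q.c p → ∃[ u ] (w ~ u × u ≢ p × u ∉ X.vertices × Q.c u ≡ Q.c p)
          redundant t e with proj₂ (proj₂ mt) (index D′.i)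
          ... | inj₂ none = ⊥-elim (none t (trans e c-p))
          ... | inj₁ m    = v , ~-sym vw , (p≢v ∘ sym) , v∉X
                          , trans Q.c-v (trans (sym (index-w D′.good)) (trans (sym m) (sym c-p)))

-- Attachments of the component, and K₅ minors

module Attachments {n : ℕ} (M : PlaneMap 4 n)
  (choose : ∀ m → m < n → (H : Graph m) → Planar H → Choosable H 4) (¬choosable : ¬ Choosable (graph M) 4) where

  open Minimal M choose ¬choosable
  open Adjacency G
  open Tools G

  saturated : ∀ {x} (es : List (Fin n)) → length es ≤ deg G x → (∀ {z} → x ~ z → z ∈ es) → ∀ {e} → e ∈ es → x ~ e
  saturated {x} es len sub {e} e∈ with x ~? e
  ... | yes p = p
  ... | no ¬p = ⊥-elim (ℕₚ.<⇒≱ (s≤s len) (length-⊆ {xs = e ∷ nbrs x} {ys = es}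
      (All.tabulate (λ z∈ → λ { refl → ¬p (∈-nbrs⁻ z∈) }) ∷ nbrs-unique x)
      λ { (here refl) → e∈ ; (there z∈) → sub (∈-nbrs⁻ z∈) }))

  -- The class map for contracting `p` into `x` and `q` into `y`.
  send₂ : Fin n → Fin n → Fin n → Fin n → Fin n → Fin n
  send₂ p x q y u with u ≟ p | u ≟ q
  ... | yes _ | _     = x
  ... | no _  | yes _ = y
  ... | no _  | no _  = u

  send₂-first : ∀ p x q y → send₂ p x q y p ≡ x
  send₂-first p x q y with p ≟ p | p ≟ q
  ... | yes _ | _ = refl
  ... | no ne | _ = ⊥-elim (ne refl)

  send₂-second : ∀ {p q} x y → p ≢ q → send₂ p x q y q ≡ y
  send₂-second {p} {q} x y p≢q with q ≟ p | q ≟ q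
  ... | yes e | _     = ⊥-elim (p≢q (sym e))
  ... | no _  | yes _ = refl
  ... | no _  | no ne = ⊥-elim (ne refl)

  send₂-other : ∀ {p q u} x y → u ≢ p → u ≢ q → send₂ p x q y u ≡ u
  send₂-other {p} {q} {u} x y np nq with u ≟ p | u ≟ q
  ... | yes e | _     = ⊥-elim (np e)
  ... | no _  | yes e = ⊥-elim (nq e)
  ... | no _  | no _  = refl

  -- Contract every component of the graph induced outside xs.
  module Block (xs : List (Fin n)) {b : Fin n} (b∉ : b ∉ xs) where

    κ : Fin n → Fin n
    κ x with x ∈ᵛ? xs
    ... | yes _ = x
    ... | no  _ = b

    κ-in : ∀ {x} → x ∈ xs → κ x ≡ x
    κ-in {x} x∈ with x ∈ᵛ? xs
    ... | yes _ = refl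
    ... | no x∉ = ⊥-elim (x∉ x∈)

    κ-out : ∀ {x} → x ∉ xs → κ x ≡ b
    κ-out {x} x∉ with x ∈ᵛ? xs
    ... | yes x∈ = ⊥-elim (x∉ x∈)
    ... | no _   = refl

    κ-apart : ∀ {x z} → x ∈ xs → x ≢ z → κ x ≢ κ z
    κ-apart {x} {z} x∈ ne e with z ∈ᵛ? xs
    ... | yes z∈ = ne (trans (sym (κ-in x∈)) e)
    ... | no _   = b∉ (subst (_∈ xs) (trans (sym (κ-in x∈)) e) x∈)

    module _ (C : ClassColouring G κ fourColours) where

      apart : ∀ {x z} → x ∈ xs → x ~ z → colour C x ≢ colour C z
      apart x∈ xz = distinct C xz (κ-apart x∈ (~⇒≢ xz))

      joined : ∀ {x z} → x ∉ xs → z ∉ xs → x ~ z → colour C x ≡ colour C z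
      joined x∉ z∉ xz = constant C xz (trans (κ-out x∉) (sym (κ-out z∉)))

  module _ {v a : Fin n} (va : v ~ a) where
    open Lobe va

    S₀ : Fin n → Set
    S₀ x = x ≢ v × deg G x ≤ 4

    S₀? : ∀ x → Dec (S₀ x)
    S₀? x = ¬? (x ≟ v) ×-dec (deg G x ℕₚ.≤? 4)

    S : Fin n → Fin n → Set
    S b x = S₀ x × x ≢ b

    S? : ∀ b x → Dec (S b x)
    S? b x = S₀? x ×-dec ¬? (x ≟ b)

    module Attached (deg-v : deg G v ≡ 6) (T : List (Fin n)) (T-unique : Unique T) (T-nbr : ∀ {t} → t ∈ T → v ~ t)
      (T-K : ∀ {t} → t ∈ T → K t) (T-all : ∀ {z} → v ~ z → K z → z ∈ T)
      (T-conn : ∀ {s t} → s ∈ T → t ∈ T → Walk G S₀ s t) where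

      T-S₀ : ∀ {t} → t ∈ T → S₀ t
      T-S₀ t∈ = walk-start (T-conn t∈ t∈)

      |T|≤6 : length T ≤ 6
      |T|≤6 = subst (length T ≤_) deg-v (length-⊆ T-unique (∈-nbrs⁺ ∘ T-nbr))

      T-deg : ∀ {t} → t ∈ T → 4 ≤ deg G t
      T-deg t∈ = min-degree (~-sym (T-nbr t∈))

      nbr-S₀ : ∀ {w p} → w ∈ T → w ~ p → p ≢ v → S₀ p
      nbr-S₀ {w} {p} w∈ wp p≢v with S₀? p
      ... | yes s = s
      ... | no ¬s = ⊥-elim (no-surplus S₀? (λ s → s) (T-nbr w∈) (T-K w∈) (λ vz k → T-conn w∈ (T-all vz k)) wp p≢v ¬s)

      -- Otherwise `no-surplus` applies to `S b`, a set that misses the neighbour `b` of `w` by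
      -- definition.
      separating : ∀ {w b} → w ∈ T → w ~ b → b ≢ v → ∃[ t ] (t ∈ T × ¬ Walk G (S b) w t)
      separating {w} {b} w∈ wb b≢v with Any.any? (λ t → ¬? (walk? (S? b) w t)) T
      ... | yes p = find p
      ... | no ¬p = ⊥-elim (no-surplus (S? b) proj₁ (T-nbr w∈) (T-K w∈) (λ vz k → all (T-all vz k)) wb b≢v (λ s → proj₂ s refl))
        where
        all : ∀ {t} → t ∈ T → Walk G (S b) w t
        all {t} t∈ with walk? (S? b) w t
        ... | yes q = q
        ... | no ¬q = ⊥-elim (¬p (lose t∈ ¬q))

      avoid : ∀ {b b₁ x z} → ¬ Walk G (S b₁) x b → Walk G (S b₁) x z → Walk G (S b) x z
      avoid {b} {x = x} no-b p@(end s) = end (proj₁ s , λ { refl → no-b p })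
      avoid {b} {x = x} no-b (via s e p) = via (proj₁ s , λ { refl → no-b (end s) }) e (avoid (no-b ∘ via s e) p)

      -- A component of S₀ − b′, for some b′, that lies in T and in the component of t in S₀ − b.
      Island : Fin n → Fin n → Set
      Island b t = ∃[ b′ ] ∃[ t′ ] (b′ ∉ T × S₀ b′ × t′ ∈ T × (∀ {z} → Walk G (S b′) t′ z → z ∈ T × Walk G (S b) t z))

      C : ∀ b t → b ∉ T → t ∈ T → Component (S? b) t
      C b t b∉ t∈ = component (S? b) t (T-S₀ t∈ , λ { refl → b∉ t∈ })

      -- Descent on the component of `t`. If it leaves `T` at an edge `z b₁`, then deleting `b₁`
      -- instead of `b` cuts off a component that contains a member of `T` but not `b`; it lies
      -- inside the old one and is smaller, as it lacks `b₁`.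
      island : ∀ fuel b t (b∉ : b ∉ T) → S₀ b → (t∈ : t ∈ T) → length (Component.vertices (C b t b∉ t∈)) ≤ fuel → Island b t
      island zero b t b∉ Sb t∈ len with Component.vertices (C b t b∉ t∈) | order-root (Component.order (C b t b∉ t∈))
      island zero b t b∉ Sb t∈ () | _ ∷ _ | _
      island (suc fuel) b t b∉ Sb t∈ len = search (Any.any? (λ z → (z ∈ᵛ? T) ×-dec Any.any? (λ b₁ → ¬? (b₁ ∈ᵛ? T) ×-dec (z ~? b₁)) C.vertices) C.vertices)
        where
        module C = Component (C b t b∉ t∈)
        Leak : Fin n → Set
        Leak z = z ∈ T × Any (λ b₁ → b₁ ∉ T × z ~ b₁) C.vertices
        search : Dec (Any Leak C.vertices) → Island b t
        search (no ¬leak) = b , t , b∉ , Sb , t∈ , λ p → along t∈ (order-root C.order) p , p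
          where
          along : ∀ {x z} → x ∈ T → x ∈ C.vertices → Walk G (S b) x z → z ∈ T
          along x∈T x∈ (end _) = x∈T
          along {x} x∈T x∈ (via {y = y} _ e p) with y ∈ᵛ? T
          ... | yes y∈T = along y∈T y∈ p
            where y∈ = C.closed x∈ e (walk-start p)
          ... | no y∉T = ⊥-elim (¬leak (lose x∈ (x∈T , lose (C.closed x∈ e (walk-start p)) (y∉T , e))))
        search (yes leak) = narrow (separating z∈T zb₁ (proj₁ Sb₁))
          where
          z     = proj₁ (find leak)
          z∈    = proj₁ (proj₂ (find leak))
          z∈T   = proj₁ (proj₂ (proj₂ (find leak)))
          inner = find (proj₂ (proj₂ (proj₂ (find leak))))
          b₁    = proj₁ inner
          b₁∈   = proj₁ (proj₂ inner)
          b₁∉T  = proj₁ (proj₂ (proj₂ inner))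
          zb₁   = proj₂ (proj₂ (proj₂ inner))
          Sb₁ : S₀ b₁
          Sb₁ = proj₁ (C.inside b₁∈)
          b≢b₁ : b ≢ b₁
          b≢b₁ e = proj₂ (C.inside b₁∈) (sym e)
          recurse : ∀ {t₂} → t₂ ∈ T → Walk G (S b) t t₂ → ¬ Walk G (S b₁) t₂ b → Island b t
          recurse {t₂} t₂∈ tt₂ no-b with island fuel b₁ t₂ b₁∉T Sb₁ t₂∈ (ℕₚ.≤-pred (ℕₚ.≤-trans smaller len))
            where
            module C₂ = Component (C b₁ t₂ b₁∉T t₂∈)
            smaller : suc (length C₂.vertices) ≤ length C.vertices
            smaller = length-⊆ {xs = b₁ ∷ C₂.vertices} {ys = C.vertices}
              (All.tabulate (λ y∈ → λ { refl → proj₂ (C₂.inside y∈) refl }) ∷ order-unique C₂.order)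
              λ { (here refl) → b₁∈ ; (there y∈) → C.reach (walk-trans tt₂ (avoid no-b (C₂.walk y∈))) }
          ... | b′ , t′ , b′∉ , Sb′ , t′∈ , sub =
                b′ , t′ , b′∉ , Sb′ , t′∈ , λ p → proj₁ (sub p) , walk-trans tt₂ (avoid no-b (proj₂ (sub p)))
          -- As `b₁` separates `z` from `t₁`, at least one of the two is cut off from `b`.
          narrow : ∃[ t₁ ] (t₁ ∈ T × ¬ Walk G (S b₁) z t₁) → Island b t
          narrow (t₁ , t₁∈ , apart₁) with walk? (S? b₁) z b
          ... | no ¬zb = recurse z∈T (C.walk z∈) ¬zb
          ... | yes zb = recurse t₁∈ tt₁ (λ p → apart₁ (walk-trans zb (walk-sym p)))
            where
            outside : ∀ {x u} → ¬ Walk G (S b) t x → Walk G (S b) x u → Walk G (S b₁) x u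
            outside ¬tx (end s) = end (proj₁ s , λ { refl → ¬tx (C.walk b₁∈) })
            outside ¬tx (via s e p) = via (proj₁ s , λ { refl → ¬tx (C.walk b₁∈) }) e
              (outside (λ q → ¬tx (walk-snoc q (~-sym e) s)) p)
            tt₁ : Walk G (S b) t t₁
            tt₁ with walk? (S? b) t t₁
            ... | yes q = q
            ... | no ¬q with first-visit b (λ { refl → b∉ t₁∈ }) (T-conn t₁∈ t∈)
            ...   | inj₁ q = walk-sym q
            -- `b₁` belongs to the component of `t`. If `t₁` did not, its walk to `b` would avoid
            -- `b₁` and continue to `z`, contrary to the choice of `t₁`.
            ...   | inj₂ (u , q , ub) = ⊥-elim (apart₁ (walk-trans zb (walk-sym
                      (walk-snoc (outside ¬q q) ub (Sb , b≢b₁)))))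

      -- If T has a neighbour b outside T, the graph S₀ − b has two islands, which are triangles in T
      -- completed to K₄ by their attachment vertices; together with v this gives a K₅ minor.
      no-attachment : ∀ {w b} → w ∈ T → b ∉ T → b ≢ v → ¬ w ~ b
      no-attachment {w} {b} w∈ b∉ b≢v wb = two (separating w∈ wb b≢v)
        where
        Sb = nbr-S₀ w∈ wb b≢v
        two : ∃[ t ] (t ∈ T × ¬ Walk G (S b) w t) → ⊥
        two (t , t∈ , w≁t) = minor (island _ b w b∉ Sb w∈ ℕₚ.≤-refl) (island _ b t b∉ Sb t∈ ℕₚ.≤-refl)
          where
          minor : Island b w → Island b t → ⊥
          minor (b₁ , t₁ , b₁∉ , Sb₁ , t₁∈ , sub₁) (b₂ , t₂ , b₂∉ , Sb₂ , t₂∈ , sub₂) = finish C₁.vertices refl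
            where
            module C₁ = Component (C b₁ t₁ b₁∉ t₁∈)
            module C₂ = Component (C b₂ t₂ b₂∉ t₂∈)
            disjoint : ∀ {z} → ¬ (z ∈ C₁.vertices × z ∈ C₂.vertices)
            disjoint (z∈₁ , z∈₂) = w≁t (walk-trans (proj₂ (sub₁ (C₁.walk z∈₁))) (walk-sym (proj₂ (sub₂ (C₂.walk z∈₂)))))
            few : length C₁.vertices + length C₂.vertices ≤ 6
            few = subst (_≤ 6) (length-++ C₁.vertices) (ℕₚ.≤-trans (length-⊆ {ys = T} (++⁺ (order-unique C₁.order) (order-unique C₂.order) disjoint)
              λ z∈ → [ (λ m → proj₁ (sub₁ (C₁.walk m))) , (λ m → proj₁ (sub₂ (C₂.walk m))) ]′ (∈-++⁻ C₁.vertices z∈)) |T|≤6)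
            nbr₁ : ∀ {x z} → x ∈ C₁.vertices → x ~ z → z ≡ v ⊎ z ≡ b₁ ⊎ z ∈ C₁.vertices
            nbr₁ {x} {z} x∈ xz with z ≟ v | z ≟ b₁
            ... | yes e | _     = inj₁ e
            ... | no _  | yes e = inj₂ (inj₁ e)
            ... | no nv | no nb = inj₂ (inj₂ (C₁.closed x∈ xz (nbr-S₀ (proj₁ (sub₁ (C₁.walk x∈))) xz nv , nb)))
            -- `t₂` has at least four neighbours, of which only `v` and `b₂` may lie outside the
            -- island; `t₂` itself is the third vertex.
            large₂ : 3 ≤ length C₂.vertices
            large₂ = ℕₚ.≤-pred (ℕₚ.≤-pred (ℕₚ.≤-trans (s≤s (T-deg t₂∈)) (length-⊆ {xs = t₂ ∷ nbrs t₂} {ys = v ∷ b₂ ∷ C₂.vertices}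
              (All.tabulate (λ z∈ → λ { refl → ~⇒≢ (∈-nbrs⁻ z∈) refl }) ∷ nbrs-unique t₂) sub)))
              where
              sub : ∀ {z} → z ∈ t₂ ∷ nbrs t₂ → z ∈ v ∷ b₂ ∷ C₂.vertices
              sub (here refl) = there (there (order-root C₂.order))
              sub {z} (there z∈) with z ≟ v | z ≟ b₂
              ... | yes e | _     = here e
              ... | no _  | yes e = there (here e)
              ... | no nv | no nb = there (there (C₂.closed (order-root C₂.order) (∈-nbrs⁻ z∈) (nbr-S₀ t₂∈ (∈-nbrs⁻ z∈) nv , nb)))
            large₁ : 3 ≤ length C₁.vertices
            large₁ = ℕₚ.≤-pred (ℕₚ.≤-pred (ℕₚ.≤-trans (s≤s (T-deg t₁∈)) (length-⊆ {xs = t₁ ∷ nbrs t₁} {ys = v ∷ b₁ ∷ C₁.vertices}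
              (All.tabulate (λ z∈ → λ { refl → ~⇒≢ (∈-nbrs⁻ z∈) refl }) ∷ nbrs-unique t₁) sub)))
              where
              sub : ∀ {z} → z ∈ t₁ ∷ nbrs t₁ → z ∈ v ∷ b₁ ∷ C₁.vertices
              sub (here refl) = there (there (order-root C₁.order))
              sub {z} (there z∈) with nbr₁ (order-root C₁.order) (∈-nbrs⁻ z∈)
              ... | inj₁ e        = here e
              ... | inj₂ (inj₁ e) = there (here e)
              ... | inj₂ (inj₂ m) = there (there m)
            small₁ : length C₁.vertices ≤ 3
            small₁ = ℕₚ.+-cancelʳ-≤ 3 _ 3 (ℕₚ.≤-trans (ℕₚ.+-monoʳ-≤ (length C₁.vertices) large₂) few)
            finish : ∀ us → C₁.vertices ≡ us → ⊥
            finish [] e with () ← subst (λ us → 3 ≤ length us) e large₁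
            finish (_ ∷ []) e with s≤s () ← subst (λ us → 3 ≤ length us) e large₁
            finish (_ ∷ _ ∷ []) e with s≤s (s≤s ()) ← subst (λ us → 3 ≤ length us) e large₁
            finish (_ ∷ _ ∷ _ ∷ _ ∷ _) e with s≤s (s≤s (s≤s ())) ← subst (λ us → length us ≤ 3) e small₁
            finish (x₁ ∷ x₂ ∷ x₃ ∷ []) e = noK₅ B.κ inner-edge inner-κ (v ∷ x₁ ∷ x₂ ∷ x₃ ∷ b₁ ∷ []) ℕₚ.≤-refl unique
              where
              ∈₁ : ∀ {x} → x ∈ x₁ ∷ x₂ ∷ x₃ ∷ [] → x ∈ C₁.vertices
              ∈₁ = subst (_ ∈_) (sym e)
              ∈₁⁻ : ∀ {x} → x ∈ C₁.vertices → x ∈ x₁ ∷ x₂ ∷ x₃ ∷ []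
              ∈₁⁻ = subst (_ ∈_) e
              i₁ = ∈₁ (here refl)
              i₂ = ∈₁ (there (here refl))
              i₃ = ∈₁ (there (there (here refl)))
              in-T : ∀ {x} → x ∈ C₁.vertices → x ∈ T
              in-T x∈ = proj₁ (sub₁ (C₁.walk x∈))
              full : ∀ {x y z} → x ∈ C₁.vertices → (∀ {u} → u ∈ x₁ ∷ x₂ ∷ x₃ ∷ [] → u ≡ x ⊎ u ∈ y ∷ z ∷ []) →
                     ∀ {u} → u ∈ v ∷ b₁ ∷ y ∷ z ∷ [] → x ~ u
              full {x} {y} {z} x∈ cover = saturated (v ∷ b₁ ∷ y ∷ z ∷ []) (T-deg (in-T x∈)) λ xu → place xu (nbr₁ x∈ xu)
                where
                place : ∀ {u} → x ~ u → u ≡ v ⊎ u ≡ b₁ ⊎ u ∈ C₁.vertices → u ∈ v ∷ b₁ ∷ y ∷ z ∷ []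
                place xu (inj₁ refl) = here refl
                place xu (inj₂ (inj₁ refl)) = there (here refl)
                place xu (inj₂ (inj₂ m)) with cover (∈₁⁻ m)
                ... | inj₁ refl = ⊥-elim (~⇒≢ xu refl)
                ... | inj₂ m′   = there (there m′)
              full₁ : ∀ {u} → u ∈ v ∷ b₁ ∷ x₂ ∷ x₃ ∷ [] → x₁ ~ u
              full₁ = full i₁ λ { (here q) → inj₁ q ; (there m) → inj₂ m }
              full₂ : ∀ {u} → u ∈ v ∷ b₁ ∷ x₁ ∷ x₃ ∷ [] → x₂ ~ u
              full₂ = full i₂ λ { (here q) → inj₂ (here q) ; (there (here q)) → inj₁ q ; (there (there m)) → inj₂ (there m) }
              full₃ : ∀ {u} → u ∈ v ∷ b₁ ∷ x₁ ∷ x₂ ∷ [] → x₃ ~ u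
              full₃ = full i₃ λ { (here q) → inj₂ (here q) ; (there (here q)) → inj₂ (there (here q)) ; (there (there (here q))) → inj₁ q }
              xs = v ∷ x₁ ∷ x₂ ∷ x₃ ∷ []
              not-xs : ∀ {u} → u ≢ v → u ∉ C₁.vertices → u ∉ xs
              not-xs nv u∉ (here q)  = nv q
              not-xs nv u∉ (there m) = u∉ (∈₁ m)
              b₁∉xs : b₁ ∉ xs
              b₁∉xs = not-xs (proj₁ Sb₁) (λ m → proj₂ (C₁.inside m) refl)
              module B = Block xs b₁∉xs
              t₂∉₁ : t₂ ∉ C₁.vertices
              t₂∉₁ m = disjoint (m , order-root C₂.order)
              -- The second island supplies the remaining adjacency: it reaches `b₁` without
              -- entering the first one and contains a neighbour of `v`, so the block contracted
              -- around `b₁` is joined to `v`.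
              exit : ∃[ u ] (Walk G (S b₁) t₂ u × u ~ b₁)
              exit with first-visit b₁ (λ { refl → b₁∉ t₂∈ }) (T-conn t₂∈ t₁∈)
              ... | inj₁ q = ⊥-elim (t₂∉₁ (C₁.reach (walk-sym q)))
              ... | inj₂ r = r
              stays : ∀ {x u} → x ∉ C₁.vertices → Walk G (S b₁) x u → Walk G (_∉ xs) x u
              stays x∉ (end s) = end (not-xs (proj₁ (proj₁ s)) x∉)
              stays x∉ (via s xy p) = via (not-xs (proj₁ (proj₁ s)) x∉) xy (stays (λ m → x∉ (C₁.closed m (~-sym xy) s)) p)
              route = stays t₂∉₁ (proj₁ (proj₂ exit))
              inner-edge = proj₂ (proj₂ exit)
              inner-κ = trans (B.κ-out (walk-finish route)) (sym (B.κ-out b₁∉xs))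
              unique : (Q : ClassColouring G B.κ fourColours) → Unique (map (colour Q) (v ∷ x₁ ∷ x₂ ∷ x₃ ∷ b₁ ∷ []))
              unique Q = (ap (here refl) (T-nbr (in-T i₁)) ∷ ap (here refl) (T-nbr (in-T i₂)) ∷ ap (here refl) (T-nbr (in-T i₃)) ∷ v≢b ∷ [])
                ∷ (ap (there (here refl)) (full₁ (there (there (here refl)))) ∷ ap (there (here refl)) (full₁ (there (there (there (here refl)))))
                    ∷ ap (there (here refl)) (full₁ (there (here refl))) ∷ [])
                ∷ (ap (there (there (here refl))) (full₂ (there (there (there (here refl))))) ∷ ap (there (there (here refl))) (full₂ (there (here refl))) ∷ [])
                ∷ (ap (there (there (there (here refl)))) (full₃ (there (here refl))) ∷ []) ∷ [] ∷ []
                where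
                ap : ∀ {x z} → x ∈ xs → x ~ z → colour Q x ≢ colour Q z
                ap = B.apart Q
                along : ∀ {x u} → Walk G (_∉ xs) x u → colour Q x ≡ colour Q u
                along (end _) = refl
                along (via x∉ xy p) = trans (B.joined Q x∉ (walk-start p) xy) (along p)
                v≢b : colour Q v ≢ colour Q b₁
                v≢b eq = ap (here refl) (T-nbr t₂∈) (trans eq (sym (trans (along route) (B.joined Q (walk-finish route) b₁∉xs inner-edge))))

      T-closed : ∀ {t z} → t ∈ T → t ~ z → z ≢ v → z ∈ T
      T-closed {t} {z} t∈ tz z≢v with z ∈ᵛ? T
      ... | yes m = m
      ... | no z∉ = ⊥-elim (no-attachment t∈ z∉ z≢v tz)

      -- `T` and `v` are at most seven vertices and include all neighbours of `s`, at least four. So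
      -- besides itself `s` misses at most two of them.
      miss : ∀ {s t x y} → Unique (s ∷ t ∷ x ∷ y ∷ []) → s ∈ T → t ∈ T → x ∈ T → y ∈ T → ¬ s ~ t → ¬ s ~ x → s ~ y
      miss {s} {t} {x} {y} uniq s∈ t∈ x∈ y∈ s≁t s≁x with s ~? y
      ... | yes p = p
      ... | no s≁y = ⊥-elim (ℕₚ.<⇒≱ {7} {8} ℕₚ.≤-refl (begin
          8                                            ≤⟨ ℕₚ.+-monoˡ-≤ 4 (T-deg s∈) ⟩
          length (nbrs s) + 4                          ≡⟨ length-++ (nbrs s) ⟨
          length (nbrs s ++ s ∷ t ∷ x ∷ y ∷ [])        ≤⟨ length-⊆ {ys = v ∷ T} (++⁺ (nbrs-unique s) uniq disjoint) sub ⟩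
          suc (length T)                               ≤⟨ s≤s |T|≤6 ⟩
          7                                            ∎))
        where
        open ℕₚ.≤-Reasoning
        disjoint : ∀ {z} → ¬ (z ∈ nbrs s × z ∈ s ∷ t ∷ x ∷ y ∷ [])
        disjoint (m , here refl)                         = ~⇒≢ (∈-nbrs⁻ m) refl
        disjoint (m , there (here refl))                 = s≁t (∈-nbrs⁻ m)
        disjoint (m , there (there (here refl)))         = s≁x (∈-nbrs⁻ m)
        disjoint (m , there (there (there (here refl)))) = s≁y (∈-nbrs⁻ m)
        sub : ∀ {z} → z ∈ nbrs s ++ s ∷ t ∷ x ∷ y ∷ [] → z ∈ v ∷ T
        sub {z} z∈ with ∈-++⁻ (nbrs s) z∈
        ... | inj₂ (here refl)                         = there s∈
        ... | inj₂ (there (here refl))                 = there t∈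
        ... | inj₂ (there (there (here refl)))         = there x∈
        ... | inj₂ (there (there (there (here refl)))) = there y∈
        ... | inj₁ m with z ≟ v
        ...   | yes e = here e
        ...   | no ne = there (T-closed s∈ (∈-nbrs⁻ m) ne)

      five : ∀ {s} (us : List (Fin n)) → s ∈ T → Unique us → (∀ {u} → u ∈ us → s ~ u) → length us ≤ 4
      five us s∈ uniq sub = ℕₚ.≤-trans (few-nbrs us uniq sub) (proj₂ (T-S₀ s∈))

      T∌v : v ∉ T
      T∌v m = ~⇒≢ (T-nbr m) refl

      -- Each corner of the triangle has a further neighbour in `T`, and the members of `T` off the
      -- triangle are pairwise adjacent. Contracting these gives the fifth vertex of a K₅ on `v`,
      -- `x`, `y`, `z`.
      no-triangle : ∀ {x y z} → x ∈ T → y ∈ T → z ∈ T → x ~ y → x ~ z → ¬ y ~ z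
      no-triangle {x} {y} {z} x∈ y∈ z∈ xy xz yz = minor inner
        where
        xs = v ∷ x ∷ y ∷ z ∷ []
        third : ∀ {s p q} → s ∈ T → ∃[ u ] (s ~ u × u ∉ v ∷ p ∷ q ∷ [])
        third s∈ = fresh _ (T-deg s∈)
        outer : ∀ {s p q u} → s ∈ T → s ~ u → u ∉ v ∷ p ∷ q ∷ [] → u ∈ T
        outer s∈ su u∉ = T-closed s∈ su (λ { refl → u∉ (here refl) })
        x′ = proj₁ (third {x} {y} {z} x∈)
        xx′ = proj₁ (proj₂ (third {x} {y} {z} x∈))
        x′∉ = proj₂ (proj₂ (third {x} {y} {z} x∈))
        y′ = proj₁ (third {y} {x} {z} y∈)
        yy′ = proj₁ (proj₂ (third {y} {x} {z} y∈))
        y′∉ = proj₂ (proj₂ (third {y} {x} {z} y∈))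
        z′ = proj₁ (third {z} {x} {y} z∈)
        zz′ = proj₁ (proj₂ (third {z} {x} {y} z∈))
        z′∉ = proj₂ (proj₂ (third {z} {x} {y} z∈))
        x′∉xs : x′ ∉ xs
        x′∉xs (here e) = x′∉ (here e)
        x′∉xs (there (here e)) = ~⇒≢ xx′ (sym e)
        x′∉xs (there (there m)) = x′∉ (there m)
        y′∉xs : y′ ∉ xs
        y′∉xs (here e) = y′∉ (here e)
        y′∉xs (there (here e)) = y′∉ (there (here e))
        y′∉xs (there (there (here e))) = ~⇒≢ yy′ (sym e)
        y′∉xs (there (there (there m))) = y′∉ (there (there m))
        z′∉xs : z′ ∉ xs
        z′∉xs (here e) = z′∉ (here e)
        z′∉xs (there (here e)) = z′∉ (there (here e))
        z′∉xs (there (there (here e))) = z′∉ (there (there (here e)))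
        z′∉xs (there (there (there (here e)))) = ~⇒≢ zz′ (sym e)
        x′∈ = outer x∈ xx′ x′∉
        y′∈ = outer y∈ yy′ y′∉
        z′∈ = outer z∈ zz′ z′∉

        ne : ∀ {s p} → s ∉ xs → p ∈ xs → s ≢ p
        ne s∉ p∈ refl = s∉ p∈

        crowded : ∀ {p q r s t} → p ∈ T → q ∈ T → r ∈ T → s ∈ T → t ∈ T → q ≢ r → q ≢ s → q ≢ t → r ≢ s → r ≢ t → s ≢ t →
                  p ~ q → p ~ r → p ~ s → ¬ p ~ t
        crowded {p} {q} {r} {s} {t} p∈ q∈ r∈ s∈ t∈ q≢r q≢s q≢t r≢s r≢t s≢t pq pr ps pt =
          ℕₚ.<⇒≱ {4} {5} ℕₚ.≤-refl (five (v ∷ q ∷ r ∷ s ∷ t ∷ []) p∈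
            ((off q∈ ∷ off r∈ ∷ off s∈ ∷ off t∈ ∷ []) ∷ (q≢r ∷ q≢s ∷ q≢t ∷ []) ∷ (r≢s ∷ r≢t ∷ []) ∷ (s≢t ∷ []) ∷ [] ∷ [])
            λ { (here refl) → ~-sym (T-nbr p∈) ; (there (here refl)) → pq ; (there (there (here refl))) → pr
              ; (there (there (there (here refl)))) → ps ; (there (there (there (there (here refl))))) → pt })
          where
          off : ∀ {u} → u ∈ T → v ≢ u
          off u∈ refl = T∌v u∈

        ix : x ∈ xs
        ix = there (here refl)
        iy : y ∈ xs
        iy = there (there (here refl))
        iz : z ∈ xs
        iz = there (there (there (here refl)))

        -- If s and t were nonadjacent, both would be joined to two of x, y, z, one of which would get degree 5.
        adjacent : ∀ {s t} → s ∈ T → t ∈ T → s ∉ xs → t ∉ xs → s ≢ t → s ~ t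
        adjacent {s} {t} s∈ t∈ s∉ t∉ s≢t with s ~? t
        ... | yes p = p
        ... | no s≁t = ⊥-elim (cases (s ~? x) (s ~? y))
          where
          x≢y = ~⇒≢ xy
          x≢z = ~⇒≢ xz
          y≢z = ~⇒≢ yz
          t≁s : ¬ t ~ s
          t≁s e = s≁t (~-sym e)
          miss-s : ∀ {p q} → p ∈ T → q ∈ T → p ∈ xs → q ∈ xs → p ≢ q → ¬ s ~ p → s ~ q
          miss-s p∈ q∈ ip iq p≢q = miss ((s≢t ∷ ne s∉ ip ∷ ne s∉ iq ∷ []) ∷ (ne t∉ ip ∷ ne t∉ iq ∷ []) ∷ (p≢q ∷ []) ∷ [] ∷ []) s∈ t∈ p∈ q∈ s≁t
          miss-t : ∀ {p q} → p ∈ T → q ∈ T → p ∈ xs → q ∈ xs → p ≢ q → ¬ t ~ p → t ~ q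
          miss-t p∈ q∈ ip iq p≢q = miss (((s≢t ∘ sym) ∷ ne t∉ ip ∷ ne t∉ iq ∷ []) ∷ (ne s∉ ip ∷ ne s∉ iq ∷ []) ∷ (p≢q ∷ []) ∷ [] ∷ []) t∈ s∈ p∈ q∈ t≁s
          block : ∀ {p q r} → p ∈ T → q ∈ T → r ∈ T → q ∈ xs → r ∈ xs → q ≢ r → p ~ q → p ~ r → s ~ p → ¬ t ~ p
          block p∈ q∈ r∈ iq ir q≢r pq pr sp tp = crowded p∈ q∈ r∈ s∈ t∈ q≢r (ne s∉ iq ∘ sym) (ne t∉ iq ∘ sym)
            (ne s∉ ir ∘ sym) (ne t∉ ir ∘ sym) s≢t pq pr (~-sym sp) (~-sym tp)
          block-x = block x∈ y∈ z∈ iy iz y≢z xy xz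
          block-y = block y∈ x∈ z∈ ix iz x≢z (~-sym xy) yz
          block-z = block z∈ x∈ y∈ ix iy x≢y (~-sym xz) (~-sym yz)
          cases : Dec (s ~ x) → Dec (s ~ y) → ⊥
          cases (yes sx) (yes sy) = block-y sy (miss-t x∈ y∈ ix iy x≢y (block-x sx))
          cases (yes sx) (no s≁y) = block-z (miss-s y∈ z∈ iy iz y≢z s≁y) (miss-t x∈ z∈ ix iz x≢z (block-x sx))
          cases (no s≁x) _        = block-z (miss-s x∈ z∈ ix iz x≢z s≁x)
                                      (miss-t y∈ z∈ iy iz y≢z (block-y (miss-s x∈ y∈ ix iy x≢y s≁x)))

        inner : ∃[ p ] ∃[ q ] (p ~ q × p ∉ xs × q ∉ xs)
        inner with x′ ≟ y′ | x′ ≟ z′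
        ... | no x′≢y′ | _        = x′ , y′ , adjacent x′∈ y′∈ x′∉xs y′∉xs x′≢y′ , x′∉xs , y′∉xs
        ... | yes _    | no x′≢z′ = x′ , z′ , adjacent x′∈ z′∈ x′∉xs z′∉xs x′≢z′ , x′∉xs , z′∉xs
        -- Here `v`, `x`, `y`, `z`, `x′` already form a K₅, but minimality still needs an edge to
        -- contract. The degree of `v` provides a fifth neighbour `r`, and the corners of the
        -- triangle have no room left for it.
        ... | yes x′≡y′ | yes x′≡z′ with fresh {v} (x ∷ y ∷ z ∷ x′ ∷ []) (subst (4 <_) (sym deg-v) (s≤s (s≤s (s≤s (s≤s (s≤s z≤n))))))
        ...   | r , vr , r∉ with fresh {r} (v ∷ []) (ℕₚ.≤-trans (s≤s (s≤s z≤n)) (min-degree (~-sym vr)))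
        ...     | u , ru , u∉ = r , u , ru , r∉xs , u∉xs
          where
          r∉xs : r ∉ xs
          r∉xs (here e) = ~⇒≢ vr (sym e)
          r∉xs (there (here e)) = r∉ (here e)
          r∉xs (there (there (here e))) = r∉ (there (here e))
          r∉xs (there (there (there (here e)))) = r∉ (there (there (here e)))
          r≢x′ : r ≢ x′
          r≢x′ e = r∉ (there (there (there (here e))))
          busy : ∀ {p q t} → p ∈ T → q ∈ T → t ∈ T → q ∈ xs → t ∈ xs → q ≢ t → p ~ q → p ~ t → p ~ x′ → ¬ p ~ r
          busy {p} p∈ q∈ t∈ iq it q≢t pq pt px′ pr = crowded p∈ q∈ t∈ x′∈ (T-closed p∈ pr (~⇒≢ vr ∘ sym)) q≢t
            (ne x′∉xs iq ∘ sym) (ne r∉xs iq ∘ sym) (ne x′∉xs it ∘ sym) (ne r∉xs it ∘ sym) (r≢x′ ∘ sym) pq pt px′ pr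
          u∉xs : u ∉ xs
          u∉xs (here e) = u∉ (here e)
          u∉xs (there (here refl)) = busy x∈ y∈ z∈ iy iz (~⇒≢ yz) xy xz xx′ (~-sym ru)
          u∉xs (there (there (here refl))) = busy y∈ x∈ z∈ ix iz (~⇒≢ xz) (~-sym xy) yz (subst (y ~_) (sym x′≡y′) yy′) (~-sym ru)
          u∉xs (there (there (there (here refl)))) =
            busy z∈ x∈ y∈ ix iy (~⇒≢ xy) (~-sym xz) (~-sym yz) (subst (z ~_) (sym x′≡z′) zz′) (~-sym ru)

        minor : ∃[ p ] ∃[ q ] (p ~ q × p ∉ xs × q ∉ xs) → ⊥
        minor (p , q , pq , p∉ , q∉) =
          noK₅ B.κ pq (trans (B.κ-out p∉) (sym (B.κ-out q∉))) (v ∷ x ∷ y ∷ z ∷ x′ ∷ []) ℕₚ.≤-refl λ Q →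
            (B.apart Q (here refl) (T-nbr x∈) ∷ B.apart Q (here refl) (T-nbr y∈) ∷ B.apart Q (here refl) (T-nbr z∈)
              ∷ B.apart Q (here refl) (T-nbr x′∈) ∷ [])
            ∷ (B.apart Q ix xy ∷ B.apart Q ix xz ∷ B.apart Q ix xx′ ∷ [])
            ∷ (B.apart Q iy yz ∷ (λ e → B.apart Q iy yy′ (trans e (same Q x′∈ y′∈ x′∉xs y′∉xs))) ∷ [])
            ∷ ((λ e → B.apart Q iz zz′ (trans e (same Q x′∈ z′∈ x′∉xs z′∉xs))) ∷ []) ∷ [] ∷ []
          where
          module B = Block xs x′∉xs
          same : (Q : ClassColouring G B.κ fourColours) → ∀ {s t} → s ∈ T → t ∈ T → s ∉ xs → t ∉ xs → colour Q s ≡ colour Q t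
          same Q {s} {t} s∈ t∈ s∉ t∉ with s ≟ t
          ... | yes refl = refl
          ... | no s≢t   = B.joined Q s∉ t∉ (adjacent s∈ t∈ s∉ t∉ s≢t)

      -- The neighbours x, y, z of a are independent, hence all joined to two further vertices p, q;
      -- contracting x p and y q makes a, x, y, z pairwise adjacent.
      impossible : ⊥
      impossible = noK₅ κ (~-sym xp) (trans κ-p (sym κ-x)) (v ∷ a ∷ x ∷ y ∷ z ∷ []) ℕₚ.≤-refl unique
        where
        a∈ = T-all va K-a
        X = fresh {a} (v ∷ []) (ℕₚ.≤-trans (s≤s (s≤s z≤n)) (T-deg a∈))
        x = proj₁ X
        ax = proj₁ (proj₂ X)
        Y = fresh {a} (v ∷ x ∷ []) (ℕₚ.≤-trans (s≤s (s≤s (s≤s z≤n))) (T-deg a∈))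
        y = proj₁ Y
        ay = proj₁ (proj₂ Y)
        Z = fresh {a} (v ∷ x ∷ y ∷ []) (T-deg a∈)
        z = proj₁ Z
        az = proj₁ (proj₂ Z)
        x∈ : x ∈ T
        x∈ = T-closed a∈ ax (λ e → proj₂ (proj₂ X) (here e))
        y∈ : y ∈ T
        y∈ = T-closed a∈ ay (λ e → proj₂ (proj₂ Y) (here e))
        z∈ : z ∈ T
        z∈ = T-closed a∈ az (λ e → proj₂ (proj₂ Z) (here e))
        x≢y : x ≢ y
        x≢y e = proj₂ (proj₂ Y) (there (here (sym e)))
        x≢z : x ≢ z
        x≢z e = proj₂ (proj₂ Z) (there (here (sym e)))
        y≢z : y ≢ z
        y≢z e = proj₂ (proj₂ Z) (there (there (here (sym e))))
        x≁y = no-triangle a∈ x∈ y∈ ax ay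
        x≁z = no-triangle a∈ x∈ z∈ ax az
        y≁z = no-triangle a∈ y∈ z∈ ay az
        Pᶠ = fresh {x} (v ∷ a ∷ []) (ℕₚ.≤-trans (s≤s (s≤s (s≤s z≤n))) (T-deg x∈))
        p = proj₁ Pᶠ
        xp = proj₁ (proj₂ Pᶠ)
        Qᶠ = fresh {x} (v ∷ a ∷ p ∷ []) (T-deg x∈)
        q = proj₁ Qᶠ
        xq = proj₁ (proj₂ Qᶠ)
        p∈ : p ∈ T
        p∈ = T-closed x∈ xp (λ e → proj₂ (proj₂ Pᶠ) (here e))
        q∈ : q ∈ T
        q∈ = T-closed x∈ xq (λ e → proj₂ (proj₂ Qᶠ) (here e))
        not-x : ∀ {s u} → x ~ u → ¬ x ~ s → s ≢ u
        not-x xu x≁s refl = x≁s xu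
        yq : y ~ q
        yq = miss ((x≢y ∘ sym ∷ y≢z ∷ not-x xq x≁y ∷ []) ∷ (x≢z ∷ ~⇒≢ xq ∷ []) ∷ (not-x xq x≁z ∷ []) ∷ [] ∷ []) y∈ x∈ z∈ q∈ (x≁y ∘ ~-sym) y≁z
        zp : z ~ p
        zp = miss ((x≢z ∘ sym ∷ y≢z ∘ sym ∷ not-x xp x≁z ∷ []) ∷ (x≢y ∷ ~⇒≢ xp ∷ []) ∷ (not-x xp x≁y ∷ []) ∷ [] ∷ []) z∈ x∈ y∈ p∈ (x≁z ∘ ~-sym) (y≁z ∘ ~-sym)
        zq : z ~ q
        zq = miss ((x≢z ∘ sym ∷ y≢z ∘ sym ∷ not-x xq x≁z ∷ []) ∷ (x≢y ∷ ~⇒≢ xq ∷ []) ∷ (not-x xq x≁y ∷ []) ∷ [] ∷ []) z∈ x∈ y∈ q∈ (x≁z ∘ ~-sym) (y≁z ∘ ~-sym)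
        p≢q : p ≢ q
        p≢q e = proj₂ (proj₂ Qᶠ) (there (there (here (sym e))))
        κ : Fin n → Fin n
        κ = send₂ p x q y
        κ-p : κ p ≡ x
        κ-p = send₂-first p x q y
        κ-q : κ q ≡ y
        κ-q = send₂-second x y p≢q
        κ-id : ∀ {u} → u ≢ p → u ≢ q → κ u ≡ u
        κ-id = send₂-other x y
        κ-v : κ v ≡ v
        κ-v = κ-id (λ { e → proj₂ (proj₂ Pᶠ) (here (sym e)) }) (λ e → proj₂ (proj₂ Qᶠ) (here (sym e)))
        κ-a : κ a ≡ a
        κ-a = κ-id (λ { e → proj₂ (proj₂ Pᶠ) (there (here (sym e))) }) (λ e → proj₂ (proj₂ Qᶠ) (there (here (sym e))))
        κ-x : κ x ≡ x
        κ-x = κ-id (~⇒≢ xp) (~⇒≢ xq)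
        κ-y : κ y ≡ y
        κ-y = κ-id (not-x xp x≁y) (not-x xq x≁y)
        κ-z : κ z ≡ z
        κ-z = κ-id (not-x xp x≁z) (not-x xq x≁z)
        unique : (Q : ClassColouring G κ fourColours) → Unique (map (colour Q) (v ∷ a ∷ x ∷ y ∷ z ∷ []))
        unique Q = (ap κ-v κ-a va ∷ ap κ-v κ-x (T-nbr x∈) ∷ ap κ-v κ-y (T-nbr y∈) ∷ ap κ-v κ-z (T-nbr z∈) ∷ [])
          ∷ (ap κ-a κ-x ax ∷ ap κ-a κ-y ay ∷ ap κ-a κ-z az ∷ [])
          -- After the contraction the edges `x q`, `z p` and `z q` join `x` to `y`, `x` to `z` and
          -- `y` to `z`.
          ∷ ((λ e → distinct Q xq (λ k → x≢y (trans (sym κ-x) (trans k κ-q))) (trans e (constant Q yq (trans κ-y (sym κ-q)))))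
            ∷ (λ e → distinct Q zp (λ k → x≢z (sym (trans (sym κ-z) (trans k κ-p)))) (trans (sym e) (constant Q xp (trans κ-x (sym κ-p))))) ∷ [])
          ∷ ((λ e → distinct Q zq (λ k → y≢z (sym (trans (sym κ-z) (trans k κ-q)))) (trans (sym e) (constant Q yq (trans κ-y (sym κ-q))))) ∷ [])
          ∷ [] ∷ []
          where
          ap : ∀ {s t} → κ s ≡ s → κ t ≡ t → s ~ t → colour Q s ≢ colour Q t
          ap ks kt st = distinct Q st λ e → ~⇒≢ st (trans (sym ks) (trans e kt))

-- Faces around a vertex of degree six

module Corners {n : ℕ} (M : PlaneMap 4 n) {v : Fin n} where

  private
    G = graph M
    ρ = rotation M
  open Faces G ρ

  face≡⇒orbit : ∀ {d e} → Dart d → Dart e → face d ≡ face e → ∃[ m ] iter ϕ m d ≡ e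
  face≡⇒orbit {d} {e} dd de eq with face-orbit d | face-orbit e
  ... | k , ek | j , ej with orbit-sym de j
  ...   | m , back = m + k , trans (iter-+ ϕ m k d) (trans (cong (iter ϕ m) (trans (sym ek) (trans eq ej))) back)

  -- The face of the dart `v w` is followed until it comes back to `v`, at the latest after one
  -- period. It arrives from `u` and turns into the corner after `u`.
  first-return : ∀ {S : Fin n → Set} {w} → v ~ w → (∀ m → proj₁ (iter ϕ m (v , w)) ≢ v → S (proj₁ (iter ϕ m (v , w)))) →
                 ∃[ u ] (v ~ u × Walk G S w u × face (v , rot ρ v u) ≡ face (v , w))
  first-return {S} {w} vw on = run p 0 (ℕₚ.+-identityʳ p) (end (on 1 w≢v)) w≢v
    where
    d : ℕ → Fin n × Fin n
    d m = iter ϕ m (v , w)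
    w≢v = ~⇒≢ vw ∘ sym
    p = proj₁ (period {v , w} vw)
    run : ∀ fuel m → fuel + m ≡ p → Walk G S w (proj₂ (d m)) → proj₂ (d m) ≢ v →
          ∃[ u ] (v ~ u × Walk G S w u × face (v , rot ρ v u) ≡ face (v , w))
    run zero m refl walk ne = ⊥-elim (ne (cong proj₁ (proj₂ (proj₂ (period {v , w} vw)))))
    run (suc fuel) m e walk ne with proj₂ (d (suc m)) ≟ v
    ... | no ne′ = run fuel (suc m) (trans (ℕₚ.+-suc fuel m) e)
                     (walk-snoc walk (iter-ϕ-dart (suc m) {v , w} vw) (on (suc (suc m)) ne′)) ne′
    ... | yes eq = proj₂ (d m) , ~-sym (subst (proj₂ (d m) ~_) eq (iter-ϕ-dart (suc m) {v , w} vw)) , walk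
                 , trans (cong (λ z → face (z , rot ρ z (proj₂ (d m)))) (sym eq)) (face-iter {v , w} vw (suc (suc m)))

  -- `face (v , a)` is the face in the corner before `a`. The condition compares the two ends of a
  -- run of `l + 1` neighbours, and minimality ranges over all starting neighbours, so no shorter
  -- stretch inside the run returns to its face.
  ShortestReturn : Set
  ShortestReturn = ∃[ a ] ∃[ l ] (v ~ a × face (v , a) ≡ face (v , iter (rot ρ v) (suc l) a) ×
    (∀ {a′ l′} → v ~ a′ → l′ < l → face (v , a′) ≢ face (v , iter (rot ρ v) (suc l′) a′)))

  shortest : ∀ fuel l {a} → l ≤ fuel → v ~ a → face (v , a) ≡ face (v , iter (rot ρ v) (suc l) a) → ShortestReturn
  shortest fuel l {a} l≤ va eq
    with Finₚ.any? (λ a′ → (v ~? a′) ×-dec ℕₚ.anyUpTo? (λ l′ → face (v , a′) ≟ᵈ face (v , iter (rot ρ v) (suc l′) a′)) l)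
  ... | no ¬p = a , l , va , eq , λ {a′} {l′} va′ l′< e → ¬p (a′ , va′ , l′ , l′< , e)
  shortest zero       l z≤n va eq | yes (_ , _ , _ , () , _)
  shortest (suc fuel) l l≤  va eq | yes (a′ , va′ , l′ , l′< , e) = shortest fuel l′ (ℕₚ.≤-pred (ℕₚ.≤-trans l′< l≤)) va′ e

  -- A full turn around `v` ends in the corner where it began, so there is a run to shorten.
  shortestReturn : ∀ {a} → v ~ a → ShortestReturn
  shortestReturn {a} va = let k , e = rot-period va in shortest k k ℕₚ.≤-refl va (cong (λ z → face (v , z)) (sym e))

module Degree6 {n : ℕ} (M : PlaneMap 4 n)
  (choose : ∀ m → m < n → (H : Graph m) → Planar H → Choosable H 4) (¬choosable : ¬ Choosable (graph M) 4)
  {v : Fin n} (deg-v : deg (graph M) v ≡ 6) {a : Fin n} (va : adj (graph M) v a ≡ true) (l : ℕ)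
  (same : Faces.face (graph M) (rotation M) (v , a) ≡
          Faces.face (graph M) (rotation M) (v , iter (rot (rotation M) v) (suc l) a))
  (minimal : ∀ {a′ l′} → adj (graph M) v a′ ≡ true → l′ < l →
     Faces.face (graph M) (rotation M) (v , a′) ≢ Faces.face (graph M) (rotation M) (v , iter (rot (rotation M) v) (suc l′) a′)) where

  private
    G = graph M
    ρ = rotation M
    L = suc l
  open Faces G ρ
  open Corners M {v}
  open Split M va l
  open Attachments M choose ¬choosable
  open Minimal M choose ¬choosable using (module Lobe)
  open Lobe va using (K; K-a; no-bridge)

  faces-differ : ∀ i d → d < l → face (v , w i) ≢ face (v , w (suc d + i))
  faces-differ i d d<l e = minimal (vw i) d<l (trans e (cong (λ z → face (v , z)) (iter-+ (rot ρ v) (suc d) i a)))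

  -- Turns two rich corners of the run into two different rich faces, and also shows that the run
  -- does not repeat a neighbour.
  faces-differ-< : ∀ {i j} → i < j → j < L → face (v , w i) ≢ face (v , w j)
  faces-differ-< {i} {j} i<j j<L = subst (λ k → face (v , w i) ≢ face (v , w k)) split
    (faces-differ i (j ∸ suc i) (ℕₚ.<-≤-trans (ℕₚ.∸-monoʳ-< {j} (s≤s z≤n) i<j) (ℕₚ.≤-pred j<L)))
    where
    split : suc (j ∸ suc i) + i ≡ j
    split = trans (sym (ℕₚ.+-suc (j ∸ suc i) i)) (ℕₚ.m∸n+n≡m i<j)

  -- A run that is a full turn contains every neighbour of `v`. Otherwise `w L` lies off the run,
  -- since its corner would repeat an earlier face, and `v` can be split along the shared face.
  arc-closed : ∀ {x z} → Arc x → v ~ z → Walk G (λ u → u ≢ v) x z → Arc z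
  arc-closed {x} {z} ax vz p with arc? z | w L ≟ a
  ... | yes az | _ = az
  ... | no ¬az | no ne = ⊥-elim (Cut.separated same ¬arc ax (vz , ¬az) p)
    where
    ¬arc : ¬ Arc (w L)
    ¬arc (zero , _ , e) = ne (sym e)
    ¬arc (suc k , k<L , e) = faces-differ-< {0} {suc k} (s≤s z≤n) k<L (trans same (cong (λ z → face (v , z)) (sym e)))
  ... | no ¬az | yes e with rot-cyc ρ v a z va vz
  ...   | k , ek = k % L , m%n<n k L , trans (sym (iter-% (rot ρ v) k L a e)) ek

  -- The vertex has to differ from `v`, which supplies the other one of large degree. The bound on
  -- `m` makes the property decidable and still covers the whole orbit.
  Rich : ℕ → Set
  Rich k = ∃[ m ] (m < n * n × proj₁ (iter ϕ m (v , w k)) ≢ v × 5 ≤ deg G (proj₁ (iter ϕ m (v , w k))))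

  rich? : ∀ k → Dec (Rich k)
  rich? k = ℕₚ.anyUpTo? (λ m → ¬? (_ ≟ v) ×-dec (5 ℕₚ.≤? deg G _)) (n * n)

  rich⇒RichFace : ∀ k → Rich k → RichFace G ρ (v , w k)
  rich⇒RichFace k (m , _ , ne , d) = _ , v , ne , (m , refl) , (0 , refl) , d , subst (5 ≤_) (sym deg-v) (ℕₚ.n≤1+n 5)

  poor : ∀ k → ¬ Rich k → ∀ m → proj₁ (iter ϕ m (v , w k)) ≢ v → S₀ va (proj₁ (iter ϕ m (v , w k)))
  poor k ¬r m ne with bounded {v , w k} (vw k) m
  ... | j , j< , e = ne , ℕₚ.≤-pred (ℕₚ.≰⇒> λ 5≤ → ¬r (j , j< , subst (_≢ v) e₁ ne , subst (λ z → 5 ≤ deg G z) e₁ 5≤))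
    where e₁ = cong proj₁ e

  w≢v : ∀ k → w k ≢ v
  w≢v k e = ~⇒≢ (vw k) (sym e)

  on-own : ∀ k → ∃[ m ] proj₁ (iter ϕ m (v , w k)) ≡ w k
  on-own k = 1 , refl

  on-next : ∀ k → ∃[ m ] proj₁ (iter ϕ m (v , w (suc k))) ≡ w k
  on-next k with orbit-sym {w k , v} (~-sym (vw k)) 1
  ... | m , e = m , cong proj₁ e

  -- The corner before `w 0` shares its face with the corner after `w l`, so the run closes up
  -- cyclically.
  on-first : ∃[ m ] proj₁ (iter ϕ m (v , w 0)) ≡ w l
  on-first with face≡⇒orbit {v , w 0} {v , w L} va (vw L) same | on-next l
  ... | k , ek | m , em = m + k , trans (cong proj₁ (trans (iter-+ ϕ m k (v , w 0)) (cong (iter ϕ m) ek))) em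

  poor-vertex : ∀ k {x} → ¬ Rich k → x ≢ v → ∃[ m ] proj₁ (iter ϕ m (v , w k)) ≡ x → S₀ va x
  poor-vertex k ¬r ne (m , refl) = poor k ¬r m ne

  twoRich : ∀ {i j} → i < j → j < L → Rich i → Rich j → TwoRichFacesAt G ρ v
  twoRich {i} {j} i<j j<L ri rj = (v , w i) , (v , w j) , vw i , vw j
    , (λ sf → faces-differ-< i<j j<L (sameFace⇒face≡ {v , w i} (vw i) sf))
    , (0 , refl) , (0 , refl) , rich⇒RichFace i ri , rich⇒RichFace j rj

  module _ (few : ∀ {i j} → i < j → j < L → Rich i → Rich j → ⊥) where

    other-poor : ∀ {i j} → i < L → j < L → i ≢ j → Rich i → ¬ Rich j
    other-poor {i} {j} i<L j<L i≢j ri rj with ℕₚ.<-cmp i j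
    ... | tri< i<j _ _ = few i<j j<L ri rj
    ... | tri≈ _ e _   = i≢j e
    ... | tri> _ _ j<i = few j<i i<L rj ri

    Link : ℕ → Set
    Link k = (∃[ j ] (suc j ≡ k × Walk G (S₀ va) (w k) (w j))) ⊎ (k ≡ 0 × Walk G (S₀ va) (w k) (w l))

    -- The face leads from `w k` back to `v` by way of some `w j`, and the corner after `w j` lies
    -- on it too. Distinctness leaves only the corner before `w k` itself, up to the shared face at
    -- the two ends of the run.
    link : ∀ {k} → k < L → ¬ Rich k → Link k
    link {k} k<L ¬r with first-return (vw k) (poor k ¬r)
    ... | u , vu , p , e with arc-closed (k , k<L , refl) vu (walk-map proj₁ p)
    ...   | j , j<L , refl with ℕₚ.<-cmp (suc j) k
    ...     | tri< lt _ _ = ⊥-elim (faces-differ-< lt k<L e)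
    ...     | tri≈ _ eq _ = inj₁ (j , eq , p)
    ...     | tri> _ _ gt with ℕₚ.m≤n⇒m<n∨m≡n j<L
    ...       | inj₁ lt   = ⊥-elim (faces-differ-< gt lt (sym e))
    ...       | inj₂ refl with k
    ...         | zero  = inj₂ (refl , p)
    ...         | suc i = ⊥-elim (faces-differ (suc i) (l ∸ suc i) (ℕₚ.∸-monoʳ-< {l} {suc i} {0} (s≤s z≤n) (ℕₚ.≤-pred k<L))
                            (trans (sym e) (cong (λ m → face (v , w m)) (sym (cong suc (ℕₚ.m∸n+n≡m (ℕₚ.≤-pred k<L)))))))

    link-suc : ∀ {k} → Link (suc k) → Walk G (S₀ va) (w (suc k)) (w k)
    link-suc (inj₁ (_ , refl , p)) = p

    link-zero : Link 0 → Walk G (S₀ va) (w 0) (w l)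
    link-zero (inj₂ (_ , p)) = p

    module _ (l>0 : 0 < l) where

      -- `w k` lies on the faces before and after it, cyclically along the run. For `l > 0` these
      -- are different corners, and at most one of them is rich.
      w-S₀ : ∀ {k} → k < L → S₀ va (w k)
      w-S₀ {k} k<L with rich? k
      ... | no ¬r = poor-vertex k ¬r (w≢v k) (on-own k)
      ... | yes r with ℕₚ.m≤n⇒m<n∨m≡n k<L
      ...   | inj₁ lt   = poor-vertex (suc k) (other-poor k<L lt (ℕₚ.<⇒≢ (ℕₚ.n<1+n k)) r) (w≢v k) (on-next k)
      ...   | inj₂ refl = poor-vertex 0 (other-poor k<L (s≤s z≤n) (λ e → ℕₚ.<⇒≢ l>0 (sym e)) r) (w≢v k) on-first

      up : ∀ k → k < L → (∀ {i} → 0 < i → i ≤ k → ¬ Rich i) → Walk G (S₀ va) (w 0) (w k)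
      up zero    k<L ¬r = end (w-S₀ k<L)
      up (suc k) k<L ¬r = walk-trans
        (up k (ℕₚ.<-trans (ℕₚ.n<1+n k) k<L) (λ pos le → ¬r pos (ℕₚ.m≤n⇒m≤1+n le)))
        (walk-sym (link-suc (link k<L (¬r (s≤s z≤n) ℕₚ.≤-refl))))

      down : ∀ d k → d + k ≡ l → Walk G (S₀ va) (w 0) (w l) → (∀ {i} → k < i → i < L → ¬ Rich i) → Walk G (S₀ va) (w 0) (w k)
      down zero    k refl p ¬r = p
      down (suc d) k e    p ¬r = walk-trans
        (down d (suc k) (trans (ℕₚ.+-suc d k) e) p (λ lt → ¬r (ℕₚ.<-trans (ℕₚ.n<1+n k) lt)))
        (link-suc (link k<L (¬r ℕₚ.≤-refl k<L)))
        where
        k<L : suc k < L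
        k<L = s≤s (subst (suc k ≤_) e (s≤s (ℕₚ.m≤n+m k d)))

      -- The links form a closed chain with at most one gap; if the gap lies between `w 0` and
      -- `w k`, the other way round is open.
      reach : ∀ {k} → k < L → Walk G (S₀ va) (w 0) (w k)
      reach {k} k<L with ℕₚ.anyUpTo? (λ i → rich? (suc i)) k
      ... | no none = up k k<L (λ { {suc i} _ i≤k r → none (i , i≤k , r) })
      ... | yes (i , i<k , r) = down (l ∸ k) k (ℕₚ.m∸n+n≡m (ℕₚ.≤-pred k<L)) first
              (λ {j} k<j j<L → other-poor i<L j<L (ℕₚ.<⇒≢ (ℕₚ.≤-<-trans i<k k<j)) r)
        where
        i<L : suc i < L
        i<L = ℕₚ.≤-<-trans i<k k<L
        first : Walk G (S₀ va) (w 0) (w l)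
        first = link-zero (link (s≤s z≤n) (other-poor i<L (s≤s z≤n) (λ ()) r))

      contradiction : ⊥
      contradiction = Attached.impossible va deg-v T T-unique T-nbr T-K T-all T-conn
        where
        T : List (Fin n)
        T = applyUpTo w L
        T-unique : Unique T
        T-unique = applyUpTo⁺₁ w L λ i<j j<L e → faces-differ-< i<j j<L (cong (λ z → face (v , z)) e)
        T-reach : ∀ {t} → t ∈ T → Walk G (S₀ va) (w 0) t
        T-reach t∈ with ∈-applyUpTo⁻ w t∈
        ... | k , k<L , refl = reach k<L
        T-nbr : ∀ {t} → t ∈ T → v ~ t
        T-nbr t∈ with ∈-applyUpTo⁻ w t∈
        ... | k , _ , refl = vw k
        T-K : ∀ {t} → t ∈ T → K t
        T-K t∈ = walk-map proj₁ (T-reach t∈)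
        T-all : ∀ {z} → v ~ z → K z → z ∈ T
        T-all vz k with arc-closed (0 , s≤s z≤n , refl) vz k
        ... | i , i<L , refl = ∈-applyUpTo⁺ w i<L
        T-conn : ∀ {s t} → s ∈ T → t ∈ T → Walk G (S₀ va) s t
        T-conn s∈ t∈ = walk-trans (walk-sym (T-reach s∈)) (T-reach t∈)

  few-rich : (∀ {i j} → i < j → j < L → Rich i → Rich j → ⊥) → ⊥
  few-rich few with 0 ℕₚ.<? l
  ... | yes l>0 = contradiction few l>0
  ... | no ¬l>0 = no-bridge only
    where
    only : ∀ {z} → v ~ z → K z → z ≡ a
    only vz k with arc-closed (0 , s≤s z≤n , refl) vz k
    ... | zero , _ , e = sym e
    ... | suc i , s≤s i<l , _ = ⊥-elim (¬l>0 (ℕₚ.≤-<-trans z≤n i<l))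

  result : TwoRichFacesAt G ρ v
  result with ℕₚ.anyUpTo? (λ j → rich? j ×-dec ℕₚ.anyUpTo? rich? j) L
  ... | yes (j , j<L , rj , i , i<j , ri) = twoRich i<j j<L ri rj
  ... | no none = ⊥-elim (few-rich λ {i} {j} i<j j<L ri rj → none (j , j<L , rj , i , i<j , ri))

theorem3 : {n : ℕ} (G : Graph n) → MinimalNon4ChoosablePlanar G →
    (ρ : Rotation G) → PlaneEmbedding G ρ →
    (v : Fin n) → deg G v ≡ 6 → TwoRichFacesAt G ρ v
theorem3 G (_ , ¬choosable , choose) ρ (conn , euler≡) v deg-v =
  let a , va , _ = Tools.fresh G {v} [] (subst (0 <_) (sym deg-v) (s≤s z≤n))
      _ , l , va′ , same , minimal = Corners.shortestReturn M va
  in Degree6.result M choose ¬choosable deg-v va′ l same minimal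
  where
  M : PlaneMap 4 _
  M = planeMap G ρ conn (ℕₚ.≤-reflexive (sym euler≡))
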